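{- Let $H=(V,E)$ be a 3-uniform hypergraph on $n$ vertices with no transversal of size less than $n/2$. Then the number of 2-colorings of $V$ under which no hyperedge of $H$ is monochromatic is at most $6^{n/4}$. Moreover, there is a randomized algorithm which, given such $H$, enumerates all these 2-colorings in expected time $\mathrm{poly}(n)\cdot 6^{n/4}$. The bound $6^{n/4}$ is tight: it is attained (for $n$ divisible by 4) by the disjoint union of $n/4$ copies of the complete 3-uniform hypergraph on 4 vertices.
   Context: A transversal of a hypergraph $H=(V,E)$ is a set of vertices that has nonempty intersection with every hyperedge. A 2-coloring is a map $V\to\{0,1\}$; a hyperedge is monochromatic if all of its vertices receive the same color. -}

module Defs where

open import Data.Bool using (Bool; true; false)
import Data.Bool.Properties as Bool
open import Data.Fin using (Fin; zero)
open import Data.Fin.Properties using (all?)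
open import Data.Fin.Subset using (Subset; _∈_; _∩_; ∣_∣; Nonempty; ⊥)
open import Data.Fin.Subset.Properties using (_∈?_)
open import Data.List using (List; []; _∷_; map; filter; foldr; length; deduplicate; cartesianProductWith)
  renaming (_++_ to _++ˡ_)
open import Data.List.Relation.Binary.Permutation.Propositional using (_↭_)
open import Data.List.Relation.Unary.All as All using (All)
import Data.List.Relation.Unary.AllPairs as AllPairs
open import Data.List.Relation.Unary.Unique.Propositional using (Unique)
import Data.List.Relation.Unary.Unique.Propositional.Properties as Unique
import Data.List.Relation.Unary.Unique.DecPropositional.Properties as UniqueDec
open import Data.Nat using (ℕ; zero; suc; _+_; _*_; _^_; _≤_; _<_; _≟_)
open import Data.Nat.ListAction using (sum)
open import Data.Product using (_×_; _,_; ∃; ∃-syntax; proj₁; proj₂)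
open import Data.Sum using (_⊎_; inj₁; inj₂)
open import Data.Vec using (Vec; []; _∷_; lookup; replicate; _++_; toList; _[_]≔_)
open import Data.Vec.Properties using (∷-injective; ≡-dec)
open import Relation.Binary.PropositionalEquality using (_≡_)
open import Relation.Nullary using (¬_; Dec; _⊎-dec_; _→-dec_; ¬?)
open import Relation.Nullary.Decidable using (map′)

-- All Boolean vectors of length n, each exactly once.  They serve as the
-- subsets of Fin n, the 2-colorings of Fin n, and the sequences of n coin tosses.
allBits : ∀ n → List (Vec Bool n)
allBits zero    = [] ∷ []
allBits (suc n) = cartesianProductWith _∷_ (false ∷ true ∷ []) (allBits n)

allBits-unique : ∀ n → Unique (allBits n)
allBits-unique zero    = All.[] AllPairs.∷ AllPairs.[]
allBits-unique (suc n) =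
  Unique.cartesianProductWith⁺ _∷_ ∷-injective
    (((λ ()) All.∷ All.[]) AllPairs.∷ (All.[] AllPairs.∷ AllPairs.[]))
    (allBits-unique n)

------------------------------------------------------------------------
-- Hypergraphs

record Hypergraph (n : ℕ) : Set where
  field
    edges    : List (Subset n)
    distinct : Unique edges

open Hypergraph public

Uniform : ∀ {n} → ℕ → Hypergraph n → Set
Uniform k H = All (λ e → ∣ e ∣ ≡ k) (edges H)

Transversal : ∀ {n} → Hypergraph n → Subset n → Set
Transversal H T = All (λ e → Nonempty (T ∩ e)) (edges H)

-- No transversal has size less than n/2.
NoSmallTransversal : ∀ {n} → Hypergraph n → Set
NoSmallTransversal {n} H = ¬ (∃[ T ] (Transversal H T × 2 * ∣ T ∣ < n))

Coloring : ℕ → Set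
Coloring = Vec Bool

Monochromatic : ∀ {n} → Coloring n → Subset n → Set
Monochromatic χ e = ∃[ c ] (∀ i → i ∈ e → lookup χ i ≡ c)

Proper : ∀ {n} → Hypergraph n → Coloring n → Set
Proper H χ = All (λ e → ¬ Monochromatic χ e) (edges H)

monochromatic? : ∀ {n} (χ : Coloring n) (e : Subset n) → Dec (Monochromatic χ e)
monochromatic? χ e = map′ to from (constant? false ⊎-dec constant? true)
  where
  Constant : Bool → Set
  Constant c = ∀ i → i ∈ e → lookup χ i ≡ c

  constant? : ∀ c → Dec (Constant c)
  constant? c = all? (λ i → (i ∈? e) →-dec (lookup χ i Bool.≟ c))

  to : Constant false ⊎ Constant true → Monochromatic χ e
  to (inj₁ p) = false , p
  to (inj₂ p) = true  , p

  from : Monochromatic χ e → Constant false ⊎ Constant true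
  from (false , p) = inj₁ p
  from (true  , p) = inj₂ p

proper? : ∀ {n} (H : Hypergraph n) (χ : Coloring n) → Dec (Proper H χ)
proper? H χ = All.all? (λ e → ¬? (monochromatic? χ e)) (edges H)

properColorings : ∀ {n} → Hypergraph n → List (Coloring n)
properColorings {n} H = filter (proper? H) (allBits n)

numProperColorings : ∀ {n} → Hypergraph n → ℕ
numProperColorings H = length (properColorings H)

complete : ∀ k n → Hypergraph n
complete k n = record
  { edges    = filter (λ e → ∣ e ∣ ≟ k) (allBits n)
  ; distinct = Unique.filter⁺ (λ e → ∣ e ∣ ≟ k) (allBits-unique n)
  }

-- The vertices of G come first, followed by those of H.  The only edge the
-- two families can share is the empty one, hence the deduplication.
_⊕_ : ∀ {m n} → Hypergraph m → Hypergraph n → Hypergraph (m + n)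
_⊕_ {m} {n} G H = record
  { edges    = deduplicate (≡-dec Bool._≟_) es
  ; distinct = UniqueDec.deduplicate-! (≡-dec Bool._≟_) es
  }
  where
  es : List (Subset (m + n))
  es = map (_++ ⊥ {n}) (edges G) ++ˡ map (⊥ {m} ++_) (edges H)

copies : ∀ {n} m → Hypergraph n → Hypergraph (m * n)
copies zero    H = record { edges = [] ; distinct = AllPairs.[] }
copies (suc m) H = H ⊕ copies m H

------------------------------------------------------------------------
-- Randomized computation
--
-- The machine model is Jones's WHILE language over binary trees, extended by
-- an instruction tossing a fair coin.  A tree is either the atom nil or a
-- pair; trees are built and inspected only by cons, hd and tl, which are
-- constant-time pointer operations (a pair stores two pointers).

data Tree : Set where
  nil : Tree
  _∙_ : Tree → Tree → Tree

infixr 5 _∙_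

hdᵗ : Tree → Tree
hdᵗ nil     = nil
hdᵗ (s ∙ t) = s

tlᵗ : Tree → Tree
tlᵗ nil     = nil
tlᵗ (s ∙ t) = t

data Exp (v : ℕ) : Set where
  var  : Fin v → Exp v
  `nil : Exp v
  cons : Exp v → Exp v → Exp v
  hd   : Exp v → Exp v
  tl   : Exp v → Exp v

infix  6 _:=_
infixr 4 _⨾_

data Cmd (v : ℕ) : Set where
  _:=_          : Fin v → Exp v → Cmd v
  toss          : Fin v → Cmd v
  _⨾_           : Cmd v → Cmd v → Cmd v
  if_then_else_ : Exp v → Cmd v → Cmd v → Cmd v
  while_loop_     : Exp v → Cmd v → Cmd v

Store : ℕ → Set
Store = Vec Tree

eval : ∀ {v} → Exp v → Store v → Tree
eval (var x)    σ = lookup σ x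
eval `nil       σ = nil
eval (cons d e) σ = eval d σ ∙ eval e σ
eval (hd e)     σ = hdᵗ (eval e σ)
eval (tl e)     σ = tlᵗ (eval e σ)

encodeBool : Bool → Tree
encodeBool false = nil
encodeBool true  = nil ∙ nil

-- The commands still to be executed, and the current store.
Config : ℕ → Set
Config v = List (Cmd v) × Store v

-- One unit of time.  The expressions are fixed parts of the program, so each
-- unit stands for a number of tree operations bounded by a constant depending
-- only on the program.  One fresh coin is supplied per step, and it is ignored
-- by every command other than toss.  A test succeeds on every tree but nil.
step : ∀ {v} → Bool → Config v → Config v
step b ([] , σ)             = [] , σ
step b ((x := e) ∷ K , σ)   = K , σ [ x ]≔ eval e σ
step b (toss x ∷ K , σ)     = K , σ [ x ]≔ encodeBool b
step b ((c ⨾ d) ∷ K , σ)    = c ∷ d ∷ K , σ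
step b ((if e then c else d) ∷ K , σ) with eval e σ
... | nil   = d ∷ K , σ
... | _ ∙ _ = c ∷ K , σ
step b ((while e loop c) ∷ K , σ) with eval e σ
... | nil   = K , σ
... | _ ∙ _ = c ∷ (while e loop c) ∷ K , σ

run : ∀ {v k} → Vec Bool k → Config v → Config v
run []       C = C
run (b ∷ bs) C = run bs (step b C)

-- The number of steps until the machine halts, truncated at k = length of the
-- coin sequence.
time : ∀ {v k} → Vec Bool k → Config v → ℕ
time []       C              = 0
time (b ∷ bs) ([] , σ)       = 0
time (b ∷ bs) C@(_ ∷ _ , _)  = suc (time bs (step b C))

record Program : Set where
  field
    extra : ℕ
    code  : Cmd (suc extra)

  -- Variable zero holds the input at the start and the output at the end;
  -- all other variables are initially nil.
  start : Tree → Config (suc extra)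
  start t = code ∷ [] , t ∷ replicate extra nil

-- Whatever the coins, if the program halts on input t, its output satisfies Q.
Outputs : Program → Tree → (Tree → Set) → Set
Outputs A t Q = ∀ {k} (r : Vec Bool k) →
  proj₁ (run r (start t)) ≡ [] → Q (lookup (proj₂ (run r (start t))) zero)
  where open Program A

-- E[T]⁴ ≤ B, where T is the running time on input t.  As k grows, E[min(T,k)]
-- increases to E[T], and E[min(T,k)] is the sum below divided by 2ᵏ.  In
-- particular T is finite with probability one.  The fourth power is there
-- because the bounds of interest are of the form p · 6^(n/4).
ExpectedTime⁴≤ : Program → Tree → ℕ → Set
ExpectedTime⁴≤ A t B = ∀ k →
  sum (map (λ r → time r (start t)) (allBits k)) ^ 4 ≤ (2 ^ k) ^ 4 * B
  where open Program A

------------------------------------------------------------------------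
-- Encodings

encodeList : ∀ {A : Set} → (A → Tree) → List A → Tree
encodeList f = foldr (λ x t → f x ∙ t) nil

encodeℕ : ℕ → Tree
encodeℕ zero    = nil
encodeℕ (suc n) = nil ∙ encodeℕ n

encodeBits : ∀ {n} → Vec Bool n → Tree
encodeBits v = encodeList encodeBool (toList v)

-- The number of vertices in unary, followed by the list of the edges as
-- characteristic vectors.  For 3-uniform hypergraphs this has size polynomial
-- in n, since the edges are distinct.
encodeHypergraph : ∀ {n} → Hypergraph n → Tree
encodeHypergraph {n} H = encodeℕ n ∙ encodeList encodeBits (edges H)

-- The output lists every proper coloring of H exactly once, in any order.
EnumeratesProperColorings : Program → ∀ {n} → Hypergraph n → Set
EnumeratesProperColorings A H = Outputs A (encodeHypergraph H) λ t →
  ∃[ L ] (L ↭ properColorings H × t ≡ encodeList encodeBits L)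

{-# OPTIONS --safe #-}

-- No transversal is smaller than n/2, so both color classes of a proper coloring are transversals
-- of size exactly n/2; in particular the color-1 class C is a minimal transversal, that is, each of
-- its vertices is the only vertex of C in some edge (a private edge).  It is therefore enough to
-- enumerate the proper colorings with this property, by branching on the colors of a few vertices
-- at a time.  Let a vertex of color 1 cost a factor 1/2 and a vertex of color 0 a factor √(2/3).
-- Whatever the partial coloring, some branching rule turns it into extensions of total cost at most
-- 1, and of cost at most 0.845, 0.7142 or 0.612 when one, two or three (not forming a triangle)
-- edges with a vertex of color 0 and two uncolored ones (two-clauses) are present; uncolored vertices of degree at least 3
-- create enough two-clauses when they get color 0, and low degrees make private edges restrictive.
-- A leaf costs 2^(-n/2) (2/3)^(n/4) = 6^(-n/4), so there are at most 6^(n/4) of them.  The branching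
-- is deterministic: the program tosses no coin.
module Submission where

open import Defs
open import Data.Bool using (Bool; true; false)
open import Data.Empty using (⊥-elim)
open import Data.List using (List; []; _∷_; map; length)
open import Data.List.Membership.Propositional using (_∈_)
open import Data.Product using (_×_; _,_; proj₁; proj₂; ∃-syntax)
open import Data.Sum using (_⊎_; inj₁; inj₂)
open import Data.Unit using (⊤; tt)
open import Data.Vec using (Vec; []; _∷_; lookup)
open import Relation.Binary.PropositionalEquality hiding ([_])
open import Relation.Nullary using (¬_; Dec; yes; no)
open import Data.Nat using (ℕ; suc; _*_; _^_; _≤_)

-- The two costs are forced by the situations in which nothing may be lost. Let a and b be the costs
-- of colors 1 and 0. An isolated live edge has exactly one vertex of color 1, hence three branches
-- of cost ab², and a total of 1 means 3ab² = 1. The complete hypergraph on four vertices has six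
-- proper colorings of cost a²b², so 6a²b² = 1. Together these give a = 1/2 and b² = 2/3. Other
-- branchings may lean on the clauses they leave behind, and this is why the bound depends on the
-- class of a state. As b is irrational, all estimates compare fourth powers. The leaf cost is exact
-- only if neither color exceeds n/2, so a state carries a budget for each color and is cut off when
-- one is overdrawn. Such dead states have no weight of their own; in the running time they are
-- charged to their parents. The conditions of the rules are formulas with two readings, a
-- proposition on which the case analysis rests and a query that the machine executes. Hence a
-- single search tree yields both the bound and the algorithm.

-- Compiling tree queries into WHILE programs, with step bounds

module Machine where

  open import Data.Fin using (zero; suc)
  open import Data.Nat
  open import Data.Nat.Properties

  infix 3 _⊢_⇒_within_

  -- Demanding the same successor under either coin makes running time and result independent of the
  -- coin sequence.
  data Steps : ℕ → Config 1 → Config 1 → Set where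
    done : ∀ {C} → Steps 0 C C
    next : ∀ {c K σ D C k} → (∀ b → step b (c ∷ K , σ) ≡ D) → Steps k D C → Steps (suc k) (c ∷ K , σ) C

  _>>_ : ∀ {j k C D E} → Steps j C D → Steps k D E → Steps (j + k) C E
  done     >> q = q
  next e p >> q = next e (p >> q)

  -- The quantification over the continuation `K` is what makes the judgement compose; the step
  -- count must not depend on it.
  _⊢_⇒_within_ : Cmd 1 → Tree → Tree → ℕ → Set
  c ⊢ t ⇒ u within b = ∃[ k ] (k ≤ b × ∀ K → Steps k (c ∷ K , t ∷ []) (K , u ∷ []))

  ev : Exp 1 → Tree → Tree
  ev e t = eval e (t ∷ [])

  weaken : ∀ {c t u b b'} → b ≤ b' → c ⊢ t ⇒ u within b → c ⊢ t ⇒ u within b'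
  weaken le (k , k≤b , p) = k , ≤-trans k≤b le , p

  assign : ∀ {e t u} → ev e t ≡ u → (zero := e) ⊢ t ⇒ u within 1
  assign refl = 1 , ≤-refl , λ K → next (λ _ → refl) done

  seq : ∀ {c d t u w b b'} → c ⊢ t ⇒ u within b → d ⊢ u ⇒ w within b' → (c ⨾ d) ⊢ t ⇒ w within suc (b + b')
  seq (k , le , p) (k' , le' , p') =
    suc (k + k') , s≤s (+-mono-≤ le le') , λ K → next (λ _ → refl) (p _ >> p' K)

  if-nil : ∀ {e c d t u b} → ev e t ≡ nil → d ⊢ t ⇒ u within b → (if e then c else d) ⊢ t ⇒ u within suc b
  if-nil {e} {c} {d} {t} eq (k , le , p) = suc k , s≤s le , λ K → next (λ b → lem b K) (p K)
    where
    lem : ∀ b K → step b ((if e then c else d) ∷ K , t ∷ []) ≡ (d ∷ K , t ∷ [])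
    lem b K rewrite eq = refl

  if-cons : ∀ {e c d t u b x y} → ev e t ≡ x ∙ y → c ⊢ t ⇒ u within b → (if e then c else d) ⊢ t ⇒ u within suc b
  if-cons {e} {c} {d} {t} eq (k , le , p) = suc k , s≤s le , λ K → next (λ b → lem b K) (p K)
    where
    lem : ∀ b K → step b ((if e then c else d) ∷ K , t ∷ []) ≡ (c ∷ K , t ∷ [])
    lem b K rewrite eq = refl

  while-nil : ∀ {e c t} → ev e t ≡ nil → (while e loop c) ⊢ t ⇒ t within 1
  while-nil {e} {c} {t} eq = 1 , ≤-refl , λ K → next (λ b → lem b K) done
    where
    lem : ∀ b K → step b ((while e loop c) ∷ K , t ∷ []) ≡ (K , t ∷ [])
    lem b K rewrite eq = refl

  while-cons : ∀ {e c t u w b b' x y} → ev e t ≡ x ∙ y → c ⊢ t ⇒ u within b →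
    (while e loop c) ⊢ u ⇒ w within b' → (while e loop c) ⊢ t ⇒ w within suc (b + b')
  while-cons {e} {c} {t} eq (k , le , p) (k' , le' , p') =
    suc (k + k') , s≤s (+-mono-≤ le le') , λ K → next (λ b → lem b K) (p _ >> p' K)
    where
    lem : ∀ b K → step b ((while e loop c) ∷ K , t ∷ []) ≡ (c ∷ (while e loop c) ∷ K , t ∷ [])
    lem b K rewrite eq = refl

  size : Tree → ℕ
  size nil     = 1
  size (s ∙ t) = suc (size s + size t)

  spine : Tree → ℕ
  spine nil     = 0
  spine (s ∙ t) = suc (spine t)

  spine≤size : ∀ t → spine t ≤ size t
  spine≤size nil     = z≤n
  spine≤size (s ∙ t) = s≤s (≤-trans (spine≤size t) (m≤n+m _ _))

  data Path : Set where
    top     : Path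
    hdᵖ tlᵖ : Path → Path

  at : Path → Tree → Tree
  at top     t = t
  at (hdᵖ p) t = hdᵗ (at p t)
  at (tlᵖ p) t = tlᵗ (at p t)

  path : Path → Exp 1 → Exp 1
  path top     e = e
  path (hdᵖ p) e = hd (path p e)
  path (tlᵖ p) e = tl (path p e)

  ev-path : ∀ p e t → ev (path p e) t ≡ at p (ev e t)
  ev-path top     e t = refl
  ev-path (hdᵖ p) e t = cong hdᵗ (ev-path p e t)
  ev-path (tlᵖ p) e t = cong tlᵗ (ev-path p e t)

  size-at : ∀ p t → size (at p t) ≤ size t
  size-at top     t = ≤-refl
  size-at (hdᵖ p) t = ≤-trans (lem (at p t)) (size-at p t)
    where
    lem : ∀ s → size (hdᵗ s) ≤ size s
    lem nil     = ≤-refl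
    lem (a ∙ b) = m≤n⇒m≤1+n (m≤m+n _ _)
  size-at (tlᵖ p) t = ≤-trans (lem (at p t)) (size-at p t)
    where
    lem : ∀ s → size (tlᵗ s) ≤ size s
    lem nil     = ≤-refl
    lem (a ∙ b) = m≤n⇒m≤1+n (m≤n+m _ _)

  -- Tree-valued queries on a state ctx ∙ big, where ctx = env ∙ glob.  The value
  -- nil counts as failure.  Only ctx is ever traversed, so the running time
  -- does not depend on big.
  data Query : Set where
    out   : Exp 1 → Query
    drop  : Path → Path → Path → Query
    _&_   : Query → Query → Query
    _∥_   : Query → Query → Query
    neg   : Query → Query
    first : Path → Query → Query

  -- Serves both for comparing unary numbers and for indexing a bit vector by a unary position.
  dropᵗ : Tree → Tree → Tree
  dropᵗ a nil     = a
  dropᵗ a (_ ∙ b) = dropᵗ (tlᵗ a) b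

  ifᵗ_then_else_ : Tree → Tree → Tree → Tree
  ifᵗ nil   then _ else y = y
  ifᵗ _ ∙ _ then x else _ = x

  orᵗ : Tree → Tree → Tree
  orᵗ nil     y = y
  orᵗ (a ∙ b) _ = a ∙ b

  -- The bound variable runs through the nonempty suffixes of a list.
  firstᵗ : (Tree → Tree) → Tree → Tree
  firstᵗ f nil     = nil
  firstᵗ f (a ∙ b) = orᵗ (f (a ∙ b)) (firstᵗ f b)

  value : Query → Tree → Tree → Tree
  value (out e)      c b = ev e (c ∙ b)
  value (drop p q r) c b = at r (dropᵗ (at p c) (at q c))
  value (φ & ψ)      c b = ifᵗ value φ c b then value ψ c b else nil
  value (φ ∥ ψ)      c b = orᵗ (value φ c b) (value ψ c b)
  value (neg φ)      c b = ifᵗ value φ c b then nil else (nil ∙ nil)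
  value (first p φ)  c b = firstᵗ (λ x → value φ ((x ∙ hdᵗ c) ∙ tlᵗ c) b) (at p c)

  X : Exp 1
  X = var zero

  -- The compiled command puts the value in front of an otherwise unchanged state. For `first`, the
  -- rest of the list sits on top of the environment, where the body sees it as the newest variable;
  -- a success replaces it by `nil`, which ends the loop.
  compile : Query → Cmd 1
  compile (out e)      = zero := cons e X
  compile (drop p q r) = (zero := cons (cons (path p (hd X)) (path q (hd X))) X)
                       ⨾ (while tl (hd X) loop (zero := cons (cons (tl (hd (hd X))) (tl (tl (hd X)))) (tl X)))
                       ⨾ (zero := cons (path r (hd (hd X))) (tl X))
  compile (φ & ψ)      = compile φ ⨾ (if hd X then (zero := tl X ⨾ compile ψ) else (zero := X))
  compile (φ ∥ ψ)      = compile φ ⨾ (if hd X then (zero := X) else (zero := tl X ⨾ compile ψ))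
  compile (neg φ)      = compile φ ⨾ (if hd X then (zero := cons `nil (tl X)) else (zero := cons (cons `nil `nil) (tl X)))
  compile (first p φ)  =
      (zero := cons `nil (cons (cons (cons (path p (hd X)) (hd (hd X))) (tl (hd X))) (tl X)))
    ⨾ (while hd (hd (hd (tl X))) loop
         ( (zero := tl X)
         ⨾ compile φ
         ⨾ (if hd X
            then (zero := cons (hd X) (cons (cons (cons `nil (tl (hd (hd (tl X))))) (tl (hd (tl X)))) (tl (tl X))))
            else (zero := cons `nil (cons (cons (cons (tl (hd (hd (hd (tl X))))) (tl (hd (hd (tl X))))) (tl (hd (tl X)))) (tl (tl X)))))))
    ⨾ (zero := cons (hd X) (cons (cons (tl (hd (hd (tl X)))) (tl (hd (tl X)))) (tl (tl X))))

  -- Here `s` bounds the size of the context. The variable bound by `first` is a part of the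
  -- context, so below it the bound doubles, up to one node.
  cost : Query → ℕ → ℕ
  cost (out e)      s = 1
  cost (drop p q r) s = 5 + 2 * s
  cost (φ & ψ)      s = 5 + cost φ s + cost ψ s
  cost (φ ∥ ψ)      s = 5 + cost φ s + cost ψ s
  cost (neg φ)      s = 3 + cost φ s
  cost (first p φ)  s = 5 + s * (6 + cost φ (suc s + s))

  drop-loop : ∀ a b t → (while tl (hd X) loop (zero := cons (cons (tl (hd (hd X))) (tl (tl (hd X)))) (tl X)))
    ⊢ (a ∙ b) ∙ t ⇒ (dropᵗ a b ∙ nil) ∙ t within suc (spine b * 2)
  drop-loop a nil     t = while-nil refl
  drop-loop a (x ∙ b) t =
    while-cons refl (assign refl) (drop-loop (tlᵗ a) b t)

  compile-correct : ∀ φ e g big s → size (e ∙ g) ≤ s →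
    compile φ ⊢ (e ∙ g) ∙ big ⇒ value φ (e ∙ g) big ∙ ((e ∙ g) ∙ big) within cost φ s
  compile-correct (out x) e g big s le = assign refl
  compile-correct (drop p q r) e g big s le = weaken bound 
      (seq (assign eq₁) (seq (drop-loop (at p c) (at q c) (c ∙ big)) (assign eq)))
    where
    c = e ∙ g
    eq₁ : (ev (path p (hd X)) (c ∙ big) ∙ ev (path q (hd X)) (c ∙ big)) ∙ (c ∙ big) ≡ (at p c ∙ at q c) ∙ (c ∙ big)
    eq₁ = cong₂ (λ a b → (a ∙ b) ∙ (c ∙ big)) (ev-path p (hd X) (c ∙ big)) (ev-path q (hd X) (c ∙ big))
    eq : ev (path r (hd (hd X))) ((dropᵗ (at p c) (at q c) ∙ nil) ∙ (c ∙ big)) ∙ (c ∙ big)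
         ≡ at r (dropᵗ (at p c) (at q c)) ∙ (c ∙ big)
    eq = cong (_∙ (c ∙ big)) (ev-path r (hd (hd X)) ((dropᵗ (at p c) (at q c) ∙ nil) ∙ (c ∙ big)))
    open ≤-Reasoning
    bound : suc (1 + suc (suc (spine (at q c) * 2) + 1)) ≤ 5 + 2 * s
    bound = begin
      suc (1 + suc (suc (spine (at q c) * 2) + 1)) ≡⟨ cong (4 +_) (+-comm _ 1) ⟩
      5 + spine (at q c) * 2                       ≡⟨ cong (5 +_) (*-comm (spine (at q c)) 2) ⟩
      5 + 2 * spine (at q c)
        ≤⟨ +-monoʳ-≤ 5 (*-monoʳ-≤ 2 (≤-trans (spine≤size (at q c)) (≤-trans (size-at q c) le))) ⟩
      5 + 2 * s ∎
  compile-correct (φ & ψ) e g big s le with value φ (e ∙ g) big in eq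
  ... | nil = weaken (bound (cost φ s) (cost ψ s))
      (seq (compile-correct φ e g big s le) (if-nil eq (assign (cong (_∙ _) eq))))
    where
    bound : ∀ a b → suc (a + 2) ≤ 5 + a + b
    bound a b = s≤s (≤-trans (≤-reflexive (+-comm a 2)) (≤-trans (+-monoˡ-≤ a {2} {4} (s≤s (s≤s z≤n))) (m≤m+n _ b)))
  ... | _ ∙ _ = weaken (bound (cost φ s) (cost ψ s))
      (seq (compile-correct φ e g big s le) (if-cons eq (seq (assign refl) (compile-correct ψ e g big s le))))
    where
    bound : ∀ a b → suc (a + suc (suc (1 + b))) ≤ 5 + a + b
    bound a b = ≤-trans (≤-reflexive (cong suc (trans (+-suc a _) (cong suc (trans (+-suc a _) (cong suc (+-suc a b))))))) (n≤1+n _)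
  compile-correct (φ ∥ ψ) e g big s le with value φ (e ∙ g) big in eq
  ... | nil = weaken (bound (cost φ s) (cost ψ s))
      (seq (compile-correct φ e g big s le) (if-nil eq (seq (assign refl) (compile-correct ψ e g big s le))))
    where
    bound : ∀ a b → suc (a + suc (suc (1 + b))) ≤ 5 + a + b
    bound a b = ≤-trans (≤-reflexive (cong suc (trans (+-suc a _) (cong suc (trans (+-suc a _) (cong suc (+-suc a b))))))) (n≤1+n _)
  ... | _ ∙ _ = weaken (bound (cost φ s) (cost ψ s))
      (seq (compile-correct φ e g big s le) (if-cons eq (assign (cong (_∙ _) eq))))
    where
    bound : ∀ a b → suc (a + 2) ≤ 5 + a + b
    bound a b = s≤s (≤-trans (≤-reflexive (+-comm a 2)) (≤-trans (+-monoˡ-≤ a {2} {4} (s≤s (s≤s z≤n))) (m≤m+n _ b)))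
  compile-correct (neg φ) e g big s le with value φ (e ∙ g) big in eq
  ... | nil   = weaken (≤-reflexive (cong suc (+-comm _ 2))) (seq (compile-correct φ e g big s le) (if-nil eq (assign refl)))
  ... | _ ∙ _ = weaken (≤-reflexive (cong suc (+-comm _ 2))) (seq (compile-correct φ e g big s le) (if-cons eq (assign refl)))
  compile-correct (first p φ) e g big s le = weaken bound
      (seq (assign (cong (λ u → nil ∙ (((u ∙ e) ∙ g) ∙ big)) (ev-path p (hd X) (c ∙ big))))
           (seq (iterate (at p c) (≤-trans (size-at p c) le)) (assign refl)))
    where
    c = e ∙ g
    f : Tree → Tree
    f x = value φ ((x ∙ e) ∙ g) big
    m = cost φ (suc s + s)
    body : Cmd 1
    body =  (zero := tl X)
         ⨾ compile φ
         ⨾ (if hd X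
            then (zero := cons (hd X) (cons (cons (cons `nil (tl (hd (hd (tl X))))) (tl (hd (tl X)))) (tl (tl X))))
            else (zero := cons `nil (cons (cons (cons (tl (hd (hd (hd (tl X))))) (tl (hd (hd (tl X))))) (tl (hd (tl X)))) (tl (tl X)))))
    small : ∀ x → size x ≤ s → size ((x ∙ e) ∙ g) ≤ suc s + s
    small x le' = ≤-trans (≤-reflexive (trans (cong (λ k → suc (suc k)) (+-assoc (size x) (size e) (size g)))
                                       (cong suc (sym (+-suc (size x) _)))))
                    (s≤s (+-mono-≤ le' le))
    stop : ∀ r → (while hd (hd (hd (tl X))) loop body) ⊢ r ∙ (((nil ∙ e) ∙ g) ∙ big) ⇒ r ∙ (((nil ∙ e) ∙ g) ∙ big) within 1
    stop r = while-nil refl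
    iterate : ∀ x → size x ≤ s → (while hd (hd (hd (tl X))) loop body) ⊢ nil ∙ (((x ∙ e) ∙ g) ∙ big)
             ⇒ firstᵗ f x ∙ (((nil ∙ e) ∙ g) ∙ big) within suc (spine x * (6 + m))
    iterate nil     le' = while-nil refl
    iterate (a ∙ b) le' with f (a ∙ b) in eq
    ... | nil = weaken (b₁ (spine b * (6 + m)))
        (while-cons refl (seq (assign refl) (seq (compile-correct φ _ _ big _ (small (a ∙ b) le')) (if-nil eq (assign refl))))
          (iterate b (≤-trans (m≤n⇒m≤1+n (m≤n+m _ _)) le')))
      where
      b₁ : ∀ k → suc (suc (1 + suc (m + 2)) + suc k) ≤ suc (6 + m + k)
      b₁ k = s≤s (≤-reflexive (trans (cong (λ z → suc (suc (suc (z + suc k)))) (+-comm m 2)) (cong (λ z → 5 + z) (+-suc m k))))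
    ... | _ ∙ _ = weaken (b₁ (spine b * (6 + m)))
        (while-cons refl (seq (assign refl) (seq (compile-correct φ _ _ big _ (small (a ∙ b) le')) (if-cons eq (assign (cong (_∙ (((nil ∙ e) ∙ g) ∙ big)) eq)))))
          (stop _))
      where
      b₁ : ∀ k → suc (suc (1 + suc (m + 2)) + 1) ≤ suc (6 + m + k)
      b₁ k = s≤s (≤-trans (≤-reflexive (trans (cong (λ z → suc (suc (suc (z + 1)))) (+-comm m 2)) (cong (λ z → 5 + z) (+-comm m 1)))) (m≤m+n (6 + m) k))
    open ≤-Reasoning
    bound : suc (1 + suc (suc (spine (at p c) * (6 + m)) + 1)) ≤ 5 + s * (6 + m)
    bound = begin
      suc (1 + suc (suc (spine (at p c) * (6 + m)) + 1)) ≡⟨ cong (4 +_) (+-comm _ 1) ⟩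
      5 + spine (at p c) * (6 + m)
        ≤⟨ +-monoʳ-≤ 5 (*-monoˡ-≤ (6 + m) (≤-trans (spine≤size (at p c)) (≤-trans (size-at p c) le))) ⟩
      5 + s * (6 + m) ∎

-- Formulas and their evaluation by queries

module Formula where

  open Machine
  open import Data.Fin using (Fin; zero; suc; toℕ)
  import Data.Fin.Properties as Fin
  open import Data.List.Relation.Unary.Any as Any using (Any; here; there)
  open import Data.Nat using (ℕ; zero; suc; _≤_; _<_; z≤n; s≤s)
  import Data.Nat.Properties as ℕ
  open import Data.Sum using ([_,_])

  data IsCons : Tree → Set where
    cons : ∀ {x y} → IsCons (x ∙ y)

  -- The relation `R` ties the returned tree to the witness found. In this way the children pushed
  -- by a rule are known to belong to the very tuple that satisfies its condition.
  data Finds (t : Tree) (A : Set) (R : A → Tree → Set) : Set where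
    none  : t ≡ nil → ¬ A → Finds t A R
    found : (a : A) → R a t → IsCons t → Finds t A R

  Decides : Tree → Set → Set
  Decides t A = Finds t A (λ _ _ → ⊤)

  accept : ∀ {t A} → A → IsCons t → Decides t A
  accept a c = found a tt c

  convert : ∀ {t A B R S} → (f : A → B) → (∀ {a t} → R a t → S (f a) t) → (B → A) → Finds t A R → Finds t B S
  convert f h g (none e ¬a)   = none e (λ b → ¬a (g b))
  convert f h g (found a r c) = found (f a) (h r) c

  convert-dec : ∀ {t A B} → (A → B) → (B → A) → Decides t A → Decides t B
  convert-dec f = convert f (λ _ → tt)

  decides-neg : ∀ {t A} → Decides t A → Decides (ifᵗ t then nil else (nil ∙ nil)) (¬ A)
  decides-neg (none refl ¬a)    = accept ¬a cons
  decides-neg (found a tt cons) = none refl (λ ¬a → ¬a a)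

  finds-and : ∀ {t u A B R} → Decides t A → Finds u B R → Finds (ifᵗ t then u else nil) (A × B) (λ (_ , b) → R b)
  finds-and (none refl ¬a)    q             = none refl (λ (a , _) → ¬a a)
  finds-and (found a tt cons) (none e ¬b)   = none e (λ (_ , b) → ¬b b)
  finds-and (found a tt cons) (found b r c) = found (a , b) r c

  decides-and : ∀ {t u A B} → Decides t A → Decides u B → Decides (ifᵗ t then u else nil) (A × B)
  decides-and = finds-and

  decides-or : ∀ {t u A B} → Decides t A → Decides u B → Decides (orᵗ t u) (A ⊎ B)
  decides-or (none refl ¬a)    (none e ¬b)    = none e [ ¬a , ¬b ]
  decides-or (none refl ¬a)    (found b _ c)  = accept (inj₂ b) c
  decides-or (found a tt cons) q              = accept (inj₁ a) cons

  -- The successor makes the vertices exactly the nonempty suffixes of the unary number `n`, which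
  -- are what `first` runs through.
  vertex : ∀ {n} → Fin n → Tree
  vertex v = encodeℕ (suc (toℕ v))

  finds-vertex : ∀ n {f : Tree → Tree} {A : Fin n → Set} {R : ∀ v → A v → Tree → Set} →
    (∀ v → Finds (f (vertex v)) (A v) (R v)) →
    Finds (firstᵗ f (encodeℕ n)) (∃[ v ] A v) (λ (v , a) → R v a)
  finds-vertex n {f} {A} {R} h =
    convert (λ (v , _ , a) → v , a) (λ r → r) (λ (v , a) → v , Fin.toℕ<n v , a) (go n ℕ.≤-refl)
    where
    go : ∀ m → m ≤ n → Finds (firstᵗ f (encodeℕ m)) (∃[ v ] (toℕ v < m × A v)) (λ (v , _ , a) → R v a)
    go zero    le = none refl (λ { (_ , () , _) })
    go (suc m) le = subst (λ k → Finds (orᵗ (f (nil ∙ encodeℕ k)) (firstᵗ f (encodeℕ m))) (∃[ v ] (toℕ v < suc m × A v)) (λ (v , _ , a) → R v a)) to-v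
        (or (h v) (go m (ℕ.<⇒≤ le)))
      where
      v : Fin n
      v = Data.Fin.fromℕ< le
      to-v : toℕ v ≡ m
      to-v = Fin.toℕ-fromℕ< le
      or : ∀ {t u} → Finds t (A v) (R v) → Finds u (∃[ v ] (toℕ v < m × A v)) (λ (v , _ , a) → R v a) →
           Finds (orᵗ t u) (∃[ v ] (toℕ v < suc m × A v)) (λ (v , _ , a) → R v a)
      or (none refl ¬a) (none e ¬b) = none e λ (w , lt , a) → [ (λ lt' → ¬b (w , lt' , a))
          , (λ eq → ¬a (subst A (Fin.toℕ-injective (trans eq (sym to-v))) a)) ] (ℕ.m≤n⇒m<n∨m≡n (ℕ.≤-pred lt))
      or (none refl ¬a) (found (w , lt , a) r c) = found (w , ℕ.m≤n⇒m≤1+n lt , a) r c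
      or (found a r cons) q = found (v , s≤s (ℕ.≤-reflexive to-v) , a) r cons

  decides-list : ∀ {B : Set} (enc : B → Tree) (xs : List B) {f : Tree → Tree} {A : B → Set} →
    (∀ x ys → Decides (f (enc x ∙ ys)) (A x)) → Decides (firstᵗ f (encodeList enc xs)) (Any A xs)
  decides-list enc []       h = none refl λ ()
  decides-list enc (x ∷ xs) h = convert-dec [ here , there ] (λ { (here a) → inj₁ a ; (there q) → inj₂ q })
    (decides-or (h x _) (decides-list enc xs h))

  drop-nil : ∀ b → dropᵗ nil b ≡ nil
  drop-nil nil     = refl
  drop-nil (_ ∙ b) = drop-nil b

  drop-≰ : ∀ m n → Decides (dropᵗ (encodeℕ m) (encodeℕ n)) (¬ m ≤ n)
  drop-≰ zero    n       = none (drop-nil (encodeℕ n)) (λ h → h z≤n)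
  drop-≰ (suc m) zero    = accept (λ ()) cons
  drop-≰ (suc m) (suc n) = convert-dec (λ h p → h (ℕ.≤-pred p)) (λ h p → h (s≤s p)) (drop-≰ m n)

  drop-bits : ∀ {n} (e : Vec Bool n) (v : Fin n) → Decides (hdᵗ (dropᵗ (encodeBits e) (encodeℕ (toℕ v)))) (lookup e v ≡ true)
  drop-bits (false ∷ e) zero    = none refl λ ()
  drop-bits (true  ∷ e) zero    = accept refl cons
  drop-bits (_ ∷ e)     (suc v) = drop-bits e v

  data Fm (k : ℕ) : Set where
    always   : Fm k
    asg      : Bool → Fin k → Fm k
    edge     : Fin k → Fin k → Fin k → Fm k
    same     : Fin k → Fin k → Fm k
    spent    : Bool → Fm k
    _and_    : Fm k → Fm k → Fm k
    _or_     : Fm k → Fm k → Fm k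
    not      : Fm k → Fm k
    ex       : Fm (suc k) → Fm k

  infixr 6 _and_
  infixr 5 _or_

  -- budget b is n + 1 - 2 · (number of vertices with color b), truncated at 0.
  record State (n : ℕ) : Set where
    constructor state
    field
      log         : List (Fin n × Bool)
      ones zeros  : ℕ

    budget : Bool → ℕ
    budget true  = ones
    budget false = zeros

  open State public

  module Sem {n} (es : List (Vec Bool n)) where

    -- When all edges have size 3, an edge containing three distinct vertices consists of them, so
    -- containment is all that has to be tested.
    Edge : Fin n → Fin n → Fin n → Set
    Edge u v w = u ≢ v × v ≢ w × u ≢ w × Any (λ e → lookup e u ≡ true × lookup e v ≡ true × lookup e w ≡ true) es

    Has : State n → Bool → Fin n → Set
    Has σ b v = (v , b) ∈ log σ

    ⟦_⟧ : ∀ {k} → Fm k → State n → Vec (Fin n) k → Set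
    ⟦ always ⟧     σ ρ = ⊤
    ⟦ asg b i ⟧    σ ρ = Has σ b (lookup ρ i)
    ⟦ edge i j l ⟧ σ ρ = Edge (lookup ρ i) (lookup ρ j) (lookup ρ l)
    ⟦ same i j ⟧   σ ρ = lookup ρ i ≡ lookup ρ j
    ⟦ spent b ⟧    σ ρ = budget σ b ≡ 0
    ⟦ φ and ψ ⟧    σ ρ = ⟦ φ ⟧ σ ρ × ⟦ ψ ⟧ σ ρ
    ⟦ φ or ψ ⟧     σ ρ = ⟦ φ ⟧ σ ρ ⊎ ⟦ ψ ⟧ σ ρ
    ⟦ not φ ⟧      σ ρ = ¬ ⟦ φ ⟧ σ ρ
    ⟦ ex φ ⟧       σ ρ = ∃[ v ] ⟦ φ ⟧ σ (v ∷ ρ)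

  encodeEntry : ∀ {n} → Fin n × Bool → Tree
  encodeEntry (v , b) = vertex v ∙ encodeBool b

  encodeState : ∀ {n} → State n → Tree
  encodeState σ = encodeList encodeEntry (log σ) ∙ (encodeℕ (ones σ) ∙ encodeℕ (zeros σ))

  encodeEnv : ∀ {n k} → Vec (Fin n) k → Tree
  encodeEnv []      = nil
  encodeEnv (v ∷ ρ) = vertex v ∙ encodeEnv ρ

  context : ∀ {n k} → List (Vec Bool n) → State n → Vec (Fin n) k → Tree
  context {n} es σ ρ = encodeEnv ρ ∙ (encodeℕ n ∙ (encodeList encodeBits es ∙ encodeState σ))

  envᵖ : ℕ → Path
  envᵖ zero    = hdᵖ top
  envᵖ (suc i) = tlᵖ (envᵖ i)

  varᵖ : ℕ → Path
  varᵖ i = hdᵖ (envᵖ i)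

  verticesᵖ edgesᵖ logᵖ onesᵖ zerosᵖ : Path
  verticesᵖ = hdᵖ (tlᵖ top)
  edgesᵖ    = hdᵖ (tlᵖ (tlᵖ top))
  logᵖ      = hdᵖ (tlᵖ (tlᵖ (tlᵖ top)))
  onesᵖ     = hdᵖ (tlᵖ (tlᵖ (tlᵖ (tlᵖ top))))
  zerosᵖ    = tlᵖ (tlᵖ (tlᵖ (tlᵖ (tlᵖ top))))

  getᵠ : Path → Query
  getᵠ p = out (path p (hd X))

  sameᵠ : Path → Path → Query
  sameᵠ p q = neg (drop p q top) & neg (drop q p top)

  bitᵠ : Bool → Path → Query
  bitᵠ true  p = getᵠ p
  bitᵠ false p = neg (getᵠ p)

  memberᵠ : Path → Path → Query
  memberᵠ e v = drop e (tlᵖ v) (hdᵖ top)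

  query : ∀ {k} → Fm k → Query
  query always         = out (cons `nil `nil)
  query (asg b i)      = first logᵖ (sameᵠ (hdᵖ (hdᵖ (varᵖ 0))) (varᵖ (suc (toℕ i))) & bitᵠ b (tlᵖ (hdᵖ (varᵖ 0))))
  query (edge i j l)   = neg (sameᵠ (varᵖ (toℕ i)) (varᵖ (toℕ j))) & (neg (sameᵠ (varᵖ (toℕ j)) (varᵖ (toℕ l)))
    & (neg (sameᵠ (varᵖ (toℕ i)) (varᵖ (toℕ l))) & first edgesᵖ
      (memberᵠ (hdᵖ (varᵖ 0)) (varᵖ (suc (toℕ i))) & (memberᵠ (hdᵖ (varᵖ 0)) (varᵖ (suc (toℕ j)))
        & memberᵠ (hdᵖ (varᵖ 0)) (varᵖ (suc (toℕ l)))))))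
  query (same i j)     = sameᵠ (varᵖ (toℕ i)) (varᵖ (toℕ j))
  query (spent true)   = neg (getᵠ onesᵖ)
  query (spent false)  = neg (getᵠ zerosᵖ)
  query (φ and ψ)      = query φ & query ψ
  query (φ or ψ)       = query φ ∥ query ψ
  query (not φ)        = neg (query φ)
  query (ex φ)         = first verticesᵖ (query φ)

  at-shift : ∀ i x e g → at (envᵖ (suc i)) ((x ∙ e) ∙ g) ≡ at (envᵖ i) (e ∙ g)
  at-shift zero    x e g = refl
  at-shift (suc i) x e g = cong tlᵗ (at-shift i x e g)

  at-var : ∀ {n k} (ρ : Vec (Fin n) k) (i : Fin k) g → at (varᵖ (toℕ i)) (encodeEnv ρ ∙ g) ≡ vertex (lookup ρ i)
  at-var (v ∷ ρ) zero    g = refl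
  at-var (v ∷ ρ) (suc i) g = trans (cong hdᵗ (at-shift (toℕ i) (vertex v) (encodeEnv ρ) g)) (at-var ρ i g)

  at-var′ : ∀ {n k} (ρ : Vec (Fin n) k) (i : Fin k) x g → at (varᵖ (suc (toℕ i))) ((x ∙ encodeEnv ρ) ∙ g) ≡ vertex (lookup ρ i)
  at-var′ ρ i x g = trans (cong hdᵗ (at-shift (toℕ i) x (encodeEnv ρ) g)) (at-var ρ i g)

  same-correct : ∀ {n} p q c b (u v : Fin n) → at p c ≡ vertex u → at q c ≡ vertex v → Decides (value (sameᵠ p q) c b) (u ≡ v)
  same-correct p q c b u v eq eq' = convert-dec to from
      (decides-and (decides-neg (subst₂ (λ x y → Decides (dropᵗ x y) _) (sym eq) (sym eq') (drop-≰ (suc (toℕ u)) (suc (toℕ v)))))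
                   (decides-neg (subst₂ (λ x y → Decides (dropᵗ x y) _) (sym eq') (sym eq) (drop-≰ (suc (toℕ v)) (suc (toℕ u))))))
    where
    stable : ∀ {a b} → ¬ ¬ a ≤ b → a ≤ b
    stable {a} {b} h with a Data.Nat.≤? b
    ... | yes p = p
    ... | no ¬p = ⊥-elim (h ¬p)
    to : ¬ ¬ suc (toℕ u) ≤ suc (toℕ v) × ¬ ¬ suc (toℕ v) ≤ suc (toℕ u) → u ≡ v
    to (h , h') = Fin.toℕ-injective (ℕ.≤-antisym (ℕ.≤-pred (stable h)) (ℕ.≤-pred (stable h')))
    from : u ≡ v → ¬ ¬ suc (toℕ u) ≤ suc (toℕ v) × ¬ ¬ suc (toℕ v) ≤ suc (toℕ u)
    from refl = (λ h → h ℕ.≤-refl) , (λ h → h ℕ.≤-refl)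

  bit-correct : ∀ b p c b' x → at p c ≡ encodeBool x → Decides (value (bitᵠ b p) c b') (x ≡ b)
  bit-correct true  p c b' x eq = subst (λ t → Decides t _) (sym (trans (ev-path p (hd X) (c ∙ b')) eq)) (lem x)
    where
    lem : ∀ x → Decides (encodeBool x) (x ≡ true)
    lem false = none refl λ ()
    lem true  = accept refl cons
  bit-correct false p c b' x eq = convert-dec (to x) (from x) (decides-neg (bit-correct true p c b' x eq))
    where
    to : ∀ x → ¬ x ≡ true → x ≡ false
    to false _ = refl
    to true  h = ⊥-elim (h refl)
    from : ∀ x → x ≡ false → ¬ x ≡ true
    from false _ ()

  member-correct : ∀ {n} p q c b (e : Vec Bool n) (v : Fin n) → at p c ≡ encodeBits e → at q c ≡ vertex v →
    Decides (value (memberᵠ p q) c b) (lookup e v ≡ true)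
  member-correct p q c b e v eq eq' =
    subst₂ (λ x y → Decides (hdᵗ (dropᵗ x (tlᵗ y))) _) (sym eq) (sym eq') (drop-bits e v)

  get-nonzero : ∀ p c b m → at p c ≡ encodeℕ m → Decides (value (neg (getᵠ p)) c b) (m ≡ 0)
  get-nonzero p c b m eq = subst (λ t → Decides (ifᵗ t then nil else (nil ∙ nil)) (m ≡ 0))
      (sym (trans (ev-path p (hd X) (c ∙ b)) eq)) (lem m)
    where
    lem : ∀ m → Decides (ifᵗ encodeℕ m then nil else (nil ∙ nil)) (m ≡ 0)
    lem zero    = accept refl cons
    lem (suc m) = none refl λ ()

  module _ {n} (es : List (Vec Bool n)) (σ : State n) (b : Tree) where
    open Sem es

    query-correct : ∀ {k} (φ : Fm k) (ρ : Vec (Fin n) k) → Decides (value (query φ) (context es σ ρ) b) (⟦ φ ⟧ σ ρ)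
    query-correct always ρ = accept tt cons
    query-correct (asg c i) ρ = convert-dec to from (decides-list encodeEntry (log σ) {A = λ (v , x) → v ≡ lookup ρ i × x ≡ c}
        λ (v , x) ys → decides-and
          (same-correct (hdᵖ (hdᵖ (varᵖ 0))) (varᵖ (suc (toℕ i))) _ b v (lookup ρ i) refl (at-var′ ρ i _ _))
          (bit-correct c (tlᵖ (hdᵖ (varᵖ 0))) _ b x refl))
      where
      to : Any (λ (v , x) → v ≡ lookup ρ i × x ≡ c) (log σ) → (lookup ρ i , c) ∈ log σ
      to = Any.map λ (p , q) → sym (cong₂ _,_ p q)
      from : (lookup ρ i , c) ∈ log σ → Any (λ (v , x) → v ≡ lookup ρ i × x ≡ c) (log σ)
      from = Any.map λ { refl → refl , refl }
    query-correct (edge i j l) ρ = decides-and (ne i j) (decides-and (ne j l) (decides-and (ne i l)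
        (decides-list encodeBits es λ e ys → decides-and (mem e ys i) (decides-and (mem e ys j) (mem e ys l)))))
      where
      ne : ∀ i j → Decides _ (¬ lookup ρ i ≡ lookup ρ j)
      ne i j = decides-neg (same-correct (varᵖ (toℕ i)) (varᵖ (toℕ j)) (context es σ ρ) b _ _ (at-var ρ i _) (at-var ρ j _))
      mem : ∀ e ys i → Decides _ (lookup e (lookup ρ i) ≡ true)
      mem e ys i = member-correct (hdᵖ (varᵖ 0)) (varᵖ (suc (toℕ i))) (((encodeBits e ∙ ys) ∙ encodeEnv ρ) ∙ _) b e (lookup ρ i)
        refl (at-var′ ρ i (encodeBits e ∙ ys) _)
    query-correct (same i j) ρ = same-correct (varᵖ (toℕ i)) (varᵖ (toℕ j)) (context es σ ρ) b _ _ (at-var ρ i _) (at-var ρ j _)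
    query-correct (spent true)  ρ = get-nonzero onesᵖ (context es σ ρ) b (ones σ) refl
    query-correct (spent false) ρ = get-nonzero zerosᵖ (context es σ ρ) b (zeros σ) refl
    query-correct (φ and ψ) ρ = decides-and (query-correct φ ρ) (query-correct ψ ρ)
    query-correct (φ or ψ)  ρ = decides-or (query-correct φ ρ) (query-correct ψ ρ)
    query-correct (not φ)   ρ = decides-neg (query-correct φ ρ)
    query-correct (ex φ)    ρ = finds-vertex n λ v → query-correct φ (v ∷ ρ)

  -- The query doubles as the decision procedure for the proofs; the tail of the state does not
  -- affect the truth of a formula, so `nil` will do.
  decide : ∀ {n k} (es : List (Vec Bool n)) (σ : State n) (φ : Fm k) ρ → Dec (Sem.⟦_⟧ es φ σ ρ)
  decide es σ φ ρ with query-correct es σ nil φ ρ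
  ... | none _ ¬a   = no ¬a
  ... | found a _ _ = yes a

-- Branching rules, weights and coverage

module Branching where

  open Formula
  open import Data.Bool using (T)
  open import Data.Empty using (⊥)
  open import Data.Fin using (Fin; zero; suc)
  open import Data.List using (_++_)
  open import Data.List.Membership.Propositional.Properties using (∈-++⁺ʳ)
  open import Data.List.Relation.Unary.All as All using (All; []; _∷_)
  open import Data.List.Relation.Unary.AllPairs using ([]; _∷_)
  open import Data.List.Relation.Unary.Any as Any using (Any; here; there)
  open import Data.Nat using (ℕ; zero; suc; _+_; _*_; _∸_; _^_; _≤_; _≤ᵇ_)

  pattern v0 = zero
  pattern v1 = suc v0
  pattern v2 = suc v1
  pattern v3 = suc v2
  pattern v4 = suc v3
  pattern v5 = suc v4
  pattern v6 = suc v5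
  pattern v7 = suc v6
  pattern v8 = suc v7
  pattern v9 = suc v8

  module _ {k : ℕ} where

    free : Fin k → Fm k
    free i = not (asg true i) and not (asg false i)

    ne : Fin k → Fin k → Fm k
    ne i j = not (same i j)

    avoid : Fin k → Fin k → Fin k → Fm k
    avoid i j l = ne i j and ne i l

    live : Fin k → Fin k → Fin k → Fm k
    live i j l = free i and free j and free l and edge i j l

    pair : Fin k → Fin k → Fin k → Fin k → Fm k
    pair i j l m = (same i l and same j m) or (same i m and same j l)

  two : ∀ {k} → Fin k → Fin k → Fm k
  two i j = free i and free j and ex (asg false v0 and edge v0 (suc i) (suc j))

  unit : ∀ {k} → Fin k → Fm k
  unit i = free i and ex (asg false v0 and ex (asg false v0 and edge (suc (suc i)) v1 v0))

  -- No live edge at i avoids both j and l.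
  meets : ∀ {k} → Fin k → Fin k → Fin k → Fm k
  meets i j l = not (ex (ex (live (suc (suc i)) v1 v0
    and avoid v1 (suc (suc j)) (suc (suc l)) and avoid v0 (suc (suc j)) (suc (suc l)))))

  -- Some live edge at i other than {i , j , l}.
  another : ∀ {k} → Fin k → Fin k → Fin k → Fm k
  another i j l = ex (ex (live (suc (suc i)) v1 v0 and not (pair v1 v0 (suc (suc j)) (suc (suc l)))))

  another₂ : ∀ {k} → Fin k → Fin k → Fin k → Fin k → Fin k → Fm k
  another₂ i j l p q = ex (ex (live (suc (suc i)) v1 v0 and not (pair v1 v0 (suc (suc j)) (suc (suc l)))
    and not (pair v1 v0 (suc (suc p)) (suc (suc q)))))

  -- Some live edge {i , u , v} not containing j for which u , v is not already a clause.
  extends : ∀ {k} → Fin k → Fin k → Fm k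
  extends i j = ex (ex (live (suc (suc i)) v1 v0 and ne v1 (suc (suc j)) and ne v0 (suc (suc j)) and not (two v1 v0)))

  -- A bad state has no proper extension with balanced colors: the budgets start at n + 1, so one of
  -- them vanishes exactly when more than n/2 vertices have its color.
  bad : Fm 0
  bad = ex (asg true v0 and asg false v0)
     or ex (ex (ex (edge v2 v1 v0 and asg false v2 and asg false v1 and asg false v0)))
     or ex (ex (ex (edge v2 v1 v0 and asg true v2 and asg true v1 and asg true v0)))
     or spent true or spent false

  Leaf : Set → Set
  Leaf A = List (A × Bool)

  record Rule : Set where
    constructor rule
    field
      vars   : ℕ
      cond   : Fm vars
      leaves : List (Leaf (Fin vars))

  apart : ∀ {k} → Fin k → Leaf (Fin k) → Fm k
  apart i []            = always
  apart i ((j , _) ∷ ℓ) = ne i j and apart i ℓ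

  admissible : ∀ {k} → Leaf (Fin k) → Fm k
  admissible []            = always
  admissible ((i , _) ∷ ℓ) = free i and apart i ℓ and admissible ℓ

  all-admissible : ∀ {k} → List (Leaf (Fin k)) → Fm k
  all-admissible []       = always
  all-admissible (ℓ ∷ ℓs) = admissible ℓ and all-admissible ℓs

  full : (r : Rule) → Fm (Rule.vars r)
  full (rule _ φ ℓs) = all-admissible ℓs and φ

  pattern _:1 i = (i , true)
  pattern _:0 i = (i , false)

  -- A live edge has only free vertices; a two-clause arises from an edge with a
  -- vertex of color 0, a unit clause from one with two such vertices.
  unitʳ starʳ p3k2ʳ p4aʳ p4bʳ p3ʳ ndʳ domʳ f1sʳ f1dʳ f2ʳ f3aʳ f3bʳ f3cʳ f3dʳ isoʳ : Rule
  unitʳ = rule 1 (unit v0) ((v0 :1 ∷ []) ∷ [])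
  starʳ = rule 4 (two v0 v1 and two v0 v2 and two v0 v3)
    ((v0 :1 ∷ []) ∷ (v0 :0 ∷ v1 :1 ∷ v2 :1 ∷ v3 :1 ∷ []) ∷ [])
  p3k2ʳ = rule 5 (two v0 v1 and two v0 v2 and two v3 v4 and ne v3 v0 and avoid v3 v1 v2 and ne v4 v0 and avoid v4 v1 v2)
    ((v0 :1 ∷ []) ∷ (v0 :0 ∷ v1 :1 ∷ v2 :1 ∷ []) ∷ [])
  p4aʳ = rule 6 (two v0 v1 and two v1 v2 and two v2 v3 and ne v3 v1 and live v1 v4 v5 and avoid v4 v0 v2 and avoid v5 v0 v2)
    ((v1 :1 ∷ []) ∷ (v1 :0 ∷ v0 :1 ∷ v2 :1 ∷ []) ∷ [])
  p4bʳ = rule 4 (two v0 v1 and two v1 v2 and two v2 v3 and meets v1 v0 v2 and meets v2 v1 v3)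
    ((v1 :1 ∷ v2 :1 ∷ v0 :0 ∷ v3 :0 ∷ []) ∷ (v1 :1 ∷ v2 :0 ∷ v3 :1 ∷ []) ∷ (v1 :0 ∷ v0 :1 ∷ v2 :1 ∷ []) ∷ [])
  p3ʳ = rule 3 (two v0 v1 and two v0 v2) ((v0 :1 ∷ []) ∷ (v0 :0 ∷ v1 :1 ∷ v2 :1 ∷ []) ∷ [])
  ndʳ = rule 4 (two v0 v1 and live v0 v2 v3 and ne v2 v1 and ne v3 v1 and not (two v2 v3))
    ((v0 :1 ∷ []) ∷ (v0 :0 ∷ v1 :1 ∷ []) ∷ [])
  domʳ = rule 2 (two v0 v1 and not (extends v0 v1)) ((v0 :1 ∷ v1 :0 ∷ []) ∷ (v0 :0 ∷ v1 :1 ∷ []) ∷ [])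
  f1sʳ = rule 5 (live v0 v1 v2 and live v0 v1 v3 and live v0 v1 v4 and ne v2 v3 and ne v3 v4 and ne v2 v4)
    ((v0 :1 ∷ []) ∷ (v0 :0 ∷ []) ∷ [])
  f1dʳ = rule 7 (live v0 v1 v2 and live v0 v3 v4 and live v0 v5 v6 and avoid v1 v3 v4 and avoid v2 v3 v4
      and not (pair v5 v6 v1 v2) and not (pair v5 v6 v3 v4))
    ((v0 :1 ∷ []) ∷ (v0 :0 ∷ []) ∷ [])
  f2ʳ = rule 4 (live v0 v1 v2 and live v0 v1 v3 and live v0 v2 v3 and meets v1 v2 v3)
    ((v0 :1 ∷ []) ∷ (v0 :0 ∷ v1 :1 ∷ v2 :1 ∷ v3 :0 ∷ []) ∷ (v0 :0 ∷ v1 :1 ∷ v2 :0 ∷ v3 :1 ∷ [])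
     ∷ (v0 :0 ∷ v1 :0 ∷ v2 :1 ∷ v3 :1 ∷ []) ∷ [])
  f3aʳ = rule 5 (live v0 v1 v2 and live v0 v3 v4 and not (pair v3 v4 v1 v2) and not (another v2 v0 v1))
    ((v2 :1 ∷ v0 :0 ∷ v1 :0 ∷ []) ∷ (v2 :0 ∷ v0 :1 ∷ []) ∷ (v2 :0 ∷ v0 :0 ∷ v1 :1 ∷ []) ∷ [])
  f3bʳ = rule 3 (live v0 v1 v2 and not (another v0 v1 v2) and not (another v1 v0 v2) and not (another v2 v0 v1))
    ((v0 :1 ∷ v1 :0 ∷ v2 :0 ∷ []) ∷ (v0 :0 ∷ v1 :1 ∷ v2 :0 ∷ []) ∷ (v0 :0 ∷ v1 :0 ∷ v2 :1 ∷ []) ∷ [])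
  f3cʳ = rule 4 (live v0 v1 v2 and live v0 v1 v3 and meets v0 v1 v1 and meets v1 v0 v0)
    ((v0 :1 ∷ v1 :0 ∷ []) ∷ (v0 :0 ∷ v1 :1 ∷ []) ∷ (v0 :0 ∷ v1 :0 ∷ v2 :1 ∷ v3 :1 ∷ []) ∷ [])
  f3dʳ = rule 10 (live v0 v1 v2 and live v0 v3 v4 and live v1 v5 v6 and live v2 v7 v8 and (same v9 v7 or same v9 v8)
      and avoid v3 v1 v2 and avoid v4 v1 v2 and avoid v5 v0 v2 and avoid v6 v0 v2 and avoid v7 v0 v1 and avoid v8 v0 v1
      and avoid v5 v3 v4 and avoid v7 v3 v4 and avoid v9 v5 v6
      and not (another₂ v0 v1 v2 v3 v4) and not (another₂ v1 v0 v2 v5 v6) and not (another₂ v2 v0 v1 v7 v8))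
    ( (v0 :1 ∷ v1 :0 ∷ v2 :0 ∷ []) ∷ (v0 :0 ∷ v1 :1 ∷ v2 :0 ∷ []) ∷ (v0 :0 ∷ v1 :0 ∷ v2 :1 ∷ [])
    ∷ (v0 :1 ∷ v1 :1 ∷ v2 :0 ∷ v3 :0 ∷ v4 :0 ∷ v5 :0 ∷ [])
    ∷ (v0 :1 ∷ v2 :1 ∷ v1 :0 ∷ v3 :0 ∷ v4 :0 ∷ v7 :0 ∷ [])
    ∷ (v1 :1 ∷ v2 :1 ∷ v0 :0 ∷ v5 :0 ∷ v6 :0 ∷ v9 :0 ∷ []) ∷ [])
  isoʳ = rule 1 always ((v0 :0 ∷ []) ∷ [])

  count : ∀ {A : Set} → Bool → Leaf A → ℕ
  count b     []                = 0
  count true  ((_ , true) ∷ ℓ)  = suc (count true ℓ)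
  count true  ((_ , false) ∷ ℓ) = count true ℓ
  count false ((_ , true) ∷ ℓ)  = count false ℓ
  count false ((_ , false) ∷ ℓ) = suc (count false ℓ)

  extend : ∀ {n} → State n → Leaf (Fin n) → State n
  extend (state l p q) ℓ = state (ℓ ++ l) (p ∸ 2 * count true ℓ) (q ∸ 2 * count false ℓ)

  inst : ∀ {n k} → Vec (Fin n) k → Leaf (Fin k) → Leaf (Fin n)
  inst ρ = map (λ (i , b) → lookup ρ i , b)

  -- Upper bounds, in units of 1/600000, for the weight of the tree below a state.
  data Class : Set where
    any one-two two-two three-two one-unit : Class

  -- Let b = √(2/3). The values 0.845 and 0.7142 lie slightly above the solutions of x = 1/2 + xb/2
  -- and x = 0.845/2 + xb/2. These equations come from `ndʳ`: color 1 loses a clause, while color 0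
  -- fixes two vertices and replaces the clause by a new one. The value 0.612 lies just below
  -- √(3/8), the largest x with 1/2 + bx ≤ 1, as required by branching on a vertex in three live
  -- edges. A unit clause forces color 1, of cost 1/2.
  num : Class → ℕ
  num any       = 600000
  num one-two   = 507000
  num two-two   = 428520
  num three-two = 367200
  num one-unit  = 300000

  -- A vertex of color 1 costs a factor 1/2 and one of color 0 a factor √(2/3).
  fits : Class → ℕ → ℕ → ℕ → Bool
  fits c d o z = num c ^ 4 * 4 ^ z ≤ᵇ d ^ 4 * (16 ^ o * 9 ^ z)

  true≢false : ∀ {b} → b ≡ true → b ≡ false → ⊥
  true≢false refl ()

  dichotomy : ∀ b → b ≡ true ⊎ b ≡ false
  dichotomy true  = inj₁ refl
  dichotomy false = inj₂ refl

  module Local {n} (es : List (Vec Bool n)) where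

    open Sem es public

    swap₁₂ : ∀ {u v w} → Edge u v w → Edge v u w
    swap₁₂ (a , b , c , e) = ≢-sym a , c , b , Any.map (λ (x , y , z) → y , x , z) e

    swap₂₃ : ∀ {u v w} → Edge u v w → Edge u w v
    swap₂₃ (a , b , c , e) = c , ≢-sym b , a , Any.map (λ (x , y , z) → x , z , y) e

    Free : State n → Fin n → Set
    Free σ v = ¬ Has σ true v × ¬ Has σ false v

    Live : State n → Fin n → Fin n → Fin n → Set
    Live σ u v w = Free σ u × Free σ v × Free σ w × Edge u v w

    Two : State n → Fin n → Fin n → Set
    Two σ u v = Free σ u × Free σ v × ∃[ w ] (Has σ false w × Edge w u v)

    two-sym : ∀ {σ u v} → Two σ u v → Two σ v u
    two-sym (a , b , w , h , e) = b , a , w , h , swap₂₃ e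

    two-≢ : ∀ {σ u v} → Two σ u v → u ≢ v
    two-≢ (_ , _ , _ , _ , _ , h , _) = h

    Unit : State n → Fin n → Set
    Unit σ u = Free σ u × ∃[ v ] (Has σ false v × ∃[ w ] (Has σ false w × Edge u v w))

    Pair : Fin n → Fin n → Fin n → Fin n → Set
    Pair u v x y = (u ≡ x × v ≡ y) ⊎ (u ≡ y × v ≡ x)

    Bad : State n → Set
    Bad σ = ⟦ bad ⟧ σ []

    InClass : Class → State n → Set
    InClass any       σ = ⊤
    InClass one-unit  σ = Bad σ ⊎ ∃[ u ] Unit σ u
    InClass one-two   σ = InClass one-unit σ ⊎ ∃[ u ] ∃[ v ] Two σ u v
    InClass two-two   σ = ∃[ u ] ∃[ v ] ∃[ x ] ∃[ y ] (Two σ u v × Two σ x y × ¬ Pair u v x y)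
    InClass three-two σ =
        (∃[ y ] ∃[ a ] ∃[ b ] ∃[ c ] (Two σ y a × Two σ y b × Two σ y c × a ≢ b × b ≢ c × a ≢ c))
      ⊎ (∃[ u ] ∃[ v ] ∃[ x ] ∃[ y ] ∃[ g ] ∃[ h ] (Two σ u v × Two σ x y × Two σ g h
          × (u ≢ x × u ≢ y) × (v ≢ x × v ≢ y) × ¬ Pair g h u v × ¬ Pair g h x y))

    -- For each child, `c` is a class it is shown to belong to and `d` the part of the parent's
    -- weight reserved for it.
    data Plan (σ : State n) : List (Leaf (Fin n)) → ℕ → Set where
      []  : Plan σ [] 0
      add : ∀ {ℓ ℓs t} c d → InClass c (extend σ ℓ) → {T (fits c d (count true ℓ) (count false ℓ))} →
            Plan σ ℓs t → Plan σ (ℓ ∷ ℓs) (t + d)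

    -- A state may lie in several classes, and its parent may have relied on any one of them, so the
    -- bound of each has to be met.
    Bounded : State n → List (Leaf (Fin n)) → Set
    Bounded σ ℓs = ∀ c → InClass c σ → ∃[ t ] (Plan σ ℓs t × t ≤ num c)

    record Good (χ : Fin n → Bool) : Set where
      field
        proper  : ∀ {u v w} b → Edge u v w → χ u ≡ b → χ v ≡ b → χ w ≡ b → ⊥
        critical-edge : ∀ x → χ x ≡ true → ∃[ u ] ∃[ v ] (Edge x u v × χ u ≡ false × χ v ≡ false)
    open Good public

    Extends : (Fin n → Bool) → State n → Set
    Extends χ σ = ∀ {v b} → Has σ b v → χ v ≡ b

    Agrees : (Fin n → Bool) → Leaf (Fin n) → Set
    Agrees χ = All (λ (v , b) → χ v ≡ b)

    Covers : State n → List (Leaf (Fin n)) → Set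
    Covers σ ℓs = ∀ {χ} → Good χ → Extends χ σ → Any (Agrees χ) ℓs

    Valid : (r : Rule) → State n → Set
    Valid r σ = ∀ ρ → ⟦ full r ⟧ σ ρ → Bounded σ (map (inst ρ) (Rule.leaves r)) × Covers σ (map (inst ρ) (Rule.leaves r))

    Applies : Rule → State n → Set
    Applies r σ = ∃[ ρ ] ⟦ full r ⟧ σ ρ

    module _ {σ : State n} where

      Off : Fin n → Leaf (Fin n) → Set
      Off v = All (λ (u , _) → v ≢ u)

      free-extend : ∀ {v ℓ} → Off v ℓ → Free σ v → Free (extend σ ℓ) v
      free-extend []         f = f
      free-extend (ne ∷ off) f = (λ { (here refl) → ne refl ; (there h) → proj₁ (free-extend off f) h })
                               , (λ { (here refl) → ne refl ; (there h) → proj₂ (free-extend off f) h })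

      two-extend : ∀ {u v ℓ} → Off u ℓ → Off v ℓ → Two σ u v → Two (extend σ ℓ) u v
      two-extend {ℓ = ℓ} ou ov (fu , fv , w , h , e) = free-extend ou fu , free-extend ov fv , w , ∈-++⁺ʳ ℓ h , e

      two-new : ∀ {x u v ℓ} → Off u ℓ → Off v ℓ → Live σ x u v → Has (extend σ ℓ) false x → Two (extend σ ℓ) u v
      two-new ou ov (_ , fu , fv , e) h = free-extend ou fu , free-extend ov fv , _ , h , e

    Open : State n → Fin n → Set
    Open σ u = Free σ u ⊎ Has σ false u

    -- Meant for leaves that may have colored `u` or `v` with 0 as well: the edge then becomes a
    -- unit clause or monochromatic instead of a two-clause, and `one-two` includes all three
    -- outcomes.
    shrunk : ∀ {τ x u v} → Edge x u v → Has τ false x → Open τ u → Open τ v → InClass one-two τ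
    shrunk e h (inj₁ f) (inj₁ g) = inj₂ (_ , _ , f , g , _ , h , e)
    shrunk e h (inj₁ f) (inj₂ g) = inj₁ (inj₂ (_ , f , _ , h , _ , g , swap₁₂ e))
    shrunk e h (inj₂ f) (inj₁ g) = inj₁ (inj₂ (_ , g , _ , h , _ , f , swap₁₂ (swap₂₃ e)))
    shrunk e h (inj₂ f) (inj₂ g) = inj₁ (inj₁ (inj₂ (inj₁ (_ , _ , _ , e , h , f , g))))

    module _ {χ} (good : Good χ) where

      forced : ∀ {u v w} → Edge u v w → χ u ≡ false → χ v ≡ false → χ w ≡ true
      forced {w = w} e hu hv with dichotomy (χ w)
      ... | inj₁ t = t
      ... | inj₂ f = ⊥-elim (proper good false e hu hv f)

      forced₂ : ∀ {σ u v} → Extends χ σ → Two σ u v → χ u ≡ false → χ v ≡ true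
      forced₂ ext (_ , _ , w , h , e) hu = forced e (ext h) hu

      status : ∀ {σ u} → Extends χ σ → χ u ≡ false → Open σ u
      status {σ} {u} ext h with decide es σ (asg false v0) (u ∷ [])
      ... | yes z = inj₂ z
      ... | no ¬z = inj₁ ((λ t → true≢false (ext t) h) , ¬z)

      -- The other two vertices of a private edge of `x` have color 0 in `χ`, so each is free or
      -- already 0 in `σ`; if both were already 0, `x` would be a unit clause.
      critical : ∀ {σ x} → (∀ u → ¬ Unit σ u) → Extends χ σ → Free σ x → χ x ≡ true →
        (∃[ u ] ∃[ v ] (Live σ x u v × χ u ≡ false × χ v ≡ false)) ⊎ (∃[ u ] (Two σ x u × χ u ≡ false))
      critical {σ} nu ext fx hx with critical-edge good _ hx
      ... | u , v , e , hu , hv with status {σ} ext hu | status {σ} ext hv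
      ... | inj₁ fu | inj₁ fv = inj₁ (u , v , (fx , fu , fv , e) , hu , hv)
      ... | inj₁ fu | inj₂ zv = inj₂ (u , (fx , fu , v , zv , swap₁₂ (swap₂₃ e)) , hu)
      ... | inj₂ zu | inj₁ fv = inj₂ (v , (fx , fv , u , zu , swap₁₂ e) , hv)
      ... | inj₂ zu | inj₂ zv = ⊥-elim (nu _ (fx , u , zu , v , zv , e))

-- Unit clauses and overlapping two-clauses

module Rules where

  open Formula
  open Branching
  open import Data.Bool using (T)
  open import Data.Empty using (⊥)
  open import Data.Fin using (Fin; suc; _≟_)
  open import Data.List.Relation.Unary.All using ([]; _∷_)
  open import Data.List.Relation.Unary.Any using (here; there)
  open import Data.Nat using (suc; _≤_; _≤ᵇ_)
  open import Data.Nat.Properties using (≤-trans; ≤ᵇ⇒≤)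

  module Validity {n} (es : List (Vec Bool n)) (σ : State n) (not-bad : ¬ Sem.⟦_⟧ es bad σ []) where

    open Local es

    private
      variable
        a b c g g' h p q u v w x y z : Fin n

    F : Fin n → Set
    F = Free σ

    L : Fin n → Fin n → Fin n → Set
    L = Live σ

    T₂ : Fin n → Fin n → Set
    T₂ = Two σ

    f₁ : L u v w → F u
    f₁ (f , _) = f
    f₂ : L u v w → F v
    f₂ (_ , f , _) = f
    f₃ : L u v w → F w
    f₃ (_ , _ , f , _) = f
    ed : L u v w → Edge u v w
    ed (_ , _ , _ , e) = e
    ≢₁₂ : L u v w → u ≢ v
    ≢₁₂ (_ , _ , _ , h , _) = h
    ≢₂₃ : L u v w → v ≢ w
    ≢₂₃ (_ , _ , _ , _ , h , _) = h
    ≢₁₃ : L u v w → u ≢ w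
    ≢₁₃ (_ , _ , _ , _ , _ , h , _) = h

    s₁₂ : L u v w → L v u w
    s₁₂ (a , b , c , e) = b , a , c , swap₁₂ e
    s₂₃ : L u v w → L u w v
    s₂₃ (a , b , c , e) = a , c , b , swap₂₃ e
    flip : T₂ u v → T₂ v u
    flip = two-sym {σ}
    t₁ : T₂ u v → F u
    t₁ (f , _) = f
    t₂ : T₂ u v → F v
    t₂ (_ , f , _) = f
    ne₂ : T₂ u v → u ≢ v
    ne₂ = two-≢ {σ}

    pair? : ∀ u v x y → Dec (Pair u v x y)
    pair? u v x y = decide es σ (pair v0 v1 v2 v3) (u ∷ v ∷ x ∷ y ∷ [])

    pair-two : Pair u v x y → T₂ u v → T₂ x y
    pair-two (inj₁ (refl , refl)) t = t
    pair-two (inj₂ (refl , refl)) t = flip t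

    pair-trans : Pair u v x y → Pair g h x y → Pair u v g h
    pair-trans (inj₁ (refl , refl)) (inj₁ (refl , refl)) = inj₁ (refl , refl)
    pair-trans (inj₁ (refl , refl)) (inj₂ (refl , refl)) = inj₂ (refl , refl)
    pair-trans (inj₂ (refl , refl)) (inj₁ (refl , refl)) = inj₂ (refl , refl)
    pair-trans (inj₂ (refl , refl)) (inj₂ (refl , refl)) = inj₁ (refl , refl)

    pair-sym : Pair u v x y → Pair x y u v
    pair-sym (inj₁ (refl , refl)) = inj₁ (refl , refl)
    pair-sym (inj₂ (refl , refl)) = inj₂ (refl , refl)

    unit-valid : Valid unitʳ σ
    unit-valid (w ∷ []) (_ , _ , v , zv , v' , zv' , e) =
        (λ c _ → 300000 , add any 300000 tt [] , least c)
      , λ good ext → here (forced good (swap₂₃ (swap₁₂ e)) (ext zv) (ext zv') ∷ [])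
      where
      least : ∀ c → 300000 ≤ num c
      least any       = ≤ᵇ⇒≤ _ _ tt
      least one-two   = ≤ᵇ⇒≤ _ _ tt
      least two-two   = ≤ᵇ⇒≤ _ _ tt
      least three-two = ≤ᵇ⇒≤ _ _ tt
      least one-unit  = ≤ᵇ⇒≤ _ _ tt

    module _ (no-unit : ∀ u → ¬ Unit σ u) where

      -- A state that is neither bad nor has a unit clause is outside `one-unit`, and 367200 is the
      -- least bound of the other classes; one plan below it serves them all.
      small : ∀ {ℓs t} → Plan σ ℓs t → {T (t ≤ᵇ 367200)} → Bounded σ ℓs
      small {t = t} p {h} c k = t , p , ≤-trans (≤ᵇ⇒≤ t 367200 h) (lem c k)
        where
        lem : ∀ c → InClass c σ → 367200 ≤ num c
        lem any       _ = ≤ᵇ⇒≤ _ _ tt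
        lem one-two   _ = ≤ᵇ⇒≤ _ _ tt
        lem two-two   _ = ≤ᵇ⇒≤ _ _ tt
        lem three-two _ = ≤ᵇ⇒≤ _ _ tt
        lem one-unit (inj₁ bd)      = ⊥-elim (not-bad bd)
        lem one-unit (inj₂ (u , h)) = ⊥-elim (no-unit u h)

      star-valid : Valid starʳ σ
      -- Each share is the cost of the leaf times the bound of its class, rounded up: here 1/2 and
      -- √(2/3)/8, in units of 1/600000.
      star-valid (y ∷ a ∷ b ∷ c ∷ []) (_ , ta , tb , tc) = small (add any 300000 tt (add any 61238 tt [])) , cover
        where
        cover : Covers σ _
        cover {χ} good ext with dichotomy (χ y)
        ... | inj₁ y1 = here (y1 ∷ [])
        ... | inj₂ y0 = there (here (y0 ∷ forced₂ good {σ} ext ta y0 ∷ forced₂ good {σ} ext tb y0 ∷ forced₂ good {σ} ext tc y0 ∷ []))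

      p3-cover : T₂ y a → T₂ y b → Covers σ (((y , true) ∷ []) ∷ ((y , false) ∷ (a , true) ∷ (b , true) ∷ []) ∷ [])
      p3-cover {y} ta tb {χ} good ext with dichotomy (χ y)
      ... | inj₁ y1 = here (y1 ∷ [])
      ... | inj₂ y0 = there (here (y0 ∷ forced₂ good {σ} ext ta y0 ∷ forced₂ good {σ} ext tb y0 ∷ []))

      p3k2-valid : Valid p3k2ʳ σ
      p3k2-valid (y ∷ a ∷ b ∷ u ∷ v ∷ []) (_ , ta , tb , tuv , u≢y , (u≢a , u≢b) , v≢y , (v≢a , v≢b)) =
        small (add one-two 253500 (inj₂ (u , v , two-extend {σ} (u≢y ∷ []) (v≢y ∷ []) tuv))
              (add one-two 103491 (inj₂ (u , v , two-extend {σ} (u≢y ∷ u≢a ∷ u≢b ∷ []) (v≢y ∷ v≢a ∷ v≢b ∷ []) tuv)) []))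
        , p3-cover ta tb

      p4a-valid : Valid p4aʳ σ
      p4a-valid (p ∷ w ∷ w' ∷ q ∷ g ∷ g' ∷ []) (_ , tpw , tww' , tw'q , q≢w , lwgg , (g≢p , g≢w') , (g'≢p , g'≢w')) =
        small (add one-two 253500 (inj₂ (w' , q , two-extend {σ} (≢-sym (ne₂ tww') ∷ []) (q≢w ∷ []) tw'q))
              (add one-two 103491 (inj₂ (g , g' , two-new {σ} (≢-sym (≢₁₂ lwgg) ∷ g≢p ∷ g≢w' ∷ [])
                 (≢-sym (≢₁₃ lwgg) ∷ g'≢p ∷ g'≢w' ∷ []) lwgg (here refl))) []))
        , p3-cover (flip tpw) tww'

      star : T₂ y a → T₂ y b → T₂ y c → a ≢ b → b ≢ c → a ≢ c → Applies starʳ σ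
      star {y} {a} {b} {c} ta tb tc ab bc ac = (y ∷ a ∷ b ∷ c ∷ []) ,
        ( (t₁ ta , tt , tt)
        , (t₁ ta , (ne₂ ta , ne₂ tb , ne₂ tc , tt) , t₂ ta , (ab , ac , tt) , t₂ tb , (bc , tt) , t₂ tc , tt , tt) , tt)
        , ta , tb , tc

      p3 : T₂ y a → T₂ y b → a ≢ b → Applies p3ʳ σ
      p3 {y} {a} {b} ta tb ab = (y ∷ a ∷ b ∷ []) ,
        ((t₁ ta , tt , tt) , (t₁ ta , (ne₂ ta , ne₂ tb , tt) , t₂ ta , (ab , tt) , t₂ tb , tt , tt) , tt) , ta , tb

      -- If both inner vertices of the path have color 1, the private edge of each avoids the other.
      -- Either it is live, and then `meets` makes it contain the outer neighbor, or it comes from a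
      -- two-clause, which by `no-star` is the outer one of the path. In both cases the outer
      -- neighbor has color 0.
      p4b-valid : ¬ Applies starʳ σ → Valid p4bʳ σ
      p4b-valid no-star (p ∷ w ∷ w' ∷ q ∷ [])
        (((_ , (_ , w≢p , w≢q , tt) , _ , (w'≢p , w'≢q , tt) , _) , _) , tpw , tww' , tw'q , mw , mw') =
        small (add any 100000 tt (add any 122475 tt (add any 122475 tt []))) , cover
        where
        cover : Covers σ _
        cover {χ} good ext with dichotomy (χ w)
        ... | inj₂ w0 = there (there (here (w0 ∷ forced₂ good {σ} ext (flip tpw) w0 ∷ forced₂ good {σ} ext tww' w0 ∷ [])))
        ... | inj₁ w1 with dichotomy (χ w')
        ... | inj₂ w'0 = there (here (w1 ∷ w'0 ∷ forced₂ good {σ} ext tw'q w'0 ∷ []))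
        ... | inj₁ w'1 = here (w1 ∷ w'1 ∷ p0 ∷ q0 ∷ [])
          where
          p0 : χ p ≡ false
          p0 with critical good {σ} no-unit ext (t₂ tpw) w1
          p0 | inj₂ (u , twu , u0) with u ≟ p
          ... | yes refl = u0
          ... | no u≢p = ⊥-elim (no-star (star (flip tpw) tww' twu (≢-sym w'≢p) (λ { refl → true≢false w'1 u0 }) (≢-sym u≢p)))
          p0 | inj₁ (u , v , l , u0 , hv) with u ≟ p | v ≟ p
          ... | yes refl | _ = u0
          ... | no _ | yes refl = hv
          ... | no u≢p | no v≢p =
            ⊥-elim (mw (u , v , l , (u≢p , λ { refl → true≢false w'1 u0 }) , (v≢p , λ { refl → true≢false w'1 hv })))
          q0 : χ q ≡ false
          q0 with critical good {σ} no-unit ext (t₂ tww') w'1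
          q0 | inj₂ (u , twu , u0) with u ≟ q
          ... | yes refl = u0
          ... | no u≢q = ⊥-elim (no-star (star tw'q (flip tww') twu (≢-sym w≢q) (λ { refl → true≢false w1 u0 }) (≢-sym u≢q)))
          q0 | inj₁ (u , v , l , u0 , hv) with u ≟ q | v ≟ q
          ... | yes refl | _ = u0
          ... | no _ | yes refl = hv
          ... | no u≢q | no v≢q =
            ⊥-elim (mw' (u , v , l , ((λ { refl → true≢false w1 u0 }) , u≢q) , ((λ { refl → true≢false w1 hv }) , v≢q)))

      -- The two rules are complementary. A live edge at an inner vertex that avoids both its
      -- neighbors on the path becomes a surviving clause when that vertex gets color 0, which pays
      -- for `p4aʳ` on the path read in one direction or the other; if neither inner vertex has such
      -- an edge, `p4bʳ` applies.
      p4 : T₂ p w → T₂ w x → T₂ x q → p ≢ x → p ≢ q → w ≢ q → Applies p4aʳ σ ⊎ Applies p4bʳ σ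
      p4 {p} {w} {x} {q} tpw twx txq p≢x p≢q w≢q with decide es σ (meets v1 v0 v2) (p ∷ w ∷ x ∷ q ∷ [])
                                                | decide es σ (meets v2 v1 v3) (p ∷ w ∷ x ∷ q ∷ [])
      ... | yes mw | yes mx = inj₂ ((p ∷ w ∷ x ∷ q ∷ []) ,
          ( (t₁ twx , (ne₂ twx , ≢-sym (ne₂ tpw) , w≢q , tt) , t₂ twx , (≢-sym p≢x , ne₂ txq , tt) , t₁ tpw , (p≢q , tt) , t₂ txq , tt , tt)
          , (t₁ twx , (ne₂ twx , w≢q , tt) , t₂ twx , (ne₂ txq , tt) , t₂ txq , tt , tt)
          , (t₁ twx , (≢-sym (ne₂ tpw) , ne₂ twx , tt) , t₁ tpw , (p≢x , tt) , t₂ twx , tt , tt) , tt)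
          , tpw , twx , txq , mw , mx)
      ... | no ¬mw | _ with decide es σ (ex (ex (live (suc (suc v1)) v1 v0 and avoid v1 v2 v4 and avoid v0 v2 v4))) (p ∷ w ∷ x ∷ q ∷ [])
      ... | no ¬e = ⊥-elim (¬mw ¬e)
      ... | yes (g , g' , l , ag , ag') = inj₁ ((p ∷ w ∷ x ∷ q ∷ g ∷ g' ∷ []) ,
          ((t₂ tpw , tt , tt) , (t₂ tpw , (≢-sym (ne₂ tpw) , ne₂ twx , tt) , t₁ tpw , (p≢x , tt) , t₂ twx , tt , tt) , tt)
          , tpw , twx , txq , ≢-sym w≢q , l , ag , ag')
      p4 {p} {w} {x} {q} tpw twx txq p≢x p≢q w≢q | yes _ | no ¬mx
        with decide es σ (ex (ex (live (suc (suc v2)) v1 v0 and avoid v1 v3 v5 and avoid v0 v3 v5))) (p ∷ w ∷ x ∷ q ∷ [])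
      ... | no ¬e = ⊥-elim (¬mx ¬e)
      ... | yes (g , g' , l , (gw , gq) , (gw' , gq')) = inj₁ ((q ∷ x ∷ w ∷ p ∷ g ∷ g' ∷ []) ,
          ((t₁ txq , tt , tt) , (t₁ txq , (ne₂ txq , ≢-sym (ne₂ twx) , tt) , t₂ txq , (≢-sym w≢q , tt) , t₁ twx , tt , tt) , tt)
          , flip txq , flip twx , flip tpw , p≢x , l , (gq , gw) , (gq' , gw'))

      module _ (no-star : ¬ Applies starʳ σ) (no-p3k2 : ¬ Applies p3k2ʳ σ)
               (no-p4a : ¬ Applies p4aʳ σ) (no-p4b : ¬ Applies p4bʳ σ) where

        not-p4 : T₂ p w → T₂ w x → T₂ x q → p ≢ x → p ≢ q → w ≢ q → ⊥
        not-p4 tpw twx txq d d' d'' with p4 tpw twx txq d d' d''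
        ... | inj₁ h = no-p4a h
        ... | inj₂ h = no-p4b h

        -- The other end of the clause is `y`, giving three clauses at `y`; or `a` or `b`, giving a
        -- path of three clauses; or it is none of them, and the clause is disjoint from the path.
        outside : T₂ y a → T₂ y b → a ≢ b → T₂ u v → u ≢ y → u ≢ a → u ≢ b → ⊥
        outside {y} {a} {b} {u} {v} ta tb ab tuv uy ua ub with v ≟ y | v ≟ a | v ≟ b
        ... | yes refl | _ | _ = no-star (star ta tb (flip tuv) ab (≢-sym ub) (≢-sym ua))
        ... | no _ | yes refl | _ = not-p4 tuv (flip ta) tb uy ub ab
        ... | no _ | no _ | yes refl = not-p4 tuv (flip tb) ta uy ua (≢-sym ab)
        ... | no vy | no va | no vb = no-p3k2 ((y ∷ a ∷ b ∷ u ∷ v ∷ []) ,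
          ((t₁ ta , tt , tt) , (t₁ ta , (ne₂ ta , ne₂ tb , tt) , t₂ ta , (ab , tt) , t₂ tb , tt , tt) , tt)
          , ta , tb , tuv , uy , (ua , ub) , vy , (va , vb))

        inside : T₂ y a → T₂ y b → a ≢ b → T₂ u v → u ≡ y ⊎ u ≡ a ⊎ u ≡ b
        inside {y} {a} {b} {u} ta tb ab tuv with u ≟ y | u ≟ a | u ≟ b
        ... | yes e | _ | _ = inj₁ e
        ... | no _ | yes e | _ = inj₂ (inj₁ e)
        ... | no _ | no _ | yes e = inj₂ (inj₂ e)
        ... | no uy | no ua | no ub = ⊥-elim (outside ta tb ab tuv uy ua ub)

        four-in-three : ∀ {A : Set} {y a b u v x z : A} → u ≡ y ⊎ u ≡ a ⊎ u ≡ b → v ≡ y ⊎ v ≡ a ⊎ v ≡ b →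
          x ≡ y ⊎ x ≡ a ⊎ x ≡ b → z ≡ y ⊎ z ≡ a ⊎ z ≡ b →
          u ≢ v → x ≢ z → u ≢ x → u ≢ z → v ≢ x → v ≢ z → ⊥
        four-in-three (inj₁ refl) (inj₁ refl) _ _ uv xz ux uz vx vz = uv refl
        four-in-three (inj₂ (inj₁ refl)) (inj₂ (inj₁ refl)) _ _ uv xz ux uz vx vz = uv refl
        four-in-three (inj₂ (inj₂ refl)) (inj₂ (inj₂ refl)) _ _ uv xz ux uz vx vz = uv refl
        four-in-three (inj₁ refl) _ (inj₁ refl) _ uv xz ux uz vx vz = ux refl
        four-in-three (inj₁ refl) _ _ (inj₁ refl) uv xz ux uz vx vz = uz refl
        four-in-three (inj₂ (inj₁ refl)) _ (inj₂ (inj₁ refl)) _ uv xz ux uz vx vz = ux refl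
        four-in-three (inj₂ (inj₁ refl)) _ _ (inj₂ (inj₁ refl)) uv xz ux uz vx vz = uz refl
        four-in-three (inj₂ (inj₂ refl)) _ (inj₂ (inj₂ refl)) _ uv xz ux uz vx vz = ux refl
        four-in-three (inj₂ (inj₂ refl)) _ _ (inj₂ (inj₂ refl)) uv xz ux uz vx vz = uz refl
        four-in-three _ (inj₁ refl) (inj₁ refl) _ uv xz ux uz vx vz = vx refl
        four-in-three _ (inj₁ refl) _ (inj₁ refl) uv xz ux uz vx vz = vz refl
        four-in-three _ (inj₂ (inj₁ refl)) (inj₂ (inj₁ refl)) _ uv xz ux uz vx vz = vx refl
        four-in-three _ (inj₂ (inj₁ refl)) _ (inj₂ (inj₁ refl)) uv xz ux uz vx vz = vz refl
        four-in-three _ (inj₂ (inj₂ refl)) (inj₂ (inj₂ refl)) _ uv xz ux uz vx vz = vx refl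
        four-in-three _ (inj₂ (inj₂ refl)) _ (inj₂ (inj₂ refl)) uv xz ux uz vx vz = vz refl
        four-in-three _ _ (inj₁ refl) (inj₁ refl) uv xz ux uz vx vz = xz refl
        four-in-three _ _ (inj₂ (inj₁ refl)) (inj₂ (inj₁ refl)) uv xz ux uz vx vz = xz refl
        four-in-three _ _ (inj₂ (inj₂ refl)) (inj₂ (inj₂ refl)) uv xz ux uz vx vz = xz refl

        -- The total 0.704 exceeds only the bounds of `three-two` and `one-unit`. Once the earlier
        -- rules fail, all clauses lie within three vertices, which leaves no room for two disjoint
        -- ones, and no vertex has three clauses; so `three-two` is impossible.
        p3-valid : Valid p3ʳ σ
        p3-valid (y ∷ a ∷ b ∷ []) ((_ , (_ , _ , _ , (ab , _) , _) , _) , ta , tb) = bounded , p3-cover ta tb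
          where
          plan : Plan σ _ 422475
          plan = add any 300000 tt (add any 122475 tt [])
          bounded : Bounded σ _
          bounded any       _ = 422475 , plan , ≤ᵇ⇒≤ _ _ tt
          bounded one-two   _ = 422475 , plan , ≤ᵇ⇒≤ _ _ tt
          bounded two-two   _ = 422475 , plan , ≤ᵇ⇒≤ _ _ tt
          bounded one-unit (inj₁ bd)      = ⊥-elim (not-bad bd)
          bounded one-unit (inj₂ (u , h)) = ⊥-elim (no-unit u h)
          bounded three-two (inj₁ (_ , _ , _ , _ , t , t' , t'' , d , d' , d'')) = ⊥-elim (no-star (star t t' t'' d d' d''))
          bounded three-two (inj₂ (u , v , x , z , _ , _ , tuv , txz , _ , (ux , uz) , (vx , vz) , _)) =
            ⊥-elim (four-in-three (inside ta tb ab tuv) (inside ta tb ab (flip tuv)) (inside ta tb ab txz) (inside ta tb ab (flip txz))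
              (ne₂ tuv) (ne₂ txz) ux uz vx vz)

-- Disjoint two-clauses, and states without clauses

module Fresh where

  open Formula
  open Branching
  open Rules
  open import Data.Bool using (T)
  open import Data.Empty using (⊥)
  open import Data.Fin using (Fin; _≟_)
  open import Data.List.Relation.Unary.All using (All; []; _∷_)
  open import Data.List.Relation.Unary.Any using (here; there)
  open import Data.Nat using (_≤ᵇ_)
  open import Data.Nat.Properties using (≤ᵇ⇒≤)
  open import Data.Sum using ([_,_]′)

  module ClauseValidity {n} (es : List (Vec Bool n)) (σ : State n) (not-bad : ¬ Sem.⟦_⟧ es bad σ [])
    (no-unit : ∀ u → ¬ Local.Unit es σ u) where

    open Local es
    open Validity es σ not-bad

    private
      variable
        a b c g g' h p q u v w x y z : Fin n

    module _ (no-p3 : ¬ Applies p3ʳ σ) where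

      Apart : Fin n → Fin n → Fin n → Fin n → Set
      Apart u v x y = (u ≢ x × u ≢ y) × (v ≢ x × v ≢ y)

      not-p3 : T₂ y a → T₂ y b → a ≢ b → ⊥
      not-p3 ta tb ab = no-p3 (p3 no-unit ta tb ab)

      matching : T₂ u v → T₂ x y → ¬ Pair u v x y → Apart u v x y
      matching {u} {v} {x} {y} tuv txy np =
          ((λ { refl → not-p3 tuv txy (λ { refl → np (inj₁ (refl , refl)) }) })
         , (λ { refl → not-p3 tuv (flip txy) (λ { refl → np (inj₂ (refl , refl)) }) }))
        , ((λ { refl → not-p3 (flip tuv) txy (λ { refl → np (inj₂ (refl , refl)) }) })
         , (λ { refl → not-p3 (flip tuv) (flip txy) (λ { refl → np (inj₁ (refl , refl)) }) }))

      -- Branching on the clause `y z` destroys it, so the smaller bounds of the richer classes must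
      -- be paid for by clauses disjoint from it. For the same reason `two-apart` extracts two of
      -- them from `three-two`.
      one-apart : ∀ y z → InClass two-two σ → T₂ y z → ∃[ u ] ∃[ v ] (T₂ u v × Apart u v y z)
      one-apart y z (u , v , x , x' , t , t' , np) tyz with pair? u v y z
      ... | no np'  = u , v , t , matching t tyz np'
      ... | yes pr = x , x' , t' , matching t' tyz (λ pr' → np (pair-trans pr pr'))

      two-apart : ∀ y z → InClass three-two σ → T₂ y z →
        ∃[ u ] ∃[ v ] ∃[ x ] ∃[ x' ] (T₂ u v × Apart u v y z × T₂ x x' × Apart x x' y z × ¬ Pair u v x x')
      two-apart y z (inj₁ (_ , _ , _ , _ , t , t' , _ , d , _)) tyz = ⊥-elim (not-p3 t t' d)
      two-apart y z (inj₂ (u , v , x , x' , g , g' , t , t' , t'' , (ux , ux') , _ , np , np')) tyz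
        with pair? u v y z | pair? x x' y z
      ... | yes pr | _ = x , x' , g , g' , t' , matching t' tyz (λ pr' → np₀ (pair-trans pr pr')) , t''
                       , matching t'' tyz (λ pr' → np (pair-trans pr' pr)) , (λ pr' → np' (pair-sym pr'))
        where
        np₀ : ¬ Pair u v x x'
        np₀ (inj₁ (e , _)) = ux e
        np₀ (inj₂ (e , _)) = ux' e
      ... | no np₁ | yes pr = u , v , g , g' , t , matching t tyz np₁ , t''
                            , matching t'' tyz (λ pr' → np' (pair-trans pr' pr)) , (λ pr' → np (pair-sym pr'))
      ... | no np₁ | no np₂ = u , v , x , x' , t , matching t tyz np₁ , t' , matching t' tyz np₂
                            , λ { (inj₁ (e , _)) → ux e ; (inj₂ (e , _)) → ux' e }

      -- Color 0 at `y` loses the clause `y z` but turns the live edge `y g g'` into a clause, a new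
      -- one because `g g'` was none; so the number of clauses is kept. Color 1 at `y` lowers it by
      -- one. This balance yields the recurrences behind the values of `num`.
      nd-valid : Valid ndʳ σ
      nd-valid (y ∷ z ∷ g ∷ g' ∷ []) (_ , tyz , l , g≢z , g'≢z , ¬tgg) = bounded , cover
        where
        ℓ : Leaf (Fin n)
        ℓ = (y , false) ∷ (z , true) ∷ []
        new : Two (extend σ ℓ) g g'
        new = two-new {σ} (≢-sym (≢₁₂ l) ∷ g≢z ∷ []) (≢-sym (≢₁₃ l) ∷ g'≢z ∷ []) l (here refl)
        off : Apart u v y z → T₂ u v → Two (extend σ ℓ) u v
        off ((a , b) , (c , d)) = two-extend {σ} (a ∷ b ∷ []) (c ∷ d ∷ [])
        off₁ : Apart u v y z → T₂ u v → Two (extend σ ((y , true) ∷ [])) u v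
        off₁ ((a , _) , (c , _)) = two-extend {σ} (a ∷ []) (c ∷ [])
        bounded : Bounded σ _
        bounded any       _ = 506982 , add any 300000 tt (add one-two 206982 (inj₂ (_ , _ , new)) []) , ≤ᵇ⇒≤ _ _ tt
        bounded one-two   _ = 506982 , add any 300000 tt (add one-two 206982 (inj₂ (_ , _ , new)) []) , ≤ᵇ⇒≤ _ _ tt
        bounded two-two   k with one-apart y z k tyz
        ... | u , v , t , ap = 428443 , add one-two 253500 (inj₂ (_ , _ , off₁ ap t))
          (add two-two 174943 (u , v , g , g' , off ap t , new , λ pr → ¬tgg (pair-two pr t)) []) , ≤ᵇ⇒≤ _ _ tt
        bounded three-two k with two-apart y z k tyz
        ... | u , v , x , x' , t , ap , t' , ap' , np = 364169 , add two-two 214260 (u , v , x , x' , off₁ ap t , off₁ ap' t' , np)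
          (add three-two 149909 (inj₂ (u , v , x , x' , g , g' , off ap t , off ap' t' , new
            , proj₁ (matching t t' np) , proj₂ (matching t t' np)
            , (λ pr → ¬tgg (pair-two (pair-sym pr) t)) , λ pr → ¬tgg (pair-two (pair-sym pr) t'))) []) , ≤ᵇ⇒≤ _ _ tt
        bounded one-unit (inj₁ bd)      = ⊥-elim (not-bad bd)
        bounded one-unit (inj₂ (u , h)) = ⊥-elim (no-unit u h)
        cover : Covers σ _
        cover {χ} good ext with dichotomy (χ y)
        ... | inj₁ y1 = here (y1 ∷ [])
        ... | inj₂ y0 = there (here (y0 ∷ forced₂ good {σ} ext tyz y0 ∷ []))

      -- Two endpoints of color 1 are impossible. A private edge of `y` would avoid `z`; as `y` is
      -- in no second clause, it would be live, and since `extends` fails, its other two vertices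
      -- already form a clause and cannot both be 0.
      dom-valid : Valid domʳ σ
      dom-valid (y ∷ z ∷ []) (_ , tyz , ¬ext) = bounded , cover
        where
        off : ∀ {i j} → Apart u v y z → T₂ u v → Two (extend σ ((y , i) ∷ (z , j) ∷ [])) u v
        off ((a , b) , (c , d)) = two-extend {σ} (a ∷ b ∷ []) (c ∷ d ∷ [])
        bounded : Bounded σ _
        bounded any       _ = 489898 , add any 244949 tt (add any 244949 tt []) , ≤ᵇ⇒≤ _ _ tt
        bounded one-two   _ = 489898 , add any 244949 tt (add any 244949 tt []) , ≤ᵇ⇒≤ _ _ tt
        bounded two-two   k with one-apart y z k tyz
        ... | u , v , t , ap = 413964 , add one-two 206982 (inj₂ (_ , _ , off ap t)) (add one-two 206982 (inj₂ (_ , _ , off ap t)) [])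
          , ≤ᵇ⇒≤ _ _ tt
        bounded three-two k with two-apart y z k tyz
        ... | u , v , x , x' , t , ap , t' , ap' , np = 349886
          , add two-two 174943 (u , v , x , x' , off ap t , off ap' t' , np)
            (add two-two 174943 (u , v , x , x' , off ap t , off ap' t' , np) []) , ≤ᵇ⇒≤ _ _ tt
        bounded one-unit (inj₁ bd)      = ⊥-elim (not-bad bd)
        bounded one-unit (inj₂ (u , h)) = ⊥-elim (no-unit u h)
        cover : Covers σ _
        cover {χ} good ext with dichotomy (χ y) | dichotomy (χ z)
        ... | inj₂ y0 | _       = there (here (y0 ∷ forced₂ good {σ} ext tyz y0 ∷ []))
        ... | inj₁ y1 | inj₂ z0 = here (y1 ∷ z0 ∷ [])
        ... | inj₁ y1 | inj₁ z1 with critical good {σ} no-unit ext (t₁ tyz) y1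
        ... | inj₂ (u , tyu , u0) = ⊥-elim (not-p3 tyz tyu (λ { refl → true≢false z1 u0 }))
        ... | inj₁ (u , v , l , u0 , hv) = ⊥-elim (¬ext (u , v , l , (λ { refl → true≢false z1 u0 }) , (λ { refl → true≢false z1 hv })
            , λ t → true≢false (forced₂ good {σ} ext t u0) hv))

      no-two : ¬ Applies ndʳ σ → ¬ Applies domʳ σ → ¬ T₂ y z
      no-two {y} {z} no-nd no-dom tyz with decide es σ (extends v0 v1) (y ∷ z ∷ [])
      ... | yes (g , g' , l , gz , g'z , nt) = no-nd ((y ∷ z ∷ g ∷ g' ∷ []) ,
          ((t₁ tyz , tt , tt) , (t₁ tyz , (ne₂ tyz , tt) , t₂ tyz , tt , tt) , tt) , tyz , l , gz , g'z , nt)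
      ... | no ne = no-dom ((y ∷ z ∷ []) ,
          ((t₁ tyz , (ne₂ tyz , tt) , t₂ tyz , tt , tt) , (t₁ tyz , (ne₂ tyz , tt) , t₂ tyz , tt , tt) , tt) , tyz , ne)

    module _ (no-clause : ∀ {u v} → ¬ T₂ u v) where

      -- Without clauses only `any` remains of the classes, so a total cost of 1 is acceptable.
      fresh : ∀ {ℓs t} → Plan σ ℓs t → {T (t ≤ᵇ 600000)} → Bounded σ ℓs
      fresh {t = t} p {h} any k = t , p , ≤ᵇ⇒≤ t 600000 h
      fresh p one-unit (inj₁ bd)               = ⊥-elim (not-bad bd)
      fresh p one-unit (inj₂ (u , k))          = ⊥-elim (no-unit u k)
      fresh p one-two (inj₁ (inj₁ bd))         = ⊥-elim (not-bad bd)
      fresh p one-two (inj₁ (inj₂ (u , k)))    = ⊥-elim (no-unit u k)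
      fresh p one-two (inj₂ (_ , _ , t))       = ⊥-elim (no-clause t)
      fresh p two-two (_ , _ , _ , _ , t , _)  = ⊥-elim (no-clause t)
      fresh p three-two (inj₁ (_ , _ , _ , _ , t , _))         = ⊥-elim (no-clause t)
      fresh p three-two (inj₂ (_ , _ , _ , _ , _ , _ , t , _)) = ⊥-elim (no-clause t)

      private-live : ∀ {χ} → Good χ → Extends χ σ → F x → χ x ≡ true → ∃[ u ] ∃[ v ] (L x u v × χ u ≡ false × χ v ≡ false)
      private-live good ext fx hx with critical good {σ} no-unit ext fx hx
      ... | inj₁ k = k
      ... | inj₂ (_ , t , _) = ⊥-elim (no-clause t)

      split : ∀ x → Covers σ (((x , true) ∷ []) ∷ ((x , false) ∷ []) ∷ [])
      split x {χ} good ext with dichotomy (χ x)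
      ... | inj₁ h = here (h ∷ [])
      ... | inj₂ h = there (here (h ∷ []))

      link : ∀ {x u v} → L x u v → Two (extend σ ((x , false) ∷ [])) u v
      link l = two-new {σ} (≢-sym (≢₁₂ l) ∷ []) (≢-sym (≢₁₃ l) ∷ []) l (here refl)

      f1s-valid : Valid f1sʳ σ
      f1s-valid (x ∷ y ∷ a ∷ b ∷ c ∷ []) (_ , la , lb , lc , ab , bc , ac) =
        fresh (add any 300000 tt (add three-two 299818 (inj₁ (y , a , b , c , link la , link lb , link lc , ab , bc , ac)) []))
        , split x

      f1d-valid : Valid f1dʳ σ
      f1d-valid (x ∷ u ∷ v ∷ a ∷ b ∷ g ∷ h ∷ []) (_ , l , l' , l'' , d , d' , np , np') =
        fresh (add any 300000 tt (add three-two 299818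
          (inj₂ (u , v , a , b , g , h , link l , link l' , link l'' , d , d' , np , np')) []))
        , split x

      -- The total is exactly 1, as it must be for the complete hypergraph on four vertices, which
      -- this rule handles. With color 0 at `x` at least two of `a`, `b`, `c` have color 1. All
      -- three cannot: by `meets` every live edge at `a` contains `b` or `c`, so `a` would have no
      -- private edge.
      f2-valid : Valid f2ʳ σ
      f2-valid (x ∷ a ∷ b ∷ c ∷ []) (_ , lab , lac , lbc , m) =
        fresh (add any 300000 tt (add any 100000 tt (add any 100000 tt (add any 100000 tt [])))) , cover
        where
        cover : Covers σ _
        cover {χ} good ext with dichotomy (χ x)
        ... | inj₁ x1 = here (x1 ∷ [])
        ... | inj₂ x0 with dichotomy (χ a)
        ... | inj₂ a0 = there (there (there (here (x0 ∷ a0 ∷ forced good (ed lab) x0 a0 ∷ forced good (ed lac) x0 a0 ∷ []))))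
        ... | inj₁ a1 with dichotomy (χ b)
        ... | inj₂ b0 = there (there (here (x0 ∷ a1 ∷ b0 ∷ forced good (ed lbc) x0 b0 ∷ [])))
        ... | inj₁ b1 with dichotomy (χ c)
        ... | inj₂ c0 = there (here (x0 ∷ a1 ∷ b1 ∷ c0 ∷ []))
        ... | inj₁ c1 with private-live good ext (f₂ lab) a1
        ... | u , v , l , u0 , hv = ⊥-elim (m (u , v , l ,
          ((λ { refl → true≢false b1 u0 }) , (λ { refl → true≢false c1 u0 })) ,
          ((λ { refl → true≢false b1 hv }) , (λ { refl → true≢false c1 hv }))))

      only : ¬ ⟦ another v0 v1 v2 ⟧ σ (c ∷ a ∷ b ∷ []) → L c u v → Pair u v a b
      only {c} {a} {b} {u} {v} h l with pair? u v a b
      ... | yes p = p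
      ... | no np = ⊥-elim (h (u , v , l , np))

      only-zero : ∀ {χ} → Good χ → Extends χ σ → ¬ ⟦ another v0 v1 v2 ⟧ σ (c ∷ a ∷ b ∷ []) → F c → χ c ≡ true →
        χ a ≡ false × χ b ≡ false
      only-zero good ext h fc c1 with private-live good ext fc c1
      ... | u , v , l , u0 , hv with only h l
      ... | inj₁ (refl , refl) = u0 , hv
      ... | inj₂ (refl , refl) = hv , u0

      f3a-cover : L a b c → ¬ ⟦ another v0 v1 v2 ⟧ σ (c ∷ a ∷ b ∷ []) →
        Covers σ (((c , true) ∷ (a , false) ∷ (b , false) ∷ []) ∷ ((c , false) ∷ (a , true) ∷ [])
          ∷ ((c , false) ∷ (a , false) ∷ (b , true) ∷ []) ∷ [])
      f3a-cover {a} {b} {c} l oc {χ} good ext with dichotomy (χ c)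
      ... | inj₁ c1 = here (c1 ∷ proj₁ (only-zero good ext oc (f₃ l) c1) ∷ proj₂ (only-zero good ext oc (f₃ l) c1) ∷ [])
      ... | inj₂ c0 with dichotomy (χ a)
      ... | inj₁ a1 = there (here (c0 ∷ a1 ∷ []))
      ... | inj₂ a0 = there (there (here (c0 ∷ a0 ∷ forced good (ed (s₁₂ (s₂₃ l))) c0 a0 ∷ [])))

      -- The bare costs add up to 1/3 + 0.408 + 1/3, more than 1. The saving comes from the second
      -- live edge at `a`: it becomes a two-clause when `a` gets color 0 or, if it also contains
      -- `b`, a unit clause when both get color 0.
      f3a-valid : Valid f3aʳ σ
      f3a-valid (a ∷ b ∷ c ∷ g ∷ h ∷ []) (_ , l , l' , np , oc) = bounded , f3a-cover l oc
        where
        unit-case : ∀ h → L a b h → h ≢ c → Bounded σ (((c , true) ∷ (a , false) ∷ (b , false) ∷ [])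
          ∷ ((c , false) ∷ (a , true) ∷ []) ∷ ((c , false) ∷ (a , false) ∷ (b , true) ∷ []) ∷ [])
        unit-case h m h≢c = fresh
          (add one-unit 100000 (inj₂ (h , free-extend {σ} (h≢c ∷ ≢-sym (≢₁₃ m) ∷ ≢-sym (≢₂₃ m) ∷ []) (f₃ m)
              , a , there (here refl) , b , there (there (here refl)) , ed (s₁₂ (s₂₃ m))))
          (add any 244949 tt (add any 200000 tt [])))
        g≢c : g ≢ c
        g≢c refl with only oc (s₁₂ l')
        ... | inj₁ (refl , refl) = np (inj₂ (refl , refl))
        ... | inj₂ (refl , refl) = ≢₁₃ l' refl
        h≢c : h ≢ c
        h≢c refl with only oc (s₁₂ (s₂₃ l'))
        ... | inj₁ (refl , refl) = np (inj₁ (refl , refl))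
        ... | inj₂ (refl , refl) = ≢₁₂ l' refl
        bounded : Bounded σ _
        bounded with g ≟ b | h ≟ b
        ... | yes refl | _ = unit-case h l' h≢c
        ... | no _ | yes refl = unit-case g (s₂₃ l') g≢c
        ... | no g≢b | no h≢b = fresh
          (add one-two 169000 (inj₂ (g , h , two-new {σ} (g≢c ∷ ≢-sym (≢₁₂ l') ∷ g≢b ∷ []) (h≢c ∷ ≢-sym (≢₁₃ l') ∷ h≢b ∷ []) l' (there (here refl))))
          (add any 244949 tt
          (add one-two 169000 (inj₂ (g , h , two-new {σ} (g≢c ∷ ≢-sym (≢₁₂ l') ∷ g≢b ∷ []) (h≢c ∷ ≢-sym (≢₁₃ l') ∷ h≢b ∷ []) l' (there (here refl))))
          [])))

      f3b-valid : Valid f3bʳ σ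
      f3b-valid (a ∷ b ∷ c ∷ []) (_ , l , oa , ob , oc) =
        fresh (add any 200000 tt (add any 200000 tt (add any 200000 tt []))) , cover
        where
        cover : Covers σ _
        cover {χ} good ext with dichotomy (χ a)
        ... | inj₁ a1 = here (a1 ∷ proj₁ (only-zero good ext oa (f₁ l) a1) ∷ proj₂ (only-zero good ext oa (f₁ l) a1) ∷ [])
        ... | inj₂ a0 with dichotomy (χ b)
        ... | inj₁ b1 = there (here (a0 ∷ b1 ∷ proj₂ (only-zero good ext ob (f₂ l) b1) ∷ []))
        ... | inj₂ b0 = there (there (here (a0 ∷ b0 ∷ forced good (ed l) a0 b0 ∷ [])))

      -- With its last two arguments equal, `meets` says that every live edge at `a` contains `b`;
      -- so if both had color 1, `a` would have no private edge.
      f3c-valid : Valid f3cʳ σ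
      f3c-valid (a ∷ b ∷ c ∷ w ∷ []) (_ , l , l' , ma , _) =
        fresh (add any 244949 tt (add any 244949 tt (add any 100000 tt []))) , cover
        where
        cover : Covers σ _
        cover {χ} good ext with dichotomy (χ a) | dichotomy (χ b)
        ... | inj₁ a1 | inj₂ b0 = here (a1 ∷ b0 ∷ [])
        ... | inj₂ a0 | inj₁ b1 = there (here (a0 ∷ b1 ∷ []))
        ... | inj₂ a0 | inj₂ b0 = there (there (here (a0 ∷ b0 ∷ forced good (ed l) a0 b0 ∷ forced good (ed l') a0 b0 ∷ [])))
        ... | inj₁ a1 | inj₁ b1 with private-live good ext (f₁ l) a1
        ... | u , v , m , u0 , hv = ⊥-elim (ma (u , v , m ,
          ((λ { refl → true≢false b1 u0 }) , (λ { refl → true≢false b1 u0 })) ,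
          ((λ { refl → true≢false b1 hv }) , (λ { refl → true≢false b1 hv }))))

      only₂-zero : ∀ {χ} → Good χ → Extends χ σ → ¬ ⟦ another₂ v0 v1 v2 v3 v4 ⟧ σ (a ∷ b ∷ c ∷ g ∷ h ∷ []) → F a → χ a ≡ true →
        χ b ≡ true ⊎ χ c ≡ true → χ g ≡ false × χ h ≡ false
      only₂-zero {a} {b} {c} {g} {h} good ext o fa a1 bc with private-live good ext fa a1
      ... | u , v , l , u0 , hv with pair? u v b c | pair? u v g h
      ... | _ | yes (inj₁ (refl , refl)) = u0 , hv
      ... | _ | yes (inj₂ (refl , refl)) = hv , u0
      ... | no np | no np' = ⊥-elim (o (u , v , l , np , np'))
      only₂-zero good ext o fa a1 (inj₁ b1) | u , v , l , u0 , hv | yes (inj₁ (refl , refl)) | no _ = ⊥-elim (true≢false b1 u0)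
      only₂-zero good ext o fa a1 (inj₂ c1) | u , v , l , u0 , hv | yes (inj₁ (refl , refl)) | no _ = ⊥-elim (true≢false c1 hv)
      only₂-zero good ext o fa a1 (inj₁ b1) | u , v , l , u0 , hv | yes (inj₂ (refl , refl)) | no _ = ⊥-elim (true≢false b1 hv)
      only₂-zero good ext o fa a1 (inj₂ c1) | u , v , l , u0 , hv | yes (inj₂ (refl , refl)) | no _ = ⊥-elim (true≢false c1 u0)

      -- If two of a , b , c get color 1, then the edge abc is private to neither of them,
      -- so the other live edge at each of the two is.
      f3d-cover : ∀ {a b c g g' h p k k' x} → L a b c → ¬ ⟦ another₂ v0 v1 v2 v3 v4 ⟧ σ (a ∷ b ∷ c ∷ g ∷ g' ∷ []) →
        ¬ ⟦ another₂ v0 v1 v2 v3 v4 ⟧ σ (b ∷ a ∷ c ∷ h ∷ p ∷ []) → ¬ ⟦ another₂ v0 v1 v2 v3 v4 ⟧ σ (c ∷ a ∷ b ∷ k ∷ k' ∷ []) →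
        x ≡ k ⊎ x ≡ k' → Covers σ
        ( ((a , true) ∷ (b , false) ∷ (c , false) ∷ []) ∷ ((a , false) ∷ (b , true) ∷ (c , false) ∷ [])
        ∷ ((a , false) ∷ (b , false) ∷ (c , true) ∷ [])
        ∷ ((a , true) ∷ (b , true) ∷ (c , false) ∷ (g , false) ∷ (g' , false) ∷ (h , false) ∷ [])
        ∷ ((a , true) ∷ (c , true) ∷ (b , false) ∷ (g , false) ∷ (g' , false) ∷ (k , false) ∷ [])
        ∷ ((b , true) ∷ (c , true) ∷ (a , false) ∷ (h , false) ∷ (p , false) ∷ (x , false) ∷ []) ∷ [])
      f3d-cover {a} {b} {c} {g} {g'} {h} {p} {k} {k'} {x} l oa ob oc x∈ {χ} good ext
        with dichotomy (χ a) | dichotomy (χ b) | dichotomy (χ c)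
      ... | inj₁ a1 | inj₁ b1 | inj₁ c1 = ⊥-elim (proper good true (ed l) a1 b1 c1)
      ... | inj₂ a0 | inj₂ b0 | _ = there (there (here (a0 ∷ b0 ∷ forced good (ed l) a0 b0 ∷ [])))
      ... | inj₁ a1 | inj₂ b0 | inj₂ c0 = here (a1 ∷ b0 ∷ c0 ∷ [])
      ... | inj₂ a0 | inj₁ b1 | inj₂ c0 = there (here (a0 ∷ b1 ∷ c0 ∷ []))
      ... | inj₁ a1 | inj₁ b1 | inj₂ c0 = there (there (there (here (a1 ∷ b1 ∷ c0 ∷ proj₁ gs ∷ proj₂ gs ∷ proj₁ hs ∷ []))))
        where
        gs : χ g ≡ false × χ g' ≡ false
        gs = only₂-zero {a} {b} {c} {g} {g'} good ext oa (f₁ l) a1 (inj₁ b1)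
        hs : χ h ≡ false × χ p ≡ false
        hs = only₂-zero {b} {a} {c} {h} {p} good ext ob (f₂ l) b1 (inj₁ a1)
      ... | inj₁ a1 | inj₂ b0 | inj₁ c1 = there (there (there (there (here (a1 ∷ c1 ∷ b0 ∷ proj₁ gs ∷ proj₂ gs ∷ proj₁ ks ∷ [])))))
        where
        gs : χ g ≡ false × χ g' ≡ false
        gs = only₂-zero {a} {b} {c} {g} {g'} good ext oa (f₁ l) a1 (inj₂ c1)
        ks : χ k ≡ false × χ k' ≡ false
        ks = only₂-zero {c} {a} {b} {k} {k'} good ext oc (f₃ l) c1 (inj₁ a1)
      ... | inj₂ a0 | inj₁ b1 | inj₁ c1 = there (there (there (there (there (here (b1 ∷ c1 ∷ a0 ∷ proj₁ hs ∷ proj₂ hs ∷ x0 ∷ []))))))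
        where
        hs : χ h ≡ false × χ p ≡ false
        hs = only₂-zero {b} {a} {c} {h} {p} good ext ob (f₂ l) b1 (inj₂ c1)
        ks : χ k ≡ false × χ k' ≡ false
        ks = only₂-zero {c} {a} {b} {k} {k'} good ext oc (f₃ l) c1 (inj₂ b1)
        x0 : χ x ≡ false
        x0 = [ (λ e → trans (cong χ e) (proj₁ ks)) , (λ e → trans (cong χ e) (proj₂ ks)) ]′ x∈

      still-open : ∀ {u} ℓ → F u → All (λ (v , b) → b ≡ true → u ≢ v) ℓ → Open (extend σ ℓ) u
      still-open [] f [] = inj₁ f
      still-open {u} ((v , b) ∷ ℓ) f (h ∷ hs) with still-open ℓ f hs | u ≟ v
      ... | inj₂ z | _ = inj₂ (there z)
      ... | inj₁ (¬t , ¬f) | no u≢v =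
        inj₁ ((λ { (here refl) → u≢v refl ; (there k) → ¬t k }) , (λ { (here refl) → u≢v refl ; (there k) → ¬f k }))
      still-open {u} ((v , true)  ∷ ℓ) f (h ∷ hs) | inj₁ _ | yes refl = ⊥-elim (h refl refl)
      still-open {u} ((v , false) ∷ ℓ) f (h ∷ hs) | inj₁ _ | yes refl = inj₂ (here refl)

      -- A single 1 among `a`, `b`, `c` turns the second edges at the other two into distinct
      -- two-clauses. Two 1s make the second edges at both private, which colors four vertices 0
      -- together with the third vertex, whose own second edge shrinks. The vertex `x` is chosen
      -- separately from `k` because the vertex of the edge at `c` that avoids the edge at `a` may
      -- lie on the edge at `b`.
      f3d-valid : Valid f3dʳ σ
      f3d-valid (a ∷ b ∷ c ∷ g ∷ g' ∷ h ∷ h' ∷ k ∷ k' ∷ x ∷ [])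
        (_ , l , lg , lh , lk , x∈ , (gb , gc) , (g'b , g'c) , (ha , hc) , (h'a , h'c) , (ka , kb) , (k'a , k'b)
           , (hg , hg') , (kg , kg') , (xh , xh') , oa , ob , oc) = bounded , f3d-cover l oa ob oc x∈
        where
        pair≢ : ∀ {u v y z : Fin n} → u ≢ y → u ≢ z → ¬ Pair u v y z
        pair≢ d d' (inj₁ (e , _)) = d e
        pair≢ d d' (inj₂ (e , _)) = d' e
        hk : ¬ Pair h h' k k'
        hk (inj₁ (refl , refl)) = [ (λ e → xh e) , (λ e → xh' e) ]′ x∈
        hk (inj₂ (refl , refl)) = [ (λ e → xh' e) , (λ e → xh e) ]′ x∈
        fx : F x
        fx = [ (λ { refl → f₂ lk }) , (λ { refl → f₃ lk }) ]′ x∈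
        single : ∀ {y u v y' u' v'} ℓ → L y u v → L y' u' v' → Has (extend σ ℓ) false y → Has (extend σ ℓ) false y' →
          Off {σ} u ℓ → Off {σ} v ℓ → Off {σ} u' ℓ → Off {σ} v' ℓ → ¬ Pair u v u' v' → InClass two-two (extend σ ℓ)
        single ℓ l l' z z' o₁ o₂ o₃ o₄ np = _ , _ , _ , _ , two-new {σ} o₁ o₂ l z , two-new {σ} o₃ o₄ l' z' , np
        no-one : ∀ {u v : Fin n} {i} → i ≡ false → i ≡ true → u ≢ v
        no-one refl ()
        -- The second edge at `z` may overlap the vertices that this leaf colors 0, so it need not
        -- become a two-clause and `shrunk` is called for.
        two-ones : ∀ {y y' z u v p q r} → L z u v → u ≢ y → u ≢ y' → v ≢ y → v ≢ y' → InClass one-two (extend σ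
          ((y , true) ∷ (y' , true) ∷ (z , false) ∷ (p , false) ∷ (q , false) ∷ (r , false) ∷ []))
        two-ones m uy uy' vy vy' = shrunk (ed m) (there (there (here refl)))
          (still-open _ (f₂ m) ((λ _ → uy) ∷ (λ _ → uy') ∷ no-one refl ∷ no-one refl ∷ no-one refl ∷ no-one refl ∷ []))
          (still-open _ (f₃ m) ((λ _ → vy) ∷ (λ _ → vy') ∷ no-one refl ∷ no-one refl ∷ no-one refl ∷ no-one refl ∷ []))
        ag : g ≢ a
        ag = ≢-sym (≢₁₂ lg)
        ag' : g' ≢ a
        ag' = ≢-sym (≢₁₃ lg)
        bh : h ≢ b
        bh = ≢-sym (≢₁₂ lh)
        bh' : h' ≢ b
        bh' = ≢-sym (≢₁₃ lh)
        ck : k ≢ c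
        ck = ≢-sym (≢₁₂ lk)
        ck' : k' ≢ c
        ck' = ≢-sym (≢₁₃ lk)
        bounded : Bounded σ _
        bounded = fresh
          (add two-two 142840 (single _ lh lk (there (here refl)) (there (there (here refl)))
            (ha ∷ bh ∷ hc ∷ []) (h'a ∷ bh' ∷ h'c ∷ []) (ka ∷ kb ∷ ck ∷ []) (k'a ∷ k'b ∷ ck' ∷ []) hk)
          (add two-two 142840 (single _ lk lg (there (there (here refl))) (here refl)
            (ka ∷ kb ∷ ck ∷ []) (k'a ∷ k'b ∷ ck' ∷ []) (ag ∷ gb ∷ gc ∷ []) (ag' ∷ g'b ∷ g'c ∷ []) (pair≢ kg kg'))
          (add two-two 142840 (single _ lh lg (there (here refl)) (here refl)
            (ha ∷ bh ∷ hc ∷ []) (h'a ∷ bh' ∷ h'c ∷ []) (ag ∷ gb ∷ gc ∷ []) (ag' ∷ g'b ∷ g'c ∷ []) (pair≢ hg hg'))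
          (add one-two 56334 (two-ones lk ka kb k'a k'b)
          (add one-two 56334 (two-ones lh ha hc h'a h'c)
          (add one-two 56334 (two-ones lg gb gc g'b g'c) []))))))

-- Some rule applies as long as a live edge remains

module Progress where

  open Formula
  open Branching
  open Rules
  open Fresh
  open import Data.Empty using (⊥)
  open import Data.Fin using (Fin; _≟_)
  open import Data.Sum using ([_,_]′)

  module Exhausted {n} (es : List (Vec Bool n)) (σ : State n) (not-bad : ¬ Sem.⟦_⟧ es bad σ [])
    (no-f1s : ¬ Local.Applies es f1sʳ σ) (no-f1d : ¬ Local.Applies es f1dʳ σ) (no-f2 : ¬ Local.Applies es f2ʳ σ)
    (no-f3a : ¬ Local.Applies es f3aʳ σ) (no-f3b : ¬ Local.Applies es f3bʳ σ) (no-f3c : ¬ Local.Applies es f3cʳ σ)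
    (no-f3d : ¬ Local.Applies es f3dʳ σ) where

    open Local es
    open Validity es σ not-bad

    private
      variable
        a b c g h k p q u v w x y z : Fin n

    disjoint-links : L x u v → L x a b → L x g h → (u ≢ a × u ≢ b) → (v ≢ a × v ≢ b) → ¬ Pair g h u v → ¬ Pair g h a b → ⊥
    disjoint-links l l' l'' d d' np np' = no-f1d (_ ∷ _ ∷ _ ∷ _ ∷ _ ∷ _ ∷ _ ∷ [] ,
      ((f₁ l , tt , tt) , (f₁ l , tt , tt) , tt) , l , l' , l'' , d , d' , np , np')

    star-links : L x u a → L x u b → L x u c → a ≢ b → b ≢ c → a ≢ c → ⊥
    star-links l l' l'' d d' d'' = no-f1s (_ ∷ _ ∷ _ ∷ _ ∷ _ ∷ [] ,
      ((f₁ l , tt , tt) , (f₁ l , tt , tt) , tt) , l , l' , l'' , d , d' , d'')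

    -- If `f2ʳ` is blocked, `u` has a live edge `u s t` avoiding `v` and `w`. If `x` is one of `s`,
    -- `t`, the link of `x` has three edges at `u`. Otherwise the link of `u` contains `x v`, the
    -- disjoint pair `s t`, and `x w`.
    triangle-links : L x u v → L x u w → L x v w → ⊥
    triangle-links {x} {u} {v} {w} l l' l'' with decide es σ (meets v1 v2 v3) (x ∷ u ∷ v ∷ w ∷ [])
    ... | yes m = no-f2 (x ∷ u ∷ v ∷ w ∷ [] ,
        ( (f₁ l , tt , tt) , adm , adm , adm , tt) , l , l' , l'' , m)
      where
      adm : F x × (x ≢ u × x ≢ v × x ≢ w × ⊤) × F u × (u ≢ v × u ≢ w × ⊤) × F v × (v ≢ w × ⊤) × F w × ⊤ × ⊤
      adm = f₁ l , (≢₁₂ l , ≢₁₃ l , ≢₁₃ l' , tt) , f₂ l , (≢₂₃ l , ≢₂₃ l' , tt) , f₃ l , (≢₂₃ l'' , tt) , f₃ l' , tt , tt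
    ... | no ¬m = ¬m λ (s , t , m , (sv , sw) , (tv , tw)) → case s t m sv sw tv tw
      where
      case : ∀ s t → L u s t → s ≢ v → s ≢ w → t ≢ v → t ≢ w → ⊥
      case s t m sv sw tv tw with x ≟ s | x ≟ t
      ... | yes refl | _ = star-links l l' (s₁₂ m) (≢₂₃ l'') (≢-sym tw) (≢-sym tv)
      ... | no _ | yes refl = star-links l l' (s₁₂ (s₂₃ m)) (≢₂₃ l'') (≢-sym sw) (≢-sym sv)
      ... | no xs | no xt = disjoint-links (s₁₂ l) m (s₁₂ l') (xs , xt) (≢-sym sv , ≢-sym tv)
            (λ { (inj₁ (_ , e)) → ≢₂₃ l'' (sym e) ; (inj₂ (e , _)) → ≢₁₃ l e })
            (λ { (inj₁ (e , _)) → xs e ; (inj₂ (e , _)) → xt e })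

    -- In the link of `x`, a third pair next to `u v` and `u w` passes through `u`, or joins `v` and
    -- `w`, or is disjoint from one of the two.
    shared-link : L x u v → L x u w → v ≢ w → L x g h → ¬ Pair g h u v → ¬ Pair g h u w → ⊥
    shared-link {x} {u} {v} {w} {g} {h} l l' vw m np np' with g ≟ u | h ≟ u
    ... | yes refl | _ = star-links l l' m vw (λ { refl → np' (inj₁ (refl , refl)) }) (λ { refl → np (inj₁ (refl , refl)) })
    ... | no _ | yes refl = star-links l l' (s₂₃ m) vw (λ { refl → np' (inj₂ (refl , refl)) }) (λ { refl → np (inj₂ (refl , refl)) })
    ... | no gu | no hu with g ≟ v | h ≟ v
    ... | yes refl | yes refl = ≢₂₃ m refl
    ... | no gv | no hv = disjoint-links m l l' (gu , gv) (hu , hv) (λ pr → np' (pair-sym pr))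
          (λ { (inj₁ (_ , e)) → vw (sym e) ; (inj₂ (e , _)) → ≢₂₃ l e })
    ... | yes refl | no _ with h ≟ w
    ...   | yes refl = triangle-links l l' m
    ...   | no hw = disjoint-links m l' l (gu , vw) (hu , hw) (λ pr → np (pair-sym pr))
          (λ { (inj₁ (_ , e)) → vw e ; (inj₂ (e , _)) → ≢₂₃ l' e })
    shared-link {x} {u} {v} {w} {g} {h} l l' vw m np np' | no gu | no hu | no gv | yes refl with g ≟ w
    ...   | yes refl = triangle-links l l' (s₂₃ m)
    ...   | no gw = disjoint-links m l' l (gu , gw) (hu , vw) (λ pr → np (pair-sym pr))
          (λ { (inj₁ (_ , e)) → vw e ; (inj₂ (e , _)) → ≢₂₃ l' e })

    pair-flip : Pair u v x y → Pair u v y x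
    pair-flip (inj₁ p) = inj₂ p
    pair-flip (inj₂ p) = inj₁ p

    pair-flip′ : Pair u v x y → Pair v u x y
    pair-flip′ (inj₁ (e , e')) = inj₂ (e' , e)
    pair-flip′ (inj₂ (e , e')) = inj₁ (e' , e)

    degree≤2 : L x u v → L x a b → L x g h → ¬ Pair u v a b → ¬ Pair u v g h → Pair g h a b
    degree≤2 {x} {u} {v} {a} {b} {g} {h} l l' l'' np np' with pair? g h a b
    ... | yes pr = pr
    ... | no np'' with u ≟ a | u ≟ b | v ≟ a | v ≟ b
    ... | yes refl | _ | _ | _ = ⊥-elim (shared-link l l' (λ { refl → np (inj₁ (refl , refl)) }) l'' (λ pr → np' (pair-sym pr)) np'')
    ... | _ | yes refl | _ | _ = ⊥-elim (shared-link l (s₂₃ l') (λ { refl → np (inj₂ (refl , refl)) }) l'' (λ pr → np' (pair-sym pr)) (λ pr → np'' (pair-flip pr)))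
    ... | _ | _ | yes refl | _ = ⊥-elim (shared-link (s₂₃ l) l' (λ { refl → np (inj₂ (refl , refl)) }) l'' (λ pr → np' (pair-sym (pair-flip pr))) np'')
    ... | _ | _ | _ | yes refl = ⊥-elim (shared-link (s₂₃ l) (s₂₃ l') (λ { refl → np (inj₁ (refl , refl)) }) l'' (λ pr → np' (pair-sym (pair-flip pr))) (λ pr → np'' (pair-flip pr)))
    ... | no ua | no ub | no va | no vb = ⊥-elim (disjoint-links l l' l'' (ua , ub) (va , vb) (λ pr → np' (pair-sym pr)) np'')

    Another : Fin n → Fin n → Fin n → Set
    Another x y z = ∃[ u ] ∃[ v ] (L x u v × ¬ Pair u v y z)

    another? : ∀ x y z → Dec (Another x y z)
    another? x y z = decide es σ (another v0 v1 v2) (x ∷ y ∷ z ∷ [])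

    another-flip : Another x y z → Another x z y
    another-flip (u , v , l , np) = u , v , l , λ pr → np (pair-flip pr)

    pendant : L a b c → ¬ Another c a b → ¬ Another a b c
    pendant l oc (g , h , l' , np) = no-f3a (_ ∷ _ ∷ _ ∷ _ ∷ _ ∷ [] ,
      ( (f₃ l , (≢-sym (≢₁₃ l) , ≢-sym (≢₂₃ l) , tt) , f₁ l , (≢₁₂ l , tt) , f₂ l , tt , tt)
      , (f₃ l , (≢-sym (≢₁₃ l) , tt) , f₁ l , tt , tt)
      , (f₃ l , (≢-sym (≢₁₃ l) , ≢-sym (≢₂₃ l) , tt) , f₁ l , (≢₁₂ l , tt) , f₂ l , tt , tt) , tt)
      , l , l' , np , oc)

    not-isolated : L a b c → ¬ Another a b c → ¬ Another b a c → ¬ Another c a b → ⊥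
    not-isolated {a} {b} {c} l oa ob oc = no-f3b (_ ∷ _ ∷ _ ∷ [] , (adm , adm , adm , tt) , l , oa , ob , oc)
      where
      adm : F a × (a ≢ b × a ≢ c × ⊤) × F b × (b ≢ c × ⊤) × F c × ⊤ × ⊤
      adm = f₁ l , (≢₁₂ l , ≢₁₃ l , tt) , f₂ l , (≢₂₃ l , tt) , f₃ l , tt , tt

    -- If `c` were in no other live edge, the failure of `f3aʳ` would deny one to `a` and `b` too,
    -- and the edge would be isolated, a case for `f3bʳ`.
    has-another : L a b c → Another c a b
    has-another {a} {b} {c} l with another? c a b
    ... | yes an = an
    ... | no oc = ⊥-elim (not-isolated l (pendant l oc) (pendant (s₁₂ l) (λ an → oc (another-flip an))) oc)

    -- The two edges exhaust the degrees of `a` and of `b`, so every live edge at one of these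
    -- contains the other, and `f3cʳ` would apply. Hence distinct live edges share at most one
    -- vertex.
    twins : L a b c → L a b w → c ≢ w → ⊥
    twins {a} {b} {c} {w} l l' cw = no-f3c (a ∷ b ∷ c ∷ w ∷ [] ,
        ( (f₁ l , (≢₁₂ l , tt) , f₂ l , tt , tt) , (f₁ l , (≢₁₂ l , tt) , f₂ l , tt , tt)
        , (f₁ l , (≢₁₂ l , ≢₁₃ l , ≢₁₃ l' , tt) , f₂ l , (≢₂₃ l , ≢₂₃ l' , tt) , f₃ l , (cw , tt) , f₃ l' , tt , tt) , tt)
        , l , l' , meet l l' , meet (s₁₂ l) (s₁₂ l'))
      where
      meet : ∀ {a b} → L a b c → L a b w → ¬ (∃[ u ] ∃[ v ] (L a u v × (u ≢ b × u ≢ b) × (v ≢ b × v ≢ b)))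
      meet l l' (u , v , m , (ub , _) , (vb , _)) with degree≤2 l l' m
          (λ { (inj₁ (_ , e)) → cw e ; (inj₂ (e , _)) → ≢₂₃ l' e })
          (λ { (inj₁ (e , _)) → ub (sym e) ; (inj₂ (e , _)) → vb (sym e) })
      ... | inj₁ (e , _) = ub e
      ... | inj₂ (_ , e) = vb e

    Off₂ : Fin n → Fin n → Fin n → Set
    Off₂ u x y = u ≢ x × u ≢ y

    off-edge : L a b c → L a g h → ¬ Pair g h b c → Off₂ g b c × Off₂ h b c
    off-edge l l' np =
        ((λ { refl → twins l l' (λ { refl → np (inj₁ (refl , refl)) }) })
        , (λ { refl → twins (s₂₃ l) l' (λ { refl → np (inj₂ (refl , refl)) }) }))
      , ((λ { refl → twins l (s₂₃ l') (λ { refl → np (inj₂ (refl , refl)) }) })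
        , (λ { refl → twins (s₂₃ l) (s₂₃ l') (λ { refl → np (inj₁ (refl , refl)) }) }))

    distinct-links : L a g h → L b p q → a ≢ b → ¬ Pair g h p q
    distinct-links l l' ab (inj₁ (refl , refl)) = twins (s₂₃ (s₁₂ l)) (s₂₃ (s₁₂ l')) ab
    distinct-links l l' ab (inj₂ (refl , refl)) = twins (s₂₃ (s₁₂ l)) (s₂₃ (s₁₂ (s₂₃ l'))) ab

    orient : L b p q → ¬ Pair p q g h → Off₂ p g h ⊎ Off₂ q g h
    orient {b} {p} {q} {g} {h} l np with p ≟ g | p ≟ h | q ≟ g | q ≟ h
    ... | no pg | no ph | _ | _ = inj₁ (pg , ph)
    ... | _ | _ | no qg | no qh = inj₂ (qg , qh)
    ... | yes refl | _ | yes refl | _ = ⊥-elim (≢₂₃ l refl)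
    ... | yes refl | _ | no _ | yes refl = ⊥-elim (np (inj₁ (refl , refl)))
    ... | no _ | yes refl | yes refl | _ = ⊥-elim (np (inj₂ (refl , refl)))
    ... | no _ | yes refl | no _ | yes refl = ⊥-elim (≢₂₃ l refl)

    only₂ : L a b c → L a g h → ¬ Pair g h b c → ¬ (∃[ u ] ∃[ v ] (L a u v × ¬ Pair u v b c × ¬ Pair u v g h))
    only₂ l l' np (u , v , m , np' , np'') = np'' (degree≤2 l l' m (λ pr → np (pair-sym pr)) (λ pr → np' (pair-sym pr)))

    -- What the other rules leave at a live edge: each of its vertices lies in one further live
    -- edge, and distinct live edges meet in at most one vertex. The `off` fields record the vertex
    -- choices that `f3dʳ` asks for.
    record TwoRegular : Set where
      field
        {vα vβ vγ g₁ g₂ h₁ h₂ k₁ k₂ vx} : Fin n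
        edge₀ : L vα vβ vγ
        edgeα : L vα g₁ g₂
        edgeβ : L vβ h₁ h₂
        edgeγ : L vγ k₁ k₂
        npα   : ¬ Pair g₁ g₂ vβ vγ
        npβ   : ¬ Pair h₁ h₂ vα vγ
        npγ   : ¬ Pair k₁ k₂ vα vβ
        off-h : Off₂ h₁ g₁ g₂
        off-k : Off₂ k₁ g₁ g₂
        vx∈   : vx ≡ k₁ ⊎ vx ≡ k₂
        off-x : Off₂ vx h₁ h₂

    impossible : ¬ TwoRegular
    impossible B = no-f3d (vα ∷ vβ ∷ vγ ∷ g₁ ∷ g₂ ∷ h₁ ∷ h₂ ∷ k₁ ∷ k₂ ∷ vx ∷ [] ,
        ( single , single , single
        , six edge₀ edgeα αo (f₂ edgeβ) (≢-sym (proj₁ (proj₁ βo)) , ≢₁₂ edgeβ , ≢-sym (proj₂ (proj₁ βo))) off-h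
        , six (s₂₃ edge₀) edgeα (swapᵒ αo) (f₂ edgeγ) (≢-sym (proj₁ (proj₁ γo)) , ≢₁₂ edgeγ , ≢-sym (proj₂ (proj₁ γo))) off-k
        , six (s₂₃ (s₁₂ edge₀)) edgeβ (swapᵒ βo) fx xo off-x , tt)
        , edge₀ , edgeα , edgeβ , edgeγ , vx∈
        , proj₁ αo , proj₂ αo , proj₁ βo , proj₂ βo , proj₁ γo , proj₂ γo , off-h , off-k , off-x
        , only₂ edge₀ edgeα npα , only₂ (s₁₂ edge₀) edgeβ npβ , only₂ (s₁₂ (s₂₃ edge₀)) edgeγ npγ)
      where
      open TwoRegular B
      αo : Off₂ g₁ vβ vγ × Off₂ g₂ vβ vγ
      αo = off-edge edge₀ edgeα npα
      βo : Off₂ h₁ vα vγ × Off₂ h₂ vα vγ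
      βo = off-edge (s₁₂ edge₀) edgeβ npβ
      γo : Off₂ k₁ vα vβ × Off₂ k₂ vα vβ
      γo = off-edge (s₁₂ (s₂₃ edge₀)) edgeγ npγ
      fx : F vx
      fx = [ (λ e → subst F (sym e) (f₂ edgeγ)) , (λ e → subst F (sym e) (f₃ edgeγ)) ]′ vx∈
      xo : vβ ≢ vx × vγ ≢ vx × vα ≢ vx
      xo = [ (λ { refl → ≢-sym (proj₂ (proj₁ γo)) , ≢₁₂ edgeγ , ≢-sym (proj₁ (proj₁ γo)) })
           , (λ { refl → ≢-sym (proj₂ (proj₂ γo)) , ≢₁₃ edgeγ , ≢-sym (proj₁ (proj₂ γo)) }) ]′ vx∈
      swapᵒ : ∀ {u v x y : Fin n} → Off₂ u x y × Off₂ v x y → Off₂ u y x × Off₂ v y x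
      swapᵒ ((a , b) , (c , d)) = (b , a) , (d , c)
      single : F vα × (vα ≢ vβ × vα ≢ vγ × ⊤) × F vβ × (vβ ≢ vγ × ⊤) × F vγ × ⊤ × ⊤
      single = f₁ edge₀ , (≢₁₂ edge₀ , ≢₁₃ edge₀ , tt) , f₂ edge₀ , (≢₂₃ edge₀ , tt) , f₃ edge₀ , tt , tt
      six : ∀ {a b c g h k} → L a b c → L a g h → Off₂ g b c × Off₂ h b c → F k → (a ≢ k × b ≢ k × c ≢ k) → Off₂ k g h →
        F a × (a ≢ b × a ≢ c × a ≢ g × a ≢ h × a ≢ k × ⊤) × F b × (b ≢ c × b ≢ g × b ≢ h × b ≢ k × ⊤)
        × F c × (c ≢ g × c ≢ h × c ≢ k × ⊤) × F g × (g ≢ h × g ≢ k × ⊤) × F h × (h ≢ k × ⊤) × F k × ⊤ × ⊤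
      six l l' ((gb , gc) , (hb , hc)) fk (ak , bk , ck) (kg , kh) =
          f₁ l , (≢₁₂ l , ≢₁₃ l , ≢₁₂ l' , ≢₁₃ l' , ak , tt) , f₂ l , (≢₂₃ l , ≢-sym gb , ≢-sym hb , bk , tt)
        , f₃ l , (≢-sym gc , ≢-sym hc , ck , tt) , f₂ l' , (≢₂₃ l' , ≢-sym kg , tt) , f₃ l' , (≢-sym kh , tt) , fk , tt , tt

    no-live : ¬ L a b c
    no-live {a} {b} {c} l with has-another (s₂₃ (s₁₂ l)) | has-another (s₂₃ l) | has-another l
    ... | g , g' , lg , ng | h , h' , lh , nh | k , k' , lk , nk =
        pick (orient lh (λ pr → distinct-links lh lg (≢-sym (≢₁₂ l)) pr)) (orient lk (λ pr → distinct-links lk lg (≢-sym (≢₁₃ l)) pr))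
      where
      finish : ∀ {h h' k k'} → L b h h' → ¬ Pair h h' a c → L c k k' → ¬ Pair k k' a b → Off₂ h g g' → Off₂ k g g' → ⊥
      finish lh nh lk nk oh ok with orient lk (λ pr → distinct-links lk lh (≢-sym (≢₂₃ l)) pr)
      ... | inj₁ ox = impossible (record { edge₀ = l ; edgeα = lg ; edgeβ = lh ; edgeγ = lk ; npα = ng ; npβ = nh
                                         ; npγ = nk ; off-h = oh ; off-k = ok ; vx∈ = inj₁ refl ; off-x = ox })
      ... | inj₂ ox = impossible (record { edge₀ = l ; edgeα = lg ; edgeβ = lh ; edgeγ = lk ; npα = ng ; npβ = nh
                                         ; npγ = nk ; off-h = oh ; off-k = ok ; vx∈ = inj₂ refl ; off-x = ox })
      pick : Off₂ h g g' ⊎ Off₂ h' g g' → Off₂ k g g' ⊎ Off₂ k' g g' → ⊥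
      pick (inj₁ oh) (inj₁ ok) = finish lh nh lk nk oh ok
      pick (inj₁ oh) (inj₂ ok) = finish lh nh (s₂₃ lk) (λ pr → nk (pair-flip′ pr)) oh ok
      pick (inj₂ oh) (inj₁ ok) = finish (s₂₃ lh) (λ pr → nh (pair-flip′ pr)) lk nk oh ok
      pick (inj₂ oh) (inj₂ ok) = finish (s₂₃ lh) (λ pr → nh (pair-flip′ pr)) (s₂₃ lk) (λ pr → nk (pair-flip′ pr)) oh ok

-- Selecting a rule by exhaustive search over tuples of vertices

module Select where

  open Machine
  open Formula
  open Branching
  open Rules
  open Fresh
  open Progress
  open import Data.Bool using () renaming (not to opposite)
  import Data.Bool.Properties as Bool
  open import Data.Fin using (Fin; zero; suc; toℕ)
  import Data.Fin.Properties as Fin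
  open import Data.List using (foldr; _++_)
  import Data.List.Properties as List
  open import Data.List.Membership.Propositional.Properties using (∈-map⁺)
  open import Data.List.Relation.Unary.All as All using (All; []; _∷_)
  import Data.List.Relation.Unary.All.Properties as All
  open import Data.List.Relation.Unary.AllPairs as AllPairs using (AllPairs; []; _∷_)
  import Data.List.Relation.Unary.AllPairs.Properties as AllPairs
  open import Data.List.Relation.Unary.Any as Any using (Any; here; any?)
  import Data.List.Relation.Unary.Any.Properties as Any
  open import Data.Nat using (ℕ; zero; suc; _*_; _∸_; _≤_; _≤?_)
  import Data.Product.Properties as Product
  open import Function using (_∘_)
  open import Relation.Nullary using (_×-dec_)
  open import Relation.Nullary.Decidable using (toWitness; True)

  search : ℕ → Query → Query
  search zero    q = q
  search (suc j) q = search j (first verticesᵖ q)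

  finds-search : ∀ {n} (es : List (Vec Bool n)) σ b j {B : Vec (Fin n) j → Set} {R : ∀ ρ → B ρ → Tree → Set} q →
    (∀ ρ → Finds (value q (context es σ ρ) b) (B ρ) (R ρ)) →
    Finds (value (search j q) (context es σ []) b) (∃[ ρ ] B ρ) (λ (ρ , x) → R ρ x)
  finds-search es σ b zero    q h = convert (λ x → [] , x) (λ r → r) (λ { ([] , x) → x }) (h [])
  finds-search {n} es σ b (suc j) q h =
    convert (λ (ρ , v , x) → v ∷ ρ , x) (λ r → r) (λ { (v ∷ ρ , x) → ρ , v , x })
      (finds-search es σ b j (first verticesᵖ q) (λ ρ → finds-vertex n (λ v → h (v ∷ ρ))))

  tls : ℕ → Exp 1 → Exp 1
  tls zero    e = e
  tls (suc k) e = tls k (tl e)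

  boolᵉ : Bool → Exp 1
  boolᵉ true  = cons `nil `nil
  boolᵉ false = `nil

  logᵉ : ∀ {k} → Leaf (Fin k) → Exp 1
  logᵉ []            = path logᵖ (hd X)
  logᵉ ((i , b) ∷ ℓ) = cons (cons (path (varᵖ (toℕ i)) (hd X)) (boolᵉ b)) (logᵉ ℓ)

  -- Since the tail of `nil` is `nil`, repeated tails of a unary budget compute the truncated
  -- subtraction of `extend`.
  childᵉ : ∀ {k} → Leaf (Fin k) → Exp 1
  childᵉ ℓ = cons (logᵉ ℓ) (cons (tls (2 * count true ℓ) (path onesᵖ (hd X))) (tls (2 * count false ℓ) (path zerosᵖ (hd X))))

  pushᵉ : ∀ {k} → List (Leaf (Fin k)) → Exp 1
  pushᵉ = foldr (λ ℓ e → cons (childᵉ ℓ) e) (hd (tl X))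

  push : List Tree → Tree → Tree
  push ts t = foldr _∙_ t ts

  ruleᵠ : Rule → Query
  ruleᵠ r = search (Rule.vars r) (query (full r) & out (cons (pushᵉ (Rule.leaves r)) (tl (tl X))))

  -- In order of priority: the validity of a rule may depend on the earlier ones not applying.
  rules : List Rule
  rules = unitʳ ∷ starʳ ∷ p3k2ʳ ∷ p4aʳ ∷ p4bʳ ∷ p3ʳ ∷ ndʳ ∷ domʳ ∷ f1sʳ ∷ f1dʳ ∷ f2ʳ ∷ f3aʳ ∷ f3bʳ ∷ f3cʳ ∷ f3dʳ ∷ isoʳ ∷ []

  rulesᵠ : List Rule → Query
  rulesᵠ = foldr (λ r q → ruleᵠ r ∥ q) (out `nil)

  opaque
    -- A bad state is popped, and otherwise the first applicable rule replaces it by its children.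
    -- The answer `nil` is left to signal that no rule applies.
    selectᵠ : Query
    selectᵠ = (query bad & out (tl X)) ∥ rulesᵠ rules

  tls-encode : ∀ k e t m → ev e t ≡ encodeℕ m → ev (tls k e) t ≡ encodeℕ (m ∸ k)
  tls-encode zero    e t m       eq = eq
  tls-encode (suc k) e t zero    eq = trans (tls-encode k (tl e) t zero (cong tlᵗ eq)) (cong encodeℕ (lem k))
    where
    lem : ∀ k → 0 ∸ k ≡ 0
    lem zero    = refl
    lem (suc k) = refl
  tls-encode (suc k) e t (suc m) eq = tls-encode k (tl e) t m (cong tlᵗ eq)

  count-inst : ∀ {n k} (ρ : Vec (Fin n) k) b ℓ → count b (inst ρ ℓ) ≡ count b ℓ
  count-inst ρ b     []                = refl
  count-inst ρ true  ((_ , true) ∷ ℓ)  = cong suc (count-inst ρ true ℓ)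
  count-inst ρ true  ((_ , false) ∷ ℓ) = count-inst ρ true ℓ
  count-inst ρ false ((_ , true) ∷ ℓ)  = count-inst ρ false ℓ
  count-inst ρ false ((_ , false) ∷ ℓ) = cong suc (count-inst ρ false ℓ)

  module _ {n} (es : List (Vec Bool n)) (σ : State n) (stack outs : Tree) where

    private
      current : ∀ {k} → Vec (Fin n) k → Tree
      current ρ = context es σ ρ ∙ (stack ∙ outs)

    ev-log : ∀ {k} (ρ : Vec (Fin n) k) ℓ → ev (logᵉ ℓ) (current ρ) ≡ encodeList encodeEntry (inst ρ ℓ ++ log σ)
    ev-log ρ []            = refl
    ev-log ρ ((i , b) ∷ ℓ) = cong₂ _∙_ (cong₂ _∙_ (trans (ev-path (varᵖ (toℕ i)) (hd X) (current ρ)) (at-var ρ i _)) (lem b)) (ev-log ρ ℓ)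
      where
      lem : ∀ b → ev (boolᵉ b) (current ρ) ≡ encodeBool b
      lem true  = refl
      lem false = refl

    ev-child : ∀ {k} (ρ : Vec (Fin n) k) ℓ → ev (childᵉ ℓ) (current ρ) ≡ encodeState (extend σ (inst ρ ℓ))
    ev-child ρ ℓ = cong₂ _∙_ (ev-log ρ ℓ) (cong₂ _∙_
      (trans (tls-encode (2 * count true ℓ) (path onesᵖ (hd X)) (current ρ) (ones σ) refl) (cong (λ m → encodeℕ (ones σ ∸ 2 * m)) (sym (count-inst ρ true ℓ))))
      (trans (tls-encode (2 * count false ℓ) (path zerosᵖ (hd X)) (current ρ) (zeros σ) refl) (cong (λ m → encodeℕ (zeros σ ∸ 2 * m)) (sym (count-inst ρ false ℓ)))))

    children : List (Leaf (Fin n)) → Tree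
    children ℓs = push (map (encodeState ∘ extend σ) ℓs) stack ∙ outs

    ev-push : ∀ {k} (ρ : Vec (Fin n) k) ℓs → ev (cons (pushᵉ ℓs) (tl (tl X))) (current ρ) ≡ children (map (inst ρ) ℓs)
    ev-push ρ ℓs = cong (_∙ outs) (go ℓs)
      where
      go : ∀ ℓs → ev (pushᵉ ℓs) (current ρ) ≡ push (map (encodeState ∘ extend σ) (map (inst ρ) ℓs)) stack
      go []       = refl
      go (ℓ ∷ ℓs) = cong₂ _∙_ (ev-child ρ ℓ) (go ℓs)

    open Local es

    finds-rule : ∀ r → Finds (value (ruleᵠ r) (context es σ []) (stack ∙ outs)) (Applies r σ)
      (λ (ρ , _) t → t ≡ children (map (inst ρ) (Rule.leaves r)))
    finds-rule r = convert (λ (ρ , a , _) → ρ , a) (λ e → e) (λ (ρ , a) → ρ , a , tt)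
      (finds-search es σ (stack ∙ outs) (Rule.vars r) {B = λ ρ → ⟦ full r ⟧ σ ρ × ⊤}
        {R = λ ρ _ t → t ≡ children (map (inst ρ) (Rule.leaves r))} _ λ ρ →
        finds-and (query-correct es σ (stack ∙ outs) (full r) ρ) (found tt (ev-push ρ (Rule.leaves r)) cons))

  -- Leaves that disagree on some vertex have no common extension; this keeps the enumeration free
  -- of repetitions.
  Conflict : ∀ {A : Set} → Leaf A → Leaf A → Set
  Conflict ℓ ℓ' = Any (λ (v , b) → (v , opposite b) ∈ ℓ') ℓ

  Distinct : ∀ {A : Set} → Leaf A → Set
  Distinct = AllPairs (λ (u , _) (v , _) → u ≢ v)

  NonemptyLeaf : ∀ {A : Set} → Leaf A → Set
  NonemptyLeaf ℓ = 1 ≤ length ℓ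

  -- A purely syntactic condition, so evaluation settles it for each rule. The limit on the leaves
  -- lets a parent pay for its dead children in `steps≤`.
  WellFormed : Rule → Set
  WellFormed (rule k _ ℓs) = AllPairs Conflict ℓs × All NonemptyLeaf ℓs × length ℓs ≤ 7

  well-formed? : ∀ r → Dec (WellFormed r)
  well-formed? (rule k _ ℓs) =
          AllPairs.allPairs? (λ ℓ ℓ' → any? (λ (v , b) → any? (Product.≡-dec Fin._≟_ Bool._≟_ (v , opposite b)) ℓ') ℓ) ℓs
    ×-dec All.all? (λ ℓ → 1 ≤? length ℓ) ℓs ×-dec (length ℓs ≤? 7)

  module Choice {n} (es : List (Vec Bool n)) (σ : State n) where

    open Local es

    record Branches (ℓs : List (Leaf (Fin n))) : Set where
      field
        not-bad   : ¬ Bad σ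
        bounded   : Bounded σ ℓs
        covers    : Covers σ ℓs
        conflicts : AllPairs Conflict ℓs
        few       : length ℓs ≤ 7
        nonempty  : All NonemptyLeaf ℓs
        distinct  : All Distinct ℓs
        unset     : All (All (Free σ ∘ proj₁)) ℓs

    data Chosen (stack outs : Tree) : Tree → Set where
      discard  : Bad σ → Chosen stack outs (stack ∙ outs)
      branch   : ∀ {ℓs} → Branches ℓs → Chosen stack outs (children es σ stack outs ℓs)
      finished : ¬ Bad σ → (∀ v → ¬ Free σ v) → Chosen stack outs nil

    admissible-sound : ∀ {k} (ρ : Vec (Fin n) k) ℓ → ⟦ admissible ℓ ⟧ σ ρ → Distinct (inst ρ ℓ) × All (Free σ ∘ proj₁) (inst ρ ℓ)
    admissible-sound ρ []            _            = [] , []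
    admissible-sound ρ ((i , b) ∷ ℓ) (f , a , as) = go ℓ a ∷ proj₁ (admissible-sound ρ ℓ as) , f ∷ proj₂ (admissible-sound ρ ℓ as)
      where
      go : ∀ ℓ → ⟦ apart i ℓ ⟧ σ ρ → All (λ (v , _) → lookup ρ i ≢ v) (inst ρ ℓ)
      go []            _       = []
      go ((j , _) ∷ ℓ) (h , t) = h ∷ go ℓ t

    all-admissible-sound : ∀ {k} (ρ : Vec (Fin n) k) ℓs → ⟦ all-admissible ℓs ⟧ σ ρ →
      All Distinct (map (inst ρ) ℓs) × All (All (Free σ ∘ proj₁)) (map (inst ρ) ℓs)
    all-admissible-sound ρ []       _        = [] , []
    all-admissible-sound ρ (ℓ ∷ ℓs) (a , as) =
        proj₁ (admissible-sound ρ ℓ a) ∷ proj₁ (all-admissible-sound ρ ℓs as)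
      , proj₂ (admissible-sound ρ ℓ a) ∷ proj₂ (all-admissible-sound ρ ℓs as)

    conflict-inst : ∀ {k} (ρ : Vec (Fin n) k) {ℓ ℓ'} → Conflict ℓ ℓ' → Conflict (inst ρ ℓ) (inst ρ ℓ')
    conflict-inst ρ c = Any.map⁺ (Any.map (∈-map⁺ _) c)

    branches : ∀ r {_ : True (well-formed? r)} → ¬ Bad σ → Valid r σ → ((ρ , _) : Applies r σ) → Branches (map (inst ρ) (Rule.leaves r))
    branches r {wf} nb valid (ρ , h) = record
      { not-bad   = nb
      ; bounded   = proj₁ (valid ρ h)
      ; covers    = proj₂ (valid ρ h)
      ; conflicts = AllPairs.map⁺ (AllPairs.map (conflict-inst ρ) (proj₁ w))
      ; few       = subst (_≤ 7) (sym (List.length-map (inst ρ) (Rule.leaves r))) (proj₂ (proj₂ w))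
      ; nonempty  = All.map⁺ (All.map (λ {ℓ} → subst (1 ≤_) (sym (List.length-map _ ℓ))) (proj₁ (proj₂ w)))
      ; distinct  = proj₁ (all-admissible-sound ρ (Rule.leaves r) (proj₁ h))
      ; unset     = proj₂ (all-admissible-sound ρ (Rule.leaves r) (proj₁ h))
      }
      where
      w : WellFormed r
      w = toWitness wf

    orElse : ∀ {t u A} {R : A → Tree → Set} {P : Tree → Set} → Finds t A R → (∀ a {t} → R a t → P t) → (¬ A → P u) → P (orᵗ t u)
    orElse (none refl ¬a)     f g = g ¬a
    orElse (found a r cons)   f g = f a r

    module _ (stack outs : Tree) where

      private
        try : ∀ r {u} {_ : True (well-formed? r)} → ¬ Bad σ → Valid r σ → (¬ Applies r σ → Chosen stack outs u) →
          Chosen stack outs (orᵗ (value (ruleᵠ r) (context es σ []) (stack ∙ outs)) u)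
        try r {_} {wf} nb valid = orElse {P = Chosen stack outs} (finds-rule es σ stack outs r) (λ { a refl → branch (branches r {wf} nb valid a) })

      -- Color 1 would require a private live edge at `v`, and no live edge is left; so a single
      -- leaf covers everything.
      iso-valid : ¬ Bad σ → (∀ u → ¬ Unit σ u) → (∀ {u v} → ¬ Two σ u v) → (∀ {u v w} → ¬ Live σ u v w) → Valid isoʳ σ
      iso-valid nb nu nt nl (v ∷ []) (((f , _) , _) , _) =
          fresh nt (add any 489898 tt [])
        , cover
        where
        open ClauseValidity es σ nb nu
        cover : Covers σ _
        cover {χ} good ext with dichotomy (χ v)
        ... | inj₂ h = here (h ∷ [])
        ... | inj₁ h with private-live nt good ext f h
        ... | _ , _ , l , _ = ⊥-elim (nl l)

      opaque
        unfolding selectᵠ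

        -- Each failed test is a hypothesis for the rules after it; in particular the failure of all
        -- rules on clauses shows that there are none, and the failure of the next seven that no
        -- edge is live.
        select-correct : Chosen stack outs (value selectᵠ (context es σ []) (stack ∙ outs))
        select-correct =
          orElse {P = Chosen stack outs} (finds-and {R = λ _ t → t ≡ stack ∙ outs} (query-correct es σ (stack ∙ outs) bad []) (found tt refl cons))
                 (λ { (b , _) refl → discard b }) λ n₀ →
          let nb : ¬ Bad σ
              nb b = n₀ (b , tt) in
          let open Validity es σ nb in
          try unitʳ nb unit-valid λ n₁ →
          let nu : ∀ u → ¬ Unit σ u
              nu u h = n₁ (u ∷ [] , ((proj₁ h , tt , tt) , tt) , h) in
          let open ClauseValidity es σ nb nu in
          try starʳ nb (star-valid nu) λ n₂ →
          try p3k2ʳ nb (p3k2-valid nu) λ n₃ →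
          try p4aʳ nb (p4a-valid nu) λ n₄ →
          try p4bʳ nb (p4b-valid nu n₂) λ n₅ →
          try p3ʳ nb (p3-valid nu n₂ n₃ n₄ n₅) λ n₆ →
          try ndʳ nb (nd-valid n₆) λ n₇ →
          try domʳ nb (dom-valid n₆) λ n₈ →
          let nt : ∀ {u v} → ¬ Two σ u v
              nt = no-two n₆ n₇ n₈ in
          try f1sʳ nb (f1s-valid nt) λ m₁ →
          try f1dʳ nb (f1d-valid nt) λ m₂ →
          try f2ʳ nb (f2-valid nt) λ m₃ →
          try f3aʳ nb (f3a-valid nt) λ m₄ →
          try f3bʳ nb (f3b-valid nt) λ m₅ →
          try f3cʳ nb (f3c-valid nt) λ m₆ →
          try f3dʳ nb (f3d-valid nt) λ m₇ →
          try isoʳ nb (iso-valid nb nu nt (Exhausted.no-live es σ nb m₁ m₂ m₃ m₄ m₅ m₆ m₇)) λ n₉ →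
          finished nb (λ v f → n₉ (v ∷ [] , ((f , tt , tt) , tt) , tt))

-- Arithmetic of weights in fourth powers

module Bounds where

  open Branching
  open import Data.Bool using (T)
  open import Data.Nat
  open import Data.Nat.Properties
  open import Data.Nat.Tactic.RingSolver using (solve-∀)

  mul⁴ : ∀ a b → (a * b) ^ 4 ≡ a ^ 4 * b ^ 4
  mul⁴ = lem
    where
    lem : ∀ a b → a * b * (a * b * (a * b * (a * b * 1))) ≡ a * (a * (a * (a * 1))) * (b * (b * (b * (b * 1))))
    lem = solve-∀

  ^⁴-mono : ∀ {a b} → a ≤ b → a ^ 4 ≤ b ^ 4
  ^⁴-mono = ^-monoˡ-≤ 4

  -- If x/u ≤ y/v, the mediant (x + y)/(u + v) is at most y/v, so the bound on y/v carries over and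
  -- no roots are taken. For v = 0, positivity of `A` forces y = 0.
  dominated : ∀ {A B} → 1 ≤ A → ∀ {x y u v} → x ^ 4 * A ≤ u ^ 4 * B → y ^ 4 * A ≤ v ^ 4 * B → x * v ≤ y * u → (x + y) ^ 4 * A ≤ (u + v) ^ 4 * B
  dominated {A} {B} pos {x} {zero}  {u} {zero} hx hy le =
    subst₂ (λ a b → a ^ 4 * A ≤ b ^ 4 * B) (sym (+-identityʳ x)) (sym (+-identityʳ u)) hx
  dominated pos {x} {suc y} {u} {zero} hx hy le with ≤-trans (*-mono-≤ (m^n>0 (suc y) 4) pos) hy
  ... | ()
  dominated {A} {B} pos {x} {y} {u} {suc v} hx hy le = *-cancelˡ-≤ (suc v ^ 4) {{>-nonZero (m^n>0 (suc v) 4)}} (begin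
    suc v ^ 4 * ((x + y) ^ 4 * A)   ≡⟨ solve-lem (suc v ^ 4) ((x + y) ^ 4) A ⟩
    ((x + y) ^ 4 * suc v ^ 4) * A   ≡⟨ cong (_* A) (sym (mul⁴ (x + y) (suc v))) ⟩
    ((x + y) * suc v) ^ 4 * A       ≤⟨ *-monoˡ-≤ A (^⁴-mono cross) ⟩
    (y * (u + suc v)) ^ 4 * A       ≡⟨ cong (_* A) (mul⁴ y (u + suc v)) ⟩
    (y ^ 4 * (u + suc v) ^ 4) * A   ≡⟨ solve-lem₂ (y ^ 4) ((u + suc v) ^ 4) A ⟩
    (u + suc v) ^ 4 * (y ^ 4 * A)   ≤⟨ *-monoʳ-≤ ((u + suc v) ^ 4) hy ⟩
    (u + suc v) ^ 4 * (suc v ^ 4 * B) ≡⟨ solve-lem₃ ((u + suc v) ^ 4) (suc v ^ 4) B ⟩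
    suc v ^ 4 * ((u + suc v) ^ 4 * B) ∎)
    where
    open ≤-Reasoning
    solve-lem : ∀ a b c → a * (b * c) ≡ b * a * c
    solve-lem = solve-∀
    solve-lem₂ : ∀ a b c → a * b * c ≡ b * (a * c)
    solve-lem₂ = solve-∀
    solve-lem₃ : ∀ a b c → a * (b * c) ≡ b * (a * c)
    solve-lem₃ = solve-∀
    cross : (x + y) * suc v ≤ y * (u + suc v)
    cross = begin
      (x + y) * suc v           ≡⟨ *-distribʳ-+ (suc v) x y ⟩
      x * suc v + y * suc v     ≤⟨ +-monoˡ-≤ (y * suc v) le ⟩
      y * u + y * suc v         ≡⟨ sym (*-distribˡ-+ y u (suc v)) ⟩
      y * (u + suc v) ∎

  -- x ≤ u R and y ≤ v R imply x + y ≤ (u + v) R, where R⁴ = B / A.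
  add⁴ : ∀ {x y u v A B} → 1 ≤ A → x ^ 4 * A ≤ u ^ 4 * B → y ^ 4 * A ≤ v ^ 4 * B → (x + y) ^ 4 * A ≤ (u + v) ^ 4 * B
  add⁴ {x} {y} {u} {v} {A} {B} pos hx hy with ≤-total (x * v) (y * u)
  ... | inj₁ le = dominated {A} {B} pos {x} {y} {u} {v} hx hy le
  ... | inj₂ ge = subst₂ (λ a b → a ^ 4 * A ≤ b ^ 4 * B) (+-comm y x) (+-comm v u) (dominated {A} {B} pos {y} {x} {v} {u} hy hx ge)

  opaque
    unit⁴ : ℕ
    unit⁴ = num any ^ 4

  opaque
    unfolding unit⁴

    -- x is at most K d / 600000 times 2^(p/2) · (3/2)^(q/4), the weight of a state
    -- in which p/2 vertices may still get color 1 and q/2 vertices color 0.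
    Within : ℕ → ℕ → ℕ → ℕ → ℕ → Set
    Within K x d p q = x ^ 4 * (2 ^ q * unit⁴) ≤ (K * d) ^ 4 * (4 ^ p * 3 ^ q)

    unit⁴-pos : 1 ≤ unit⁴
    unit⁴-pos = ≤ᵇ⇒≤ 1 (num any ^ 4) tt

    within-any : ∀ p q → Within 1 1 (num any) p q
    within-any p q = begin
      1 * (2 ^ q * num any ^ 4)              ≡⟨ *-identityˡ _ ⟩
      2 ^ q * num any ^ 4                    ≤⟨ *-monoˡ-≤ (num any ^ 4) (≤-trans (^-monoˡ-≤ q (s≤s (s≤s (z≤n {1}))))
                                                  (m≤n*m (3 ^ q) (4 ^ p) {{>-nonZero (m^n>0 4 p)}})) ⟩
      (4 ^ p * 3 ^ q) * num any ^ 4          ≡⟨ *-comm (4 ^ p * 3 ^ q) _ ⟩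
      num any ^ 4 * (4 ^ p * 3 ^ q)          ≡⟨ cong (λ m → m ^ 4 * (4 ^ p * 3 ^ q)) (sym (*-identityˡ (num any))) ⟩
      (1 * num any) ^ 4 * (4 ^ p * 3 ^ q) ∎
      where open ≤-Reasoning

    -- Every class bound is at least one half, so a factor 2 pays for a single node whatever its
    -- class.
    num-any≤ : ∀ c → unit⁴ ≤ (2 * num c) ^ 4
    num-any≤ any       = ≤ᵇ⇒≤ (num any ^ 4) ((2 * num any) ^ 4) tt
    num-any≤ one-two   = ≤ᵇ⇒≤ (num any ^ 4) ((2 * num one-two) ^ 4) tt
    num-any≤ two-two   = ≤ᵇ⇒≤ (num any ^ 4) ((2 * num two-two) ^ 4) tt
    num-any≤ three-two = ≤ᵇ⇒≤ (num any ^ 4) ((2 * num three-two) ^ 4) tt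
    num-any≤ one-unit  = ≤ᵇ⇒≤ (num any ^ 4) ((2 * num one-unit) ^ 4) tt

    within-one : ∀ c p q → Within 2 1 (num c) p q
    within-one c p q = begin
      1 * (2 ^ q * unit⁴)                 ≡⟨ *-identityˡ _ ⟩
      2 ^ q * unit⁴                       ≤⟨ *-mono-≤ (≤-trans (^-monoˡ-≤ q (s≤s (s≤s (z≤n {1}))))
                                               (m≤n*m (3 ^ q) (4 ^ p) {{>-nonZero (m^n>0 4 p)}})) (num-any≤ c) ⟩
      (4 ^ p * 3 ^ q) * (2 * num c) ^ 4   ≡⟨ *-comm (4 ^ p * 3 ^ q) ((2 * num c) ^ 4) ⟩
      (2 * num c) ^ 4 * (4 ^ p * 3 ^ q) ∎
      where open ≤-Reasoning

    within-zero : ∀ {K d p q} → Within K 0 d p q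
    within-zero = z≤n

    scale-pos : ∀ q → 1 ≤ 2 ^ q * unit⁴
    scale-pos q = *-mono-≤ (m^n>0 2 q) unit⁴-pos

    within-+ : ∀ {K x y d e p q} → Within K x d p q → Within K y e p q → Within K (x + y) (d + e) p q
    within-+ {K} {x} {y} {d} {e} {p} {q} hx hy = subst (λ m → (x + y) ^ 4 * (2 ^ q * unit⁴) ≤ m ^ 4 * (4 ^ p * 3 ^ q))
      (sym (*-distribˡ-+ K d e)) (add⁴ {x} {y} {K * d} {K * e} (scale-pos q) hx hy)

    -- Placing a node on top of its subtrees adds 2 to the factor. Over the depth of the tree this
    -- adds up to the linear factor in the number of nodes.
    within-suc : ∀ {K x} c {p q} → Within K x (num c) p q → Within (2 + K) (1 + x) (num c) p q
    within-suc {K} {x} c {p} {q} hx = subst (λ m → (1 + x) ^ 4 * (2 ^ q * unit⁴) ≤ m ^ 4 * (4 ^ p * 3 ^ q))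
      (sym (*-distribʳ-+ (num c) 2 K)) (add⁴ {1} {x} {2 * num c} {K * num c} (scale-pos q) (within-one c p q) hx)

    within-mono : ∀ {K L x d e p q} → K ≤ L → d ≤ e → Within K x d p q → Within L x e p q
    within-mono {p = p} {q} le le' h = ≤-trans h (*-monoˡ-≤ (4 ^ p * 3 ^ q) (^⁴-mono (*-mono-≤ le le')))

    pow-+ : ∀ m a b → m ^ (a + 2 * b) ≡ m ^ a * (m ^ 2) ^ b
    pow-+ m a b = trans (^-distribˡ-+-* m a (2 * b)) (cong (m ^ a *_) (sym (^-*-assoc m 2 b)))

    -- Spending `o` and `z` vertices shrinks 2^(p/2) · (3/2)^(q/4) by exactly the cost of the leaf,
    -- and `fits` compares this cost times the class bound with the share, in fourth powers.
    within-extend : ∀ {K x d p q} c o z → T (fits c d o z) → Within K x (num c) p q → Within K x d (p + 2 * o) (q + 2 * z)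
    within-extend {K} {x} {d} {p} {q} c o z fit h = begin
      x ^ 4 * (2 ^ (q + 2 * z) * unit⁴)                           ≡⟨ cong (λ m → x ^ 4 * (m * unit⁴)) (pow-+ 2 q z) ⟩
      x ^ 4 * (2 ^ q * 4 ^ z * unit⁴)                             ≡⟨ e₁ (x ^ 4) (2 ^ q) (4 ^ z) unit⁴ ⟩
      x ^ 4 * (2 ^ q * unit⁴) * 4 ^ z                             ≤⟨ *-monoˡ-≤ (4 ^ z) h ⟩
      (K * num c) ^ 4 * (4 ^ p * 3 ^ q) * 4 ^ z                   ≡⟨ cong (λ m → m * (4 ^ p * 3 ^ q) * 4 ^ z) (mul⁴ K (num c)) ⟩
      K ^ 4 * num c ^ 4 * (4 ^ p * 3 ^ q) * 4 ^ z                 ≡⟨ e₂ (K ^ 4) (num c ^ 4) (4 ^ p * 3 ^ q) (4 ^ z) ⟩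
      K ^ 4 * (4 ^ p * 3 ^ q) * (num c ^ 4 * 4 ^ z)               ≤⟨ *-monoʳ-≤ (K ^ 4 * (4 ^ p * 3 ^ q)) (≤ᵇ⇒≤ _ _ fit) ⟩
      K ^ 4 * (4 ^ p * 3 ^ q) * (d ^ 4 * (16 ^ o * 9 ^ z))        ≡⟨ e₃ (K ^ 4) (4 ^ p) (3 ^ q) (d ^ 4) (16 ^ o) (9 ^ z) ⟩
      K ^ 4 * d ^ 4 * (4 ^ p * 16 ^ o * (3 ^ q * 9 ^ z))          ≡⟨ cong₂ (λ m k → K ^ 4 * d ^ 4 * (m * k)) (sym (pow-+ 4 p o)) (sym (pow-+ 3 q z)) ⟩
      K ^ 4 * d ^ 4 * (4 ^ (p + 2 * o) * 3 ^ (q + 2 * z))         ≡⟨ cong (_* (4 ^ (p + 2 * o) * 3 ^ (q + 2 * z))) (sym (mul⁴ K d)) ⟩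
      (K * d) ^ 4 * (4 ^ (p + 2 * o) * 3 ^ (q + 2 * z)) ∎
      where
      open ≤-Reasoning
      e₁ : ∀ a b c d → a * (b * c * d) ≡ a * (b * d) * c
      e₁ = solve-∀
      e₂ : ∀ a b c d → a * b * c * d ≡ a * c * (b * d)
      e₂ = solve-∀
      e₃ : ∀ a b c d e f → a * (b * c) * (d * (e * f)) ≡ a * d * (b * e * (c * f))
      e₃ = solve-∀

    -- With n the number of vertices, the root has p = q = n.
    within-root : ∀ {K x n} → Within K x (num any) n n → x ^ 4 ≤ K ^ 4 * 6 ^ n
    within-root {K} {x} {n} h = *-cancelʳ-≤ (x ^ 4) (K ^ 4 * 6 ^ n) (2 ^ n * num any ^ 4)
      {{>-nonZero (scale-pos n)}} (begin
      x ^ 4 * (2 ^ n * num any ^ 4)                       ≤⟨ h ⟩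
      (K * num any) ^ 4 * (4 ^ n * 3 ^ n)                 ≡⟨ cong₂ _*_ (mul⁴ K (num any)) four-three ⟩
      K ^ 4 * num any ^ 4 * (6 ^ n * 2 ^ n)               ≡⟨ e (K ^ 4) (num any ^ 4) (6 ^ n) (2 ^ n) ⟩
      K ^ 4 * 6 ^ n * (2 ^ n * num any ^ 4) ∎)
      where
      open ≤-Reasoning
      e : ∀ a b c d → a * b * (c * d) ≡ a * c * (d * b)
      e = solve-∀
      distrib : ∀ a b n → (a * b) ^ n ≡ a ^ n * b ^ n
      distrib a b zero    = refl
      distrib a b (suc n) = trans (cong (a * b *_) (distrib a b n)) (e′ a b (a ^ n) (b ^ n))
        where
        e′ : ∀ a b c d → a * b * (c * d) ≡ a * c * (b * d)
        e′ = solve-∀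
      four-three : 4 ^ n * 3 ^ n ≡ 6 ^ n * 2 ^ n
      four-three = trans (sym (distrib 4 3 n)) (distrib 6 2 n)

-- The search tree: exhaustive, without repetitions, and small

module Search where

  open Machine
  open Formula
  open Branching
  open Select
  open Bounds
  open import Data.Bool using (T) renaming (not to opposite)
  open import Data.Empty using (⊥)
  open import Data.Fin using (Fin; zero; suc)
  import Data.Fin.Properties as Fin
  open import Data.List using (_++_) renaming (lookup to lookupˡ)
  import Data.List.Properties as List
  open import Data.List.Membership.Propositional using (find)
  open import Data.List.Membership.Propositional.Properties using (∈-++⁺ʳ; ∈-++⁺ˡ; ∈-++⁻)
  open import Data.List.Relation.Unary.All as All using (All; []; _∷_)
  import Data.List.Relation.Unary.All.Properties as All
  open import Data.List.Relation.Unary.AllPairs as AllPairs using (AllPairs; []; _∷_)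
  import Data.List.Relation.Unary.AllPairs.Properties as AllPairs
  open import Data.List.Relation.Unary.Any as Any using (Any; here; there)
  open import Data.List.Relation.Unary.Unique.Propositional using (Unique)
  import Data.List.Relation.Unary.Unique.Propositional.Properties as Unique
  open import Data.Nat
  open import Data.Nat.Properties
  open import Data.Nat.Tactic.RingSolver using (solve-∀)
  open import Data.Vec using (tabulate)
  open import Data.Vec.Properties using (lookup∘tabulate)
  open import Function using (_∘_)
  open import Relation.Nullary using (does)

  distinct-bound : ∀ {n} (ℓ : Leaf (Fin n)) → Distinct ℓ → length ℓ ≤ n
  distinct-bound ℓ d = Fin.injective⇒≤ (λ {i} {j} → injective d i j)
    where
    at′ : ∀ {n} (ℓ : Leaf (Fin n)) → Fin (length ℓ) → Fin n
    at′ ℓ i = proj₁ (lookupˡ ℓ i)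
    off : ∀ {n} {ℓ : Leaf (Fin n)} {v} → All (λ (u , _) → v ≢ u) ℓ → ∀ i → v ≢ at′ ℓ i
    off (h ∷ hs) zero    = h
    off (h ∷ hs) (suc i) = off hs i
    injective : ∀ {n} {ℓ : Leaf (Fin n)} → Distinct ℓ → ∀ i j → at′ ℓ i ≡ at′ ℓ j → i ≡ j
    injective (h ∷ d) zero    zero    e = refl
    injective (h ∷ d) zero    (suc j) e = ⊥-elim (off h j e)
    injective (h ∷ d) (suc i) zero    e = ⊥-elim (off h i (sym e))
    injective (h ∷ d) (suc i) (suc j) e = cong suc (injective d i j e)

  count-++ : ∀ {A : Set} b (ℓ ℓ' : Leaf A) → count b (ℓ ++ ℓ') ≡ count b ℓ' + count b ℓ
  count-++ b     []                ℓ' = sym (+-identityʳ _)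
  count-++ true  ((_ , true) ∷ ℓ)  ℓ' = trans (cong suc (count-++ true ℓ ℓ')) (sym (+-suc _ _))
  count-++ true  ((_ , false) ∷ ℓ) ℓ' = count-++ true ℓ ℓ'
  count-++ false ((_ , true) ∷ ℓ)  ℓ' = count-++ false ℓ ℓ'
  count-++ false ((_ , false) ∷ ℓ) ℓ' = trans (cong suc (count-++ false ℓ ℓ')) (sym (+-suc _ _))

  module Explore {n} (es : List (Vec Bool n)) where

    open Local es

    record Inv (σ : State n) : Set where
      field
        distinct : Distinct (log σ)
        ones≡    : ones σ ≡ suc n ∸ 2 * count true (log σ)
        zeros≡   : zeros σ ≡ suc n ∸ 2 * count false (log σ)

    inv-extend : ∀ σ {ℓ} → Inv σ → Distinct ℓ → All (Free σ ∘ proj₁) ℓ → Inv (extend σ ℓ)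
    inv-extend σ {ℓ} inv d f = record
      { distinct = AllPairs.++⁺ d (Inv.distinct inv) (All.map (λ {e} → apart′ {e}) f)
      ; ones≡    = spend true (Inv.ones≡ inv)
      ; zeros≡   = spend false (Inv.zeros≡ inv)
      }
      where
      apart′ : ∀ {e : Fin n × Bool} → Free σ (proj₁ e) → All (λ (v , _) → proj₁ e ≢ v) (log σ)
      apart′ (nt , nf) = All.tabulate λ { {_ , true} h refl → nt h ; {_ , false} h refl → nf h }
      spend : ∀ b {k} → k ≡ suc n ∸ 2 * count b (log σ) → k ∸ 2 * count b ℓ ≡ suc n ∸ 2 * count b (ℓ ++ log σ)
      spend b refl = trans (∸-+-assoc (suc n) (2 * count b (log σ)) (2 * count b ℓ))
        (cong (suc n ∸_) (trans (sym (*-distribˡ-+ 2 (count b (log σ)) (count b ℓ))) (cong (2 *_) (sym (count-++ b ℓ (log σ))))))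

    Balanced : (Fin n → Bool) → Set
    Balanced χ = ∀ b ℓ → Distinct ℓ → Agrees χ ℓ → 2 * count b ℓ ≤ n

    -- This is why discarding bad states loses no coloring. The offset n + 1 in the budgets matters:
    -- a color used on exactly n/2 vertices still leaves 1.
    not-spent : ∀ {χ σ} → Good χ → Balanced χ → Inv σ → Extends χ σ → ¬ Bad σ
    not-spent good bal inv ext (inj₁ (v , t , f)) = true≢false (ext t) (ext f)
    not-spent good bal inv ext (inj₂ (inj₁ (u , v , w , e , hu , hv , hw))) = proper good false e (ext hu) (ext hv) (ext hw)
    not-spent good bal inv ext (inj₂ (inj₂ (inj₁ (u , v , w , e , hu , hv , hw)))) = proper good true e (ext hu) (ext hv) (ext hw)
    not-spent {σ = σ} good bal inv ext (inj₂ (inj₂ (inj₂ s))) = go s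
      where
      left : ∀ b {k} → k ≡ suc n ∸ 2 * count b (log σ) → k ≢ 0
      left b refl e = <⇒≱ (s≤s (bal b (log σ) (Inv.distinct inv) (All.tabulate ext))) (m∸n≡0⇒m≤n e)
      go : ones σ ≡ 0 ⊎ zeros σ ≡ 0 → ⊥
      go (inj₁ e) = left true (Inv.ones≡ inv) e
      go (inj₂ e) = left false (Inv.zeros≡ inv) e

    bits : State n → Vec Bool n
    bits σ = tabulate (λ v → does (decide es σ (asg true zero) (v ∷ [])))

    Next : State n → Tree → Tree → Tree
    Next σ stack outs = orᵗ (value selectᵠ (context es σ []) (stack ∙ outs)) (stack ∙ (encodeBits (bits σ) ∙ outs))

    -- Visits k s o s' o': from the stack s and the output o, k iterations lead to s' and o'.
    data Visits : ℕ → Tree → Tree → Tree → Tree → Set where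
      done  : ∀ {s o} → Visits 0 s o s o
      visit : ∀ {k σ s o s₁ o₁ s' o'} → Inv σ → Next σ s o ≡ s₁ ∙ o₁ → Visits k s₁ o₁ s' o' →
              Visits (suc k) (encodeState σ ∙ s) o s' o'

    _then_ : ∀ {j k s o s₁ o₁ s' o'} → Visits j s o s₁ o₁ → Visits k s₁ o₁ s' o' → Visits (j + k) s o s' o'
    done        then q = q
    visit i e p then q = visit i e (p then q)

    emit : List (Vec Bool n) → Tree → Tree
    emit cs = push (map encodeBits cs)

    emit-++ : ∀ cs ds o → emit (cs ++ ds) o ≡ emit cs (emit ds o)
    emit-++ []       ds o = refl
    emit-++ (c ∷ cs) ds o = cong (encodeBits c ∙_) (emit-++ cs ds o)

    Extends′ : (Fin n → Bool) → State n → Set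
    Extends′ χ σ = ∀ v b → Has σ b v → χ v ≡ b

    Proper′ : (Fin n → Bool) → Set
    Proper′ χ = ∀ u v w b → Edge u v w → χ u ≡ b → χ v ≡ b → χ w ≡ b → ⊥

    Fits : ℕ → ℕ → Class → State n → Set
    Fits K x c σ = Within K x (num c) (pred (ones σ)) (pred (zeros σ))

    -- All visited states count in `steps`, but only those that are not bad in `internal`. Weights
    -- control the latter alone, and `steps≤` charges the bad states to their parents.
    record Result (K : ℕ) (σ : State n) (s o : Tree) : Set where
      field
        outputs    : List (Vec Bool n)
        steps    : ℕ
        internal : ℕ
        visits   : Visits steps (encodeState σ ∙ s) o s (emit outputs o)
        steps≤   : steps ≤ 1 + 8 * internal
        sound    : All (λ χ → Extends′ (lookup χ) σ × Proper′ (lookup χ)) outputs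
        exhaustive : ∀ χ → Good (lookup χ) → Balanced (lookup χ) → Extends (lookup χ) σ → χ ∈ outputs
        unique   : Unique outputs
        dead     : Bad σ → internal ≡ 0 × length outputs ≡ 0
        few      : ¬ Bad σ → ∀ c → InClass c σ → Fits 1 (length outputs) c σ × Fits K internal c σ

    record Results (K : ℕ) (σ : State n) (ℓs : List (Leaf (Fin n))) (s o : Tree) : Set where
      field
        outputs    : List (Vec Bool n)
        steps    : ℕ
        internal : ℕ
        visits   : Visits steps (push (map (encodeState ∘ extend σ) ℓs) s) o s (emit outputs o)
        steps≤   : steps ≤ length ℓs + 8 * internal
        sound    : All (λ χ → Any (Agrees (lookup χ)) ℓs × Extends′ (lookup χ) σ × Proper′ (lookup χ)) outputs
        exhaustive : ∀ χ → Good (lookup χ) → Balanced (lookup χ) → Extends (lookup χ) σ → Any (Agrees (lookup χ)) ℓs → χ ∈ outputs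
        unique   : Unique outputs
        few      : ¬ Bad σ → ∀ {t} → Plan σ ℓs t → Within 1 (length outputs) t (pred (ones σ)) (pred (zeros σ))
                                                × Within K internal t (pred (ones σ)) (pred (zeros σ))

    extends-leaf : ∀ {χ σ ℓ} → Agrees χ ℓ → Extends χ σ → Extends χ (extend σ ℓ)
    extends-leaf {χ} {σ} {ℓ} ag ext h with ∈-++⁻ ℓ h
    ... | inj₁ h' = All.lookup ag h'
    ... | inj₂ h' = ext h'

    leaf-within : ∀ {K x c d} σ ℓ → ¬ Bad σ → (Bad (extend σ ℓ) → x ≡ 0) →
      (¬ Bad (extend σ ℓ) → Fits K x c (extend σ ℓ)) → T (fits c d (count true ℓ) (count false ℓ)) →
      Within K x d (pred (ones σ)) (pred (zeros σ))
    leaf-within {K} {x} {c} {d} σ ℓ nb z h fit with decide es (extend σ ℓ) bad []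
    ... | yes b = subst (λ x → Within K x d (pred (ones σ)) (pred (zeros σ))) (sym (z b)) (within-zero {K} {d} {pred (ones σ)} {pred (zeros σ)})
    ... | no ¬b = subst₂ (Within K x d) (sym (refund (ones σ) (2 * count true ℓ) (λ e → ¬b (inj₂ (inj₂ (inj₂ (inj₁ e)))))))
                                        (sym (refund (zeros σ) (2 * count false ℓ) (λ e → ¬b (inj₂ (inj₂ (inj₂ (inj₂ e)))))))
                    (within-extend {K} {x} {d} {pred (ones σ ∸ 2 * count true ℓ)} {pred (zeros σ ∸ 2 * count false ℓ)}
                      c (count true ℓ) (count false ℓ) fit (h ¬b))
      where
      refund : ∀ p k → p ∸ k ≢ 0 → pred p ≡ pred (p ∸ k) + k
      refund zero    k       ne = ⊥-elim (ne (0∸n≡0 k))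
      refund (suc p) zero    ne = sym (+-identityʳ p)
      refund (suc p) (suc k) ne with p ∸ k in eq
      ... | zero  = ⊥-elim (ne refl)
      ... | suc m = trans (sym (m∸n+n≡m {p} {k} (≰⇒≥ λ p≤k → 1+n≢0 (trans (sym eq) (m≤n⇒m∸n≡0 p≤k))))) (trans (cong (_+ k) eq) (sym (+-suc m k)))

    explore-leaves : ∀ K σ ℓs → AllPairs Conflict ℓs → (∀ ℓ → ℓ ∈ ℓs → ∀ s o → Result K (extend σ ℓ) s o) →
      ∀ s o → Results K σ ℓs s o
    explore-leaves K σ [] _ rec s o = record
      { outputs = [] ; steps = 0 ; internal = 0 ; visits = done ; steps≤ = z≤n ; sound = [] ; exhaustive = λ { _ _ _ _ () }
      ; unique = [] ; few = λ { _ [] → within-zero {1} {0} {pred (ones σ)} {pred (zeros σ)} , within-zero {K} {0} {pred (ones σ)} {pred (zeros σ)} } }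
    explore-leaves K σ (ℓ ∷ ℓs) (cf ∷ cfs) rec s o = record
      -- New colorings are put in front of the output, so those of the later leaves come first.
      { outputs    = R₂.outputs ++ R₁.outputs
      ; steps    = R₁.steps + R₂.steps
      ; internal = R₂.internal + R₁.internal
      ; visits   = subst (Visits _ _ _ _) (sym (emit-++ R₂.outputs R₁.outputs o)) (R₁.visits then R₂.visits)
      ; steps≤   = ≤-trans (+-mono-≤ R₁.steps≤ R₂.steps≤) (≤-reflexive (arith (length ℓs) R₁.internal R₂.internal))
      ; sound    = All.++⁺ (All.map (λ (a , h) → there a , h) R₂.sound)
                     (All.map (λ (e , p) → here (All.tabulate (λ h → e _ _ (∈-++⁺ˡ h))) , (λ v b h → e v b (∈-++⁺ʳ ℓ h)) , p) R₁.sound)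
      ; exhaustive = exhaustive′
      ; unique   = Unique.++⁺ R₂.unique R₁.unique λ (h₂ , h₁) →
                     clash (proj₁ (All.lookup R₂.sound h₂)) (λ h → proj₁ (All.lookup R₁.sound h₁) _ _ (∈-++⁺ˡ h))
      ; few      = few′
      }
      where
      R₁ : Result K (extend σ ℓ) _ o
      R₁ = rec ℓ (here refl) _ o
      module R₁ = Result R₁
      R₂ : Results K σ ℓs s (emit R₁.outputs o)
      R₂ = explore-leaves K σ ℓs cfs (λ ℓ' h → rec ℓ' (there h)) s _
      module R₂ = Results R₂
      arith : ∀ l a b → 1 + 8 * a + (l + 8 * b) ≡ suc l + 8 * (b + a)
      arith = solve-∀
      exhaustive′ : ∀ χ → Good (lookup χ) → Balanced (lookup χ) → Extends (lookup χ) σ → Any (Agrees (lookup χ)) (ℓ ∷ ℓs) →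
        χ ∈ R₂.outputs ++ R₁.outputs
      exhaustive′ χ g b e (here a)  = ∈-++⁺ʳ R₂.outputs (R₁.exhaustive χ g b (extends-leaf {lookup χ} {σ} {ℓ} a e))
      exhaustive′ χ g b e (there a) = ∈-++⁺ˡ (R₂.exhaustive χ g b e a)
      opposite≢ : ∀ b → b ≢ opposite b
      opposite≢ true  ()
      opposite≢ false ()
      clash : ∀ {χ} → Any (Agrees χ) ℓs → (∀ {v b} → (v , b) ∈ ℓ → χ v ≡ b) → ⊥
      clash a e = case (find a)
        where
        case : ∃[ ℓ' ] (ℓ' ∈ ℓs × Agrees _ ℓ') → ⊥
        case (ℓ' , h , ag) = let (v , b) , h₁ , h₂ = find (All.lookup cf h) in
          opposite≢ b (trans (sym (e h₁)) (All.lookup ag h₂))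
      few′ : ¬ Bad σ → ∀ {t} → Plan σ (ℓ ∷ ℓs) t →
        Within 1 (length (R₂.outputs ++ R₁.outputs)) t (pred (ones σ)) (pred (zeros σ))
        × Within K (R₂.internal + R₁.internal) t (pred (ones σ)) (pred (zeros σ))
      few′ nb (add {t = t} c d cls {fit} plan) =
          subst (λ x → Within 1 x (t + d) p q) (sym (List.length-++ R₂.outputs))
            (within-+ {1} {length R₂.outputs} {length R₁.outputs} {t} {d} {p} {q} (proj₁ (R₂.few nb plan))
              (leaf-within {1} {length R₁.outputs} {c} {d} σ ℓ nb (λ b → proj₂ (R₁.dead b)) (λ b → proj₁ (R₁.few b c cls)) fit))
        , within-+ {K} {R₂.internal} {R₁.internal} {t} {d} {p} {q} (proj₂ (R₂.few nb plan))
              (leaf-within {K} {R₁.internal} {c} {d} σ ℓ nb (λ b → proj₁ (R₁.dead b)) (λ b → proj₂ (R₁.few b c cls)) fit)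
        where
        p q : ℕ
        p = pred (ones σ)
        q = pred (zeros σ)

    lookup-bits : ∀ σ v → lookup (bits σ) v ≡ does (decide es σ (asg true zero) (v ∷ []))
    lookup-bits σ v = lookup∘tabulate (λ v → does (decide es σ (asg true zero) (v ∷ []))) v

    bits-true : ∀ σ v → Has σ true v → lookup (bits σ) v ≡ true
    bits-true σ v h with decide es σ (asg true zero) (v ∷ []) | lookup-bits σ v
    ... | yes _ | e = e
    ... | no ¬h | _ = ⊥-elim (¬h h)

    bits-false : ∀ σ v → ¬ Has σ true v → lookup (bits σ) v ≡ false
    bits-false σ v nh with decide es σ (asg true zero) (v ∷ []) | lookup-bits σ v
    ... | yes h | _ = ⊥-elim (nh h)
    ... | no _  | e = e

    -- The fuel `f` bounds the number of uncolored vertices, hence the depth below `σ`; each level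
    -- adds 2 to the factor for the number of nodes.
    explore : ∀ f σ → Inv σ → n ≤ f + length (log σ) → ∀ s o → Result (2 * suc f) σ s o
    explore-by : ∀ f σ → Inv σ → n ≤ f + length (log σ) → ∀ s o {t} →
      value selectᵠ (context es σ []) (s ∙ o) ≡ t → Choice.Chosen es σ s o t → Result (2 * suc f) σ s o
    explore-children : ∀ f σ → Inv σ → suc n ≤ f + length (log σ) → ∀ s o → Result (2 * f) σ s o

    explore-children zero    σ inv le s o = ⊥-elim (<⇒≱ le (distinct-bound (log σ) (Inv.distinct inv)))
    explore-children (suc f) σ inv le s o = explore f σ inv (≤-pred le) s o

    explore f σ inv le s o = explore-by f σ inv le s o refl (Choice.select-correct es σ s o)

    explore-by f σ inv le s o eq (Choice.discard b) = record
      { outputs = [] ; steps = 1 ; internal = 0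
      ; visits = visit inv (cong (λ t → orᵗ t (s ∙ (encodeBits (bits σ) ∙ o))) eq) done
      ; steps≤ = ≤-refl ; sound = []
      ; exhaustive = λ χ g bal ext → ⊥-elim (not-spent {σ = σ} g bal inv ext b)
      ; unique = [] ; dead = λ _ → refl , refl ; few = λ nb → ⊥-elim (nb b) }
    explore-by f σ inv le s o eq (Choice.finished nb nf) = record
      { outputs = bits σ ∷ [] ; steps = 1 ; internal = 1
      ; visits = visit inv (cong (λ t → orᵗ t (s ∙ (encodeBits (bits σ) ∙ o))) eq) done
      ; steps≤ = s≤s z≤n
      ; sound = (agrees , proper′) ∷ []
      ; exhaustive = λ χ g bal ext → here (lookup-ext χ (bits σ) λ v → same′ χ ext v)
      ; unique = [] ∷ []
      ; dead = λ b → ⊥-elim (nb b)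
      ; few = λ _ c k → only-any c k , within-mono {2} {2 * suc f} {1} {num c} {num c} {pred (ones σ)} {pred (zeros σ)}
                (*-monoʳ-≤ 2 (s≤s (z≤n {f}))) ≤-refl (within-one c (pred (ones σ)) (pred (zeros σ))) }
      where
      lookup-ext : ∀ {m} (xs ys : Vec Bool m) → (∀ i → lookup xs i ≡ lookup ys i) → xs ≡ ys
      lookup-ext []       []       h = refl
      lookup-ext (x ∷ xs) (y ∷ ys) h = cong₂ _∷_ (h zero) (lookup-ext xs ys (h ∘ suc))
      has-false : ∀ v → ¬ Has σ true v → Has σ false v
      has-false v nt with decide es σ (asg false zero) (v ∷ [])
      ... | yes h = h
      ... | no nh = ⊥-elim (nf v (nt , nh))
      agrees : ∀ v b → Has σ b v → lookup (bits σ) v ≡ b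
      agrees v true  h = bits-true σ v h
      agrees v false h = bits-false σ v (λ t → nb (inj₁ (v , t , h)))
      has : ∀ v b → lookup (bits σ) v ≡ b → Has σ b v
      has v b e with decide es σ (asg true zero) (v ∷ [])
      has v true  e | yes h = h
      has v false e | yes h = ⊥-elim (true≢false (bits-true σ v h) e)
      has v true  e | no nh = ⊥-elim (true≢false e (bits-false σ v nh))
      has v false e | no nh = has-false v nh
      proper′ : Proper′ (lookup (bits σ))
      proper′ _ _ _ false e hu hv hw = nb (inj₂ (inj₁ (_ , _ , _ , e , has _ _ hu , has _ _ hv , has _ _ hw)))
      proper′ _ _ _ true  e hu hv hw = nb (inj₂ (inj₂ (inj₁ (_ , _ , _ , e , has _ _ hu , has _ _ hv , has _ _ hw))))
      same′ : ∀ χ → Extends (lookup χ) σ → ∀ v → lookup χ v ≡ lookup (bits σ) v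
      same′ χ ext v = ext (has v _ refl)
      -- Every other class exhibits a free vertex or a bad state, and a finished state has neither;
      -- so its one coloring is measured against weight 1 only.
      only-any : ∀ c → InClass c σ → Fits 1 1 c σ
      only-any any       _ = within-any (pred (ones σ)) (pred (zeros σ))
      only-any one-unit  (inj₁ b)                       = ⊥-elim (nb b)
      only-any one-unit  (inj₂ (u , f , _))             = ⊥-elim (nf u f)
      only-any one-two   (inj₁ (inj₁ b))                = ⊥-elim (nb b)
      only-any one-two   (inj₁ (inj₂ (u , f , _)))      = ⊥-elim (nf u f)
      only-any one-two   (inj₂ (u , _ , f , _))         = ⊥-elim (nf u f)
      only-any two-two   (u , _ , _ , _ , (f , _) , _)  = ⊥-elim (nf u f)
      only-any three-two (inj₁ (u , _ , _ , _ , (f , _) , _))         = ⊥-elim (nf u f)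
      only-any three-two (inj₂ (u , _ , _ , _ , _ , _ , (f , _) , _)) = ⊥-elim (nf u f)
    explore-by f σ inv le s o eq (Choice.branch {ℓs} br) = record
      { outputs = R.outputs ; steps = suc R.steps ; internal = suc R.internal
      ; visits = visit inv (cong (λ t → orᵗ t (s ∙ (encodeBits (bits σ) ∙ o))) eq) R.visits
      ; steps≤ = s≤s (≤-trans R.steps≤ (≤-trans (+-monoˡ-≤ (8 * R.internal) (≤-trans B.few (n≤1+n 7)))
                   (≤-reflexive (sym (*-distribˡ-+ 8 1 R.internal)))))
      ; sound = All.map proj₂ R.sound
      ; exhaustive = λ χ g bal ext → R.exhaustive χ g bal ext (B.covers g ext)
      ; unique = R.unique
      ; dead = λ b → ⊥-elim (B.not-bad b)
      ; few = λ nb c k → let t , plan , le′ = B.bounded c k in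
          within-mono {1} {1} {length R.outputs} {t} {num c} {pred (ones σ)} {pred (zeros σ)} ≤-refl le′ (proj₁ (R.few nb plan))
        , subst (λ K → Within K (suc R.internal) (num c) (pred (ones σ)) (pred (zeros σ))) (sym (*-distribˡ-+ 2 1 f))
          (within-suc {2 * f} {R.internal} c {pred (ones σ)} {pred (zeros σ)}
          (within-mono {2 * f} {2 * f} {R.internal} {t} {num c} {pred (ones σ)} {pred (zeros σ)} ≤-refl le′ (proj₂ (R.few nb plan))))
      }
      where
      module B = Choice.Branches br
      R : Results (2 * f) σ ℓs s o
      R = explore-leaves (2 * f) σ ℓs B.conflicts (λ ℓ h s o → explore-children f (extend σ ℓ)
          (inv-extend σ inv (All.lookup B.distinct h) (All.lookup B.unset h)) (longer ℓ (All.lookup B.nonempty h)) s o) s o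
        where
        longer : ∀ ℓ → 1 ≤ length ℓ → suc n ≤ f + length (ℓ ++ log σ)
        longer ℓ le₁ = ≤-trans (s≤s le) (≤-trans (≤-reflexive (sym (+-suc f _)))
          (+-monoʳ-≤ f (≤-trans (+-monoˡ-≤ (length (log σ)) le₁) (≤-reflexive (sym (List.length-++ ℓ))))))
      module R = Results R

-- The program and its running time

module Code where

  open Machine
  open Formula
  open Branching
  open Select
  open Search
  open import Data.Fin using (Fin; zero; suc; toℕ; fromℕ<)
  import Data.Fin.Properties as Fin
  open import Data.List using () renaming (drop to dropˡ)
  open import Data.Nat
  open import Data.Nat.Properties
  open import Data.Vec using (toList)
  open import Relation.Nullary using (does)

  -- Correctness of a query only says that a positive answer is a pair. The double negation
  -- normalizes it to `nil ∙ nil`, so that it is literally an encoded bit.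
  bitᶠ : Fm 1
  bitᶠ = not (not (asg true zero))

  opaque
    collectᵠ : Query
    collectᵠ = query bitᶠ

  -- From a complete state, collect appends its coloring to the output; meanwhile the machine
  -- holds ((suffix of n ∙ nil) ∙ glob) ∙ (bits collected ∙ (stack ∙ output)).
  collect-body : Cmd 1
  collect-body = compile collectᵠ
    ⨾ (zero := cons (cons (cons (tl (hd (hd (hd (tl X))))) `nil) (tl (hd (tl X)))) (cons (cons (hd X) (hd (tl (tl X)))) (tl (tl (tl X)))))

  collect : Cmd 1
  collect =
      (zero := cons (cons (cons (hd (tl (hd (tl X)))) `nil) (tl (hd (tl X)))) (cons `nil (tl (tl X))))
    ⨾ (while hd (hd (hd X)) loop collect-body)
    ⨾ (zero := cons (cons (hd (tl (tl X))) (cons (hd (tl X)) (tl (tl (tl X))))) (cons (hd (tl (hd X))) (hd (tl (tl (hd X))))))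

  -- Between iterations the machine holds (stack ∙ output) ∙ (n ∙ edges).
  body : Cmd 1
  body =
      (zero := cons (cons `nil (cons (hd (tl X)) (cons (tl (tl X)) (hd (hd (hd X)))))) (cons (tl (hd (hd X))) (tl (hd X))))
    ⨾ compile selectᵠ
    ⨾ (if hd X
       then (zero := cons (hd X) (cons (hd (tl (hd (tl X)))) (hd (tl (tl (hd (tl X)))))))
       else collect)

  code : Cmd 1
  code =
      -- The initial stack holds the root alone: an empty log and both budgets n + 1.
      (zero := cons (cons (cons (cons `nil (cons (cons `nil (hd X)) (cons `nil (hd X)))) `nil) `nil) X)
    ⨾ (while hd (hd X) loop body)
    ⨾ (zero := tl (hd X))

  program : Program
  program = record { extra = 0 ; code = code }

  body-cost : ℕ → ℕ → ℕ
  body-cost n s = 14 + cost selectᵠ s + n * (4 + cost collectᵠ s)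

  root : ∀ n → State n
  root n = state [] (suc n) (suc n)

  module _ {n} (es : List (Vec Bool n)) where

    open Local es
    open Explore es

    bit-value : ∀ σ b v → value collectᵠ (context es σ (v ∷ [])) b ≡ encodeBool (lookup (bits σ) v)
    bit-value σ b v = trans (lem (query-correct es σ b (asg true zero) (v ∷ [])) (decide es σ (asg true zero) (v ∷ [])))
                            (cong encodeBool (sym (lookup-bits σ v)))
      where
      opaque
        unfolding collectᵠ
        lem : ∀ {A : Set} → Decides (value (query {1} (asg true zero)) (context es σ (v ∷ [])) b) A → (d : Dec A) →
          value collectᵠ (context es σ (v ∷ [])) b ≡ encodeBool (does d)
        lem p d = aux p d
          where
          aux : ∀ {t} {A : Set} → Decides t A → (d : Dec A) →
            (ifᵗ (ifᵗ t then nil else (nil ∙ nil)) then nil else (nil ∙ nil)) ≡ encodeBool (does d)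
          aux (none refl _)       (no _)  = refl
          aux (none refl ¬a)      (yes a) = ⊥-elim (¬a a)
          aux (found _ _ cons)    (yes _) = refl
          aux (found a _ cons)    (no ¬a) = ⊥-elim (¬a a)

    drop-lookup : ∀ {m} (xs : Vec Bool m) (v : Fin m) → dropˡ (toℕ v) (toList xs) ≡ lookup xs v ∷ dropˡ (suc (toℕ v)) (toList xs)
    drop-lookup (x ∷ xs) zero    = refl
    drop-lookup (x ∷ xs) (suc v) = drop-lookup xs v

    drop-all : ∀ {m} (xs : Vec Bool m) → dropˡ m (toList xs) ≡ []
    drop-all []       = refl
    drop-all (x ∷ xs) = drop-all xs

    module _ (σ : State n) (stack outs : Tree) (s : ℕ) (fits : ∀ (v : Fin n) → size (context es σ (v ∷ [])) ≤ s)
             (fits₀ : size (context es σ []) ≤ s) where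

      private
        glob : Tree
        glob = encodeℕ n ∙ (encodeList encodeBits es ∙ encodeState σ)
        suffix : ℕ → Tree
        suffix m = encodeList encodeBool (dropˡ m (toList (bits σ)))
        big : Tree
        big = stack ∙ outs

      -- The unary counter, read as a vertex, is the last one not yet collected; prepending its
      -- color builds the vector from its end.
      collect-loop : ∀ m → m ≤ n → (while hd (hd (hd X)) loop collect-body)
        ⊢ ((encodeℕ m ∙ nil) ∙ glob) ∙ (suffix m ∙ big) ⇒ ((nil ∙ nil) ∙ glob) ∙ (encodeBits (bits σ) ∙ big)
        within suc (m * (4 + cost collectᵠ s))
      collect-loop zero    le = while-nil refl
      collect-loop (suc m) le = weaken bound
        (while-cons refl
          (subst (λ k → collect-body ⊢ ((encodeℕ (suc k) ∙ nil) ∙ glob) ∙ (suffix (suc k) ∙ big)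
               ⇒ ((encodeℕ k ∙ nil) ∙ glob) ∙ (suffix k ∙ big) within (2 + cost collectᵠ s)) (Fin.toℕ-fromℕ< le)
            (weaken (≤-reflexive (cong suc (+-comm _ 1)))
            (seq (compile-correct collectᵠ (vertex v ∙ nil) glob (suffix (suc (toℕ v)) ∙ big) s (fits v))
                 (assign (cong (λ t → ((encodeℕ (toℕ v) ∙ nil) ∙ glob) ∙ (t ∙ big))
                   (trans (cong (_∙ suffix (suc (toℕ v))) (bit-value σ (suffix (suc (toℕ v)) ∙ big) v))
                          (sym (cong (encodeList encodeBool) (drop-lookup (bits σ) v)))))))))
          (collect-loop m (<⇒≤ le)))
        where
        v : Fin n
        v = fromℕ< le
        c : ℕ
        c = cost collectᵠ s
        bound : suc (2 + c + suc (m * (4 + c))) ≤ suc (suc m * (4 + c))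
        bound = s≤s (≤-trans (≤-reflexive (+-suc (2 + c) (m * (4 + c)))) (n≤1+n _))

      body-correct : ∀ {s₁ o₁} → Next σ stack outs ≡ s₁ ∙ o₁ →
        body ⊢ ((encodeState σ ∙ stack) ∙ outs) ∙ (encodeℕ n ∙ encodeList encodeBits es)
          ⇒ (s₁ ∙ o₁) ∙ (encodeℕ n ∙ encodeList encodeBits es) within body-cost n s
      body-correct {s₁} {o₁} eq = by refl eq
        where
        E : Tree
        E = encodeList encodeBits es
        c d : ℕ
        c = cost selectᵠ s
        d = cost collectᵠ s
        first-part : ∀ {t} → value selectᵠ (context es σ []) big ≡ t →
          compile selectᵠ ⊢ context es σ [] ∙ big ⇒ t ∙ (context es σ [] ∙ big) within c
        first-part refl = compile-correct selectᵠ nil glob big s fits₀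
        by : ∀ {t} → value selectᵠ (context es σ []) big ≡ t → orᵗ t (stack ∙ (encodeBits (bits σ) ∙ outs)) ≡ s₁ ∙ o₁ →
          body ⊢ ((encodeState σ ∙ stack) ∙ outs) ∙ (encodeℕ n ∙ E) ⇒ (s₁ ∙ o₁) ∙ (encodeℕ n ∙ E) within body-cost n s
        by {x ∙ y} e refl = weaken bound (seq (assign refl) (seq (first-part e) (if-cons refl (assign refl))))
          where
          bound : suc (1 + suc (c + 2)) ≤ body-cost n s
          bound = ≤-trans (s≤s (s≤s (s≤s (≤-reflexive (+-comm c 2))))) (≤-trans (+-monoˡ-≤ c {5} {14} (≤ᵇ⇒≤ 5 14 _)) (m≤m+n (14 + c) _))
        by {nil} e refl = weaken bound (seq (assign refl) (seq (first-part e) (if-nil refl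
            (seq (assign (cong (λ l → ((encodeℕ n ∙ nil) ∙ glob) ∙ (l ∙ big)) (sym (cong (encodeList encodeBool) (drop-all (bits σ))))))
              (seq (collect-loop n ≤-refl) (assign refl))))))
          where
          k : ℕ
          k = n * (4 + d)
          bound : suc (1 + suc (c + suc (suc (1 + suc (suc k + 1))))) ≤ 14 + c + k
          bound = begin
            3 + (c + suc (suc (1 + suc (suc k + 1))))  ≡⟨ cong (λ z → 3 + (c + (5 + z))) (+-comm k 1) ⟩
            3 + (c + (6 + k))                          ≡⟨ cong (3 +_) (trans (sym (+-assoc c 6 k)) (cong (_+ k) (+-comm c 6))) ⟩
            9 + c + k                                  ≤⟨ +-monoˡ-≤ k (+-monoˡ-≤ c {9} {14} (≤ᵇ⇒≤ 9 14 _)) ⟩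
            14 + c + k ∎
            where open ≤-Reasoning

    module _ (s : ℕ) (fits : ∀ σ → Inv σ → ∀ (v : Fin n) → size (context es σ (v ∷ [])) ≤ s)
             (fits₀ : ∀ σ → Inv σ → size (context es σ []) ≤ s) where

      visits-run : ∀ {k st o o'} → Visits k st o nil o' → (while hd (hd X) loop body)
        ⊢ (st ∙ o) ∙ (encodeℕ n ∙ encodeList encodeBits es) ⇒ (nil ∙ o') ∙ (encodeℕ n ∙ encodeList encodeBits es)
        within suc (k * suc (body-cost n s))
      visits-run done = while-nil refl
      visits-run (visit {k} {σ} {st} {o} inv eq vs) = weaken (≤-reflexive (arith k (body-cost n s)))
        (while-cons refl (body-correct σ st o s (fits σ inv) (fits₀ σ inv) eq) (visits-run vs))
        where
        arith : ∀ (k b : ℕ) → suc (b + suc (k * suc b)) ≡ suc (suc k * suc b)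
        arith k b = cong ℕ.suc (+-suc b (k * suc b))

      code-run : ∀ {k o} → Visits k (encodeState (root n) ∙ nil) nil nil o →
        code ⊢ encodeℕ n ∙ encodeList encodeBits es ⇒ o within 5 + k * suc (body-cost n s)
      code-run {k} vs = weaken (≤-reflexive (cong (3 +_) (trans (+-comm _ 1) refl)))
        (seq (assign refl) (seq (visits-run vs) (assign refl)))

-- Polynomially bounded functions

module Polynomial where

  open Machine
  open import Data.Nat
  open import Data.Nat.Properties
  open import Data.Nat.Tactic.RingSolver using (solve-∀)

  -- With base `suc n` the powers grow with the exponent even at `n = 0`, so the exponents of two
  -- bounds can simply be added.
  Poly : (ℕ → ℕ) → Set
  Poly f = ∃[ c ] ∃[ d ] ∀ n → f n ≤ c * suc n ^ d

  poly-const : ∀ k → Poly (λ _ → k)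
  poly-const k = k , 0 , λ n → ≤-reflexive (sym (*-identityʳ k))

  poly-power : ∀ d → Poly (λ n → suc n ^ d)
  poly-power d = 1 , d , λ n → ≤-reflexive (sym (*-identityˡ (suc n ^ d)))

  poly-id : Poly (λ n → n)
  poly-id = 1 , 1 , λ n → ≤-trans (n≤1+n n) (≤-reflexive (sym (trans (*-identityˡ (suc n ^ 1)) (^-identityʳ (suc n)))))

  poly-+ : ∀ {f g} → Poly f → Poly g → Poly (λ n → f n + g n)
  poly-+ {f} {g} (c , d , h) (c' , d' , h') = c + c' , d + d' , λ n → begin
    f n + g n                                       ≤⟨ +-mono-≤ (h n) (h' n) ⟩
    c * suc n ^ d + c' * suc n ^ d'                 ≤⟨ +-mono-≤ (*-monoʳ-≤ c (^-monoʳ-≤ (suc n) (m≤m+n d d')))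
                                                                (*-monoʳ-≤ c' (^-monoʳ-≤ (suc n) (m≤n+m d' d))) ⟩
    c * suc n ^ (d + d') + c' * suc n ^ (d + d')    ≡⟨ sym (*-distribʳ-+ (suc n ^ (d + d')) c c') ⟩
    (c + c') * suc n ^ (d + d') ∎
    where open ≤-Reasoning

  poly-* : ∀ {f g} → Poly f → Poly g → Poly (λ n → f n * g n)
  poly-* {f} {g} (c , d , h) (c' , d' , h') = c * c' , d + d' , λ n → begin
    f n * g n                               ≤⟨ *-mono-≤ (h n) (h' n) ⟩
    c * suc n ^ d * (c' * suc n ^ d')       ≡⟨ rearrange c (suc n ^ d) c' (suc n ^ d') ⟩
    c * c' * (suc n ^ d * suc n ^ d')       ≡⟨ cong (c * c' *_) (sym (^-distribˡ-+-* (suc n) d d')) ⟩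
    c * c' * suc n ^ (d + d') ∎
    where
    open ≤-Reasoning
    rearrange : ∀ a b c d → a * b * (c * d) ≡ a * c * (b * d)
    rearrange = solve-∀

  poly-cost : ∀ q {f} → Poly f → Poly (λ n → cost q (f n))
  poly-cost (out e)      p = poly-const 1
  poly-cost (drop _ _ _) p = poly-+ (poly-const 5) (poly-* (poly-const 2) p)
  poly-cost (q & r)      p = poly-+ (poly-+ (poly-const 5) (poly-cost q p)) (poly-cost r p)
  poly-cost (q ∥ r)      p = poly-+ (poly-+ (poly-const 5) (poly-cost q p)) (poly-cost r p)
  poly-cost (neg q)      p = poly-+ (poly-const 3) (poly-cost q p)
  poly-cost (first _ q)  p = poly-+ (poly-const 5) (poly-* p (poly-+ (poly-const 6) (poly-cost q (poly-+ (poly-+ (poly-const 1) p) p))))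

-- Proper colorings as balanced colorings with private edges

module Hyper where

  open Formula
  open Branching
  open Select
  open Search
  open import Data.Empty using () renaming (⊥ to Empty)
  open import Data.Fin using (Fin; zero; suc; _≟_)
  import Data.Fin.Properties as Fin
  open import Data.Fin.Subset using (_∩_; ∁; ∣_∣; Nonempty) renaming (_∈_ to _∈ˢ_; _-_ to _-ˢ_)
  open import Data.Fin.Subset.Properties using (x∈p∩q⁺; x∈p∩q⁻; x∉p⇒x∈∁p; ∣∁p∣≡n∸∣p∣; ∣p∣≤n; nonempty?; x∈p⇒∣p-x∣<∣p∣; x∈p∧x≢y⇒x∈p-y)
  open import Data.List using () renaming (lookup to lookupˡ)
  import Data.List.Properties as List
  open import Data.List.Membership.Propositional using (find; lose)
  open import Data.List.Membership.Propositional.Properties using (∈-map⁺; ∈-map⁻; ∈-lookup)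
  open import Data.List.Relation.Unary.All as All using (All; []; _∷_)
  import Data.List.Relation.Unary.All.Properties as All
  open import Data.List.Relation.Unary.AllPairs as AllPairs using ([]; _∷_)
  open import Data.List.Relation.Unary.Any as Any using (Any; here; there; index)
  import Data.List.Relation.Unary.Any.Properties as Any
  open import Data.List.Relation.Unary.Unique.Propositional using (Unique)
  import Data.List.Relation.Unary.Unique.Propositional.Properties as Unique
  open import Data.Nat using (zero; suc; _+_; _*_; _^_; _≤_; z≤n; s≤s)
  open import Data.Nat.Properties hiding (_≟_)
  open import Data.Vec.Properties using ([]=⇒lookup; lookup⇒[]=)

  unique-⊆⇒length≤ : ∀ {A : Set} {xs ys : List A} → Unique xs → (∀ {x} → x ∈ xs → x ∈ ys) → length xs ≤ length ys
  unique-⊆⇒length≤ {xs = xs} {ys} u sub = Fin.injective⇒≤ {f = λ i → index (sub (∈-lookup {xs = xs} i))} λ {i} {j} eq →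
    injective u i j (trans (Any.lookup-index (sub (∈-lookup i))) (trans (cong (lookupˡ ys) eq) (sym (Any.lookup-index (sub (∈-lookup j))))))
    where
    injective : ∀ {xs} → Unique xs → ∀ i j → lookupˡ xs i ≡ lookupˡ xs j → i ≡ j
    injective (_ ∷ _) zero    zero    _ = refl
    injective (h ∷ _) zero    (suc j) e = ⊥-elim (All.lookup h (∈-lookup j) e)
    injective (h ∷ _) (suc i) zero    e = ⊥-elim (All.lookup h (∈-lookup i) (sym e))
    injective (_ ∷ u) (suc i) (suc j) e = cong suc (injective u i j e)

  members : ∀ {n} → Vec Bool n → List (Fin n)
  members []          = []
  members (true  ∷ p) = zero ∷ map suc (members p)
  members (false ∷ p) = map suc (members p)

  length-members : ∀ {n} (p : Vec Bool n) → length (members p) ≡ ∣ p ∣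
  length-members []          = refl
  length-members (true  ∷ p) = cong suc (trans (List.length-map suc (members p)) (length-members p))
  length-members (false ∷ p) = trans (List.length-map suc (members p)) (length-members p)

  ∈-members⁺ : ∀ {n} (p : Vec Bool n) {v} → lookup p v ≡ true → v ∈ members p
  ∈-members⁺ (true  ∷ p) {zero}  e = here refl
  ∈-members⁺ (true  ∷ p) {suc v} e = there (∈-map⁺ suc (∈-members⁺ p e))
  ∈-members⁺ (false ∷ p) {suc v} e = ∈-map⁺ suc (∈-members⁺ p e)

  ∈-members⁻ : ∀ {n} (p : Vec Bool n) {v} → v ∈ members p → lookup p v ≡ true
  ∈-members⁻ (true  ∷ p) (here refl) = refl
  ∈-members⁻ (true  ∷ p) (there h) with ∈-map⁻ suc h
  ... | _ , h' , refl = ∈-members⁻ p h'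
  ∈-members⁻ (false ∷ p) h with ∈-map⁻ suc h
  ... | _ , h' , refl = ∈-members⁻ p h'

  members-unique : ∀ {n} (p : Vec Bool n) → Unique (members p)
  members-unique []          = []
  members-unique (true  ∷ p) = All.tabulate (λ h e → zero∉ (subst (_∈ map suc (members p)) (sym e) h)) ∷ Unique.map⁺ Fin.suc-injective (members-unique p)
    where
    zero∉ : ∀ {xs : List (Fin _)} → zero ∈ map suc xs → Empty
    zero∉ h with ∈-map⁻ suc h
    ... | _ , _ , ()
  members-unique (false ∷ p) = Unique.map⁺ Fin.suc-injective (members-unique p)

  tails : ∀ {n} → Bool → List (Vec Bool (suc n)) → List (Vec Bool n)
  tails b     []                 = []
  tails true  ((true  ∷ x) ∷ xs) = x ∷ tails true xs
  tails true  ((false ∷ x) ∷ xs) = tails true xs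
  tails false ((true  ∷ x) ∷ xs) = tails false xs
  tails false ((false ∷ x) ∷ xs) = x ∷ tails false xs

  length-tails : ∀ {n} (xs : List (Vec Bool (suc n))) → length xs ≡ length (tails true xs) + length (tails false xs)
  length-tails []                 = refl
  length-tails ((true  ∷ x) ∷ xs) = cong suc (length-tails xs)
  length-tails ((false ∷ x) ∷ xs) = trans (cong suc (length-tails xs)) (sym (+-suc _ _))

  all-tails : ∀ {n} {P : Vec Bool (suc n) → Set} b {xs} → All P xs → All (λ x → P (b ∷ x)) (tails b xs)
  all-tails b     []                        = []
  all-tails true  (_∷_ {x = true  ∷ _} p ps) = p ∷ all-tails true ps
  all-tails true  (_∷_ {x = false ∷ _} p ps) = all-tails true ps
  all-tails false (_∷_ {x = true  ∷ _} p ps) = all-tails false ps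
  all-tails false (_∷_ {x = false ∷ _} p ps) = p ∷ all-tails false ps

  unique-tails : ∀ {n} b {xs : List (Vec Bool (suc n))} → Unique xs → Unique (tails b xs)
  unique-tails b     []                          = []
  unique-tails true  (_∷_ {x = true  ∷ _} h u) = All.map (λ ne e → ne (cong (true ∷_) e)) (all-tails true h) ∷ unique-tails true u
  unique-tails true  (_∷_ {x = false ∷ _} h u) = unique-tails true u
  unique-tails false (_∷_ {x = true  ∷ _} h u) = unique-tails false u
  unique-tails false (_∷_ {x = false ∷ _} h u) = All.map (λ ne e → ne (cong (false ∷_) e)) (all-tails false h) ∷ unique-tails false u

  -- Pascal's recursion, splitting the sets by whether they contain the first vertex. It keeps the
  -- encoded edge list, and with it the cost of a query, polynomial in the number of vertices.
  uniform-bound : ∀ n k (xs : List (Vec Bool n)) → Unique xs → All (λ e → ∣ e ∣ ≡ k) xs → length xs ≤ suc n ^ k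
  uniform-bound zero k []            u          h       = z≤n
  uniform-bound zero k (_ ∷ [])      u          h       = m^n>0 1 k
  uniform-bound zero k ([] ∷ [] ∷ _) ((ne ∷ _) ∷ _) h   = ⊥-elim (ne refl)
  uniform-bound (suc n) zero xs u h with tails true xs | all-tails true h | length-tails xs
  ... | []    | _        | eq = ≤-trans (≤-reflexive eq) (uniform-bound n zero (tails false xs) (unique-tails false u) (all-tails false h))
  ... | _ ∷ _ | () ∷ _   | _
  uniform-bound (suc n) (suc k) xs u h = begin
    length xs                                             ≡⟨ length-tails xs ⟩
    length (tails true xs) + length (tails false xs)      ≤⟨ +-mono-≤
        (uniform-bound n k (tails true xs) (unique-tails true u) (All.map suc-injective (all-tails true h)))
        (uniform-bound n (suc k) (tails false xs) (unique-tails false u) (all-tails false h)) ⟩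
    suc n ^ k + suc n * suc n ^ k                         ≤⟨ *-monoʳ-≤ (suc (suc n)) (^-monoˡ-≤ k (n≤1+n (suc n))) ⟩
    suc (suc n) * suc (suc n) ^ k ∎
    where open ≤-Reasoning

  module Minimal {n} (H : Hypergraph n) (uniform : Uniform 3 H) (no-small : NoSmallTransversal H) where

    es : List (Vec Bool n)
    es = edges H

    open Local es
    open Explore es

    three : ∀ (e : Vec Bool n) {u v w i} → ∣ e ∣ ≡ 3 → lookup e u ≡ true → lookup e v ≡ true → lookup e w ≡ true →
      u ≢ v → v ≢ w → u ≢ w → lookup e i ≡ true → i ≡ u ⊎ i ≡ v ⊎ i ≡ w
    three e {u} {v} {w} {i} card hu hv hw uv vw uw hi with i ≟ u | i ≟ v | i ≟ w
    ... | yes p | _     | _     = inj₁ p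
    ... | no _  | yes p | _     = inj₂ (inj₁ p)
    ... | no _  | no _  | yes p = inj₂ (inj₂ p)
    ... | no iu | no iv | no iw = ⊥-elim (<⇒≱ (s≤s (s≤s (s≤s (s≤s z≤n))))
        (≤-trans (unique-⊆⇒length≤ {xs = i ∷ u ∷ v ∷ w ∷ []} ((iu ∷ iv ∷ iw ∷ []) ∷ (uv ∷ uw ∷ []) ∷ (vw ∷ []) ∷ [] ∷ []) sub)
                 (≤-reflexive (trans (length-members e) card))))
      where
      sub : ∀ {x} → x ∈ i ∷ u ∷ v ∷ w ∷ [] → x ∈ members e
      sub (here refl)                         = ∈-members⁺ e hi
      sub (there (here refl))                 = ∈-members⁺ e hu
      sub (there (there (here refl)))         = ∈-members⁺ e hv
      sub (there (there (there (here refl)))) = ∈-members⁺ e hw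

    vertices : ∀ (e : Vec Bool n) → ∣ e ∣ ≡ 3 → ∃[ u ] ∃[ v ] ∃[ w ] (u ≢ v × v ≢ w × u ≢ w
      × lookup e u ≡ true × lookup e v ≡ true × lookup e w ≡ true)
    vertices e card with members e | length-members e | members-unique e | (λ {v} → ∈-members⁻ e {v})
    ... | u ∷ v ∷ w ∷ [] | _ | (uv ∷ uw ∷ []) ∷ (vw ∷ []) ∷ _ | h =
      u , v , w , uv , vw , uw , h (here refl) , h (there (here refl)) , h (there (there (here refl)))
    ... | []                | eq | _ | _ = ⊥-elim (0≢1+n (trans eq card))
    ... | _ ∷ []            | eq | _ | _ = ⊥-elim (0≢1+n (suc-injective (trans eq card)))
    ... | _ ∷ _ ∷ []        | eq | _ | _ = ⊥-elim (0≢1+n (suc-injective (suc-injective (trans eq card))))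
    ... | _ ∷ _ ∷ _ ∷ _ ∷ _ | eq | _ | _ = ⊥-elim (1+n≢0 (suc-injective (suc-injective (suc-injective (trans eq card)))))

    proper⇒ : ∀ {χ : Vec Bool n} → Proper H χ → Proper′ (lookup χ)
    proper⇒ {χ} prop u v w b (uv , vw , uw , common) hu hv hw = let e , e∈ , (eu , ev , ew) = find common in
      All.lookup prop e∈ (b , λ i i∈ → colour (three e (All.lookup uniform e∈) eu ev ew uv vw uw ([]=⇒lookup i∈)))
      where
      colour : ∀ {i} → i ≡ u ⊎ i ≡ v ⊎ i ≡ w → lookup χ i ≡ b
      colour (inj₁ refl)        = hu
      colour (inj₂ (inj₁ refl)) = hv
      colour (inj₂ (inj₂ refl)) = hw

    proper⇐ : ∀ {χ : Vec Bool n} → Proper′ (lookup χ) → Proper H χ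
    proper⇐ {χ} prop = All.tabulate λ {e} e∈ (b , h) →
      let u , v , w , uv , vw , uw , hu , hv , hw = vertices e (All.lookup uniform e∈) in
      prop u v w b (uv , vw , uw , lose e∈ (hu , hv , hw))
        (h u (lookup⇒[]= u e hu)) (h v (lookup⇒[]= v e hv)) (h w (lookup⇒[]= w e hw))

    large : ∀ (T : Vec Bool n) → Transversal H T → n ≤ 2 * ∣ T ∣
    large T t = ≮⇒≥ λ lt → no-small (T , t , lt)

    module _ {χ : Vec Bool n} (prop : Proper H χ) where

      ones-transversal : Transversal H χ
      ones-transversal = All.map (λ {e} ¬mono → hit e ¬mono) prop
        where
        hit : ∀ e → ¬ Monochromatic χ e → Nonempty (χ ∩ e)
        hit e ¬mono with nonempty? (χ ∩ e)
        ... | yes h = h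
        ... | no ¬h = ⊥-elim (¬mono (false , λ i i∈ → is-false i i∈ (dichotomy (lookup χ i))))
          where
          is-false : ∀ i → i ∈ˢ e → lookup χ i ≡ true ⊎ lookup χ i ≡ false → lookup χ i ≡ false
          is-false i i∈ (inj₁ t) = ⊥-elim (¬h (i , x∈p∩q⁺ (lookup⇒[]= i χ t , i∈)))
          is-false i i∈ (inj₂ f) = f

      zeros-transversal : Transversal H (∁ χ)
      zeros-transversal = All.map (λ {e} ¬mono → hit e ¬mono) prop
        where
        hit : ∀ e → ¬ Monochromatic χ e → Nonempty (∁ χ ∩ e)
        hit e ¬mono with nonempty? (∁ χ ∩ e)
        ... | yes h = h
        ... | no ¬h = ⊥-elim (¬mono (true , λ i i∈ → is-true i i∈ (dichotomy (lookup χ i))))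
          where
          is-true : ∀ i → i ∈ˢ e → lookup χ i ≡ true ⊎ lookup χ i ≡ false → lookup χ i ≡ true
          is-true i i∈ (inj₁ t) = t
          is-true i i∈ (inj₂ f) = ⊥-elim (¬h (i , x∈p∩q⁺ (x∉p⇒x∈∁p (λ h → true≢false ([]=⇒lookup h) f) , i∈)))

      cards : ∣ χ ∣ + ∣ ∁ χ ∣ ≡ n
      cards = trans (cong (∣ χ ∣ +_) (∣∁p∣≡n∸∣p∣ χ)) (m+[n∸m]≡n (∣p∣≤n χ))

      half : ∀ a b → a + b ≡ n → n ≤ 2 * b → 2 * a ≤ n
      half a b sum le = +-cancelʳ-≤ n (2 * a) n (begin
        2 * a + n       ≤⟨ +-monoʳ-≤ (2 * a) le ⟩
        2 * a + 2 * b   ≡⟨ sym (*-distribˡ-+ 2 a b) ⟩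
        2 * (a + b)     ≡⟨ cong (2 *_) sum ⟩
        2 * n           ≡⟨ cong (n +_) (+-identityʳ n) ⟩
        n + n ∎)
        where open ≤-Reasoning

      ones-half : 2 * ∣ χ ∣ ≤ n
      ones-half = half ∣ χ ∣ ∣ ∁ χ ∣ cards (large (∁ χ) zeros-transversal)

      zeros-half : 2 * ∣ ∁ χ ∣ ≤ n
      zeros-half = half ∣ ∁ χ ∣ ∣ χ ∣ (trans (+-comm ∣ ∁ χ ∣ ∣ χ ∣) cards) (large χ ones-transversal)

      with-color : Bool → Leaf (Fin n) → List (Fin n)
      with-color b     []                = []
      with-color true  ((v , true) ∷ ℓ)  = v ∷ with-color true ℓ
      with-color true  ((v , false) ∷ ℓ) = with-color true ℓ
      with-color false ((v , true) ∷ ℓ)  = with-color false ℓ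
      with-color false ((v , false) ∷ ℓ) = v ∷ with-color false ℓ

      length-with-color : ∀ b ℓ → length (with-color b ℓ) ≡ count b ℓ
      length-with-color b     []                = refl
      length-with-color true  ((v , true) ∷ ℓ)  = cong suc (length-with-color true ℓ)
      length-with-color true  ((v , false) ∷ ℓ) = length-with-color true ℓ
      length-with-color false ((v , true) ∷ ℓ)  = length-with-color false ℓ
      length-with-color false ((v , false) ∷ ℓ) = cong suc (length-with-color false ℓ)

      ∈-with-color : ∀ b ℓ {v} → v ∈ with-color b ℓ → (v , b) ∈ ℓ
      ∈-with-color true  ((v , true) ∷ ℓ)  (here refl) = here refl
      ∈-with-color true  ((v , true) ∷ ℓ)  (there h)   = there (∈-with-color true ℓ h)
      ∈-with-color true  ((v , false) ∷ ℓ) h           = there (∈-with-color true ℓ h)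
      ∈-with-color false ((v , true) ∷ ℓ)  h           = there (∈-with-color false ℓ h)
      ∈-with-color false ((v , false) ∷ ℓ) (here refl) = here refl
      ∈-with-color false ((v , false) ∷ ℓ) (there h)   = there (∈-with-color false ℓ h)

      unique-with-color : ∀ b {ℓ} → Distinct ℓ → Unique (with-color b ℓ)
      unique-with-color b     {[]} []                      = []
      unique-with-color true  {(v , true) ∷ ℓ}  (h ∷ d) = All.tabulate (λ k → All.lookup h (∈-with-color true ℓ k)) ∷ unique-with-color true d
      unique-with-color true  {(v , false) ∷ ℓ} (h ∷ d) = unique-with-color true d
      unique-with-color false {(v , true) ∷ ℓ}  (h ∷ d) = unique-with-color false d
      unique-with-color false {(v , false) ∷ ℓ} (h ∷ d) = All.tabulate (λ k → All.lookup h (∈-with-color false ℓ k)) ∷ unique-with-color false d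

      balanced : Balanced (lookup χ)
      balanced b ℓ d ag = ≤-trans (*-monoʳ-≤ 2 (≤-trans (≤-reflexive (sym (length-with-color b ℓ)))
        (≤-trans (unique-⊆⇒length≤ (unique-with-color b d) (λ {v} h → inside b (All.lookup ag (∈-with-color b ℓ h))))
                 (≤-reflexive (length-members (class b)))))) (bound b)
        where
        class : Bool → Vec Bool n
        class true  = χ
        class false = ∁ χ
        inside : ∀ b {v} → lookup χ v ≡ b → v ∈ members (class b)
        inside true  h = ∈-members⁺ χ h
        inside false {v} h = ∈-members⁺ (∁ χ) ([]=⇒lookup (x∉p⇒x∈∁p {x = v} {p = χ} (λ k → true≢false ([]=⇒lookup k) h)))
        bound : ∀ b → 2 * ∣ class b ∣ ≤ n
        bound true  = ones-half
        bound false = zeros-half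

      -- The color class of x minus x is too small to be a transversal.
      private-edge : ∀ x → lookup χ x ≡ true → ∃[ u ] ∃[ v ] (Edge x u v × lookup χ u ≡ false × lookup χ v ≡ false)
      private-edge x hx = let e , e∈ , empty = find missed in go e e∈ empty (vertices e (All.lookup uniform e∈)) (All.lookup ones-transversal e∈)
        where
        missed : Any (λ e → ¬ Nonempty ((χ -ˢ x) ∩ e)) es
        missed = All.¬All⇒Any¬ (λ e → nonempty? ((χ -ˢ x) ∩ e)) es λ t →
          <⇒≱ (<-≤-trans (*-monoʳ-< 2 (x∈p⇒∣p-x∣<∣p∣ (lookup⇒[]= x χ hx))) ones-half) (large (χ -ˢ x) t)
        go : ∀ e → e ∈ es → ¬ Nonempty ((χ -ˢ x) ∩ e) → ∃[ a ] ∃[ b ] ∃[ c ] (a ≢ b × b ≢ c × a ≢ c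
               × lookup e a ≡ true × lookup e b ≡ true × lookup e c ≡ true) → Nonempty (χ ∩ e) →
             ∃[ u ] ∃[ v ] (Edge x u v × lookup χ u ≡ false × lookup χ v ≡ false)
        go e e∈ empty (a , b , c , ab , bc , ac , ha , hb , hc) (i , i∈) = pick (three e (All.lookup uniform e∈) ha hb hc ab bc ac x∈e)
          where
          is-x : i ≡ x
          is-x with i ≟ x
          ... | yes p = p
          ... | no ne = ⊥-elim (empty (i , x∈p∩q⁺ (x∈p∧x≢y⇒x∈p-y (proj₁ (x∈p∩q⁻ χ e i∈)) ne , proj₂ (x∈p∩q⁻ χ e i∈))))
          x∈e : lookup e x ≡ true
          x∈e = subst (λ i → lookup e i ≡ true) is-x ([]=⇒lookup (proj₂ (x∈p∩q⁻ χ e i∈)))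
          off : ∀ {v} → x ≢ v → lookup e v ≡ true → lookup χ v ≡ false
          off {v} ne hv with dichotomy (lookup χ v)
          ... | inj₂ f = f
          ... | inj₁ t = ⊥-elim (empty (v , x∈p∩q⁺ (x∈p∧x≢y⇒x∈p-y (lookup⇒[]= v χ t) (≢-sym ne) , lookup⇒[]= v e hv)))
          pick : x ≡ a ⊎ x ≡ b ⊎ x ≡ c → ∃[ u ] ∃[ v ] (Edge x u v × lookup χ u ≡ false × lookup χ v ≡ false)
          pick (inj₁ refl)        = b , c , (ab , bc , ac , lose e∈ (ha , hb , hc)) , off ab hb , off ac hc
          pick (inj₂ (inj₁ refl)) = a , c , (≢-sym ab , ac , bc , lose e∈ (hb , ha , hc)) , off (≢-sym ab) ha , off bc hc
          pick (inj₂ (inj₂ refl)) = a , b , (≢-sym ac , ab , ≢-sym bc , lose e∈ (hc , ha , hb)) , off (≢-sym ac) ha , off (≢-sym bc) hb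

      good : Good (lookup χ)
      good = record { proper = λ {u} {v} {w} b e → proper⇒ {χ} prop u v w b e ; critical-edge = private-edge }

-- Correctness and expected time of the enumeration

module Enumerate where

  open Machine
  open Formula
  open Branching
  open Select
  open Bounds
  open Search
  open Code
  open Polynomial
  open Hyper
  open import Data.Fin using (Fin; zero; suc; toℕ)
  import Data.Fin.Properties as Fin
  import Data.List.Properties as List
  open import Data.List.Membership.Propositional.Properties using (∈-cartesianProductWith⁺; ∈-filter⁺; ∈-filter⁻)
  open import Data.List.Membership.Propositional.Properties.WithK using (unique∧set⇒bag)
  open import Data.List.Relation.Binary.BagAndSetEquality using (∼bag⇒↭)
  open import Data.List.Relation.Binary.Permutation.Propositional using (_↭_)
  open import Data.List.Relation.Binary.Permutation.Propositional.Properties using (↭-length)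
  open import Data.List.Relation.Unary.All as All using (All; []; _∷_)
  open import Data.List.Relation.Unary.AllPairs using ([]; _∷_)
  open import Data.List.Relation.Unary.Any using (here; there)
  import Data.List.Relation.Unary.Unique.Propositional.Properties as Unique
  open import Data.Nat
  open import Data.Nat.ListAction using (sum)
  open import Data.Nat.Properties
  open import Data.Nat.Tactic.RingSolver using (solve-∀)
  open import Data.Vec using (toList)
  open import Data.Vec.Properties using (length-toList)
  open import Function using (mk⇔)

  -- The steps are the same for all coins, and a halted machine stays put, so every coin sequence
  -- long enough to halt ends in the same configuration.
  steps-run : ∀ {j C σ} → Steps j C ([] , σ) → ∀ {k} (r : Vec Bool k) → proj₁ (run r C) ≡ [] → run r C ≡ ([] , σ)
  steps-run done       []       e = refl
  steps-run done       (b ∷ r)  e = steps-run done r e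
  steps-run (next h s) []       ()
  steps-run (next h s) (b ∷ r)  e rewrite h b = steps-run s r e

  steps-time : ∀ {j C σ} → Steps j C ([] , σ) → ∀ {k} (r : Vec Bool k) → time r C ≤ j
  steps-time done       []      = z≤n
  steps-time done       (b ∷ r) = z≤n
  steps-time (next h s) []      = z≤n
  steps-time (next h s) (b ∷ r) rewrite h b = s≤s (steps-time s r)

  length-allBits : ∀ k → length (allBits k) ≡ 2 ^ k
  length-allBits zero    = refl
  length-allBits (suc k) = trans (List.length-++ (map (false ∷_) (allBits k))) (cong₂ _+_ (half false)
      (trans (List.length-++ (map (true ∷_) (allBits k))) (cong (_+ 0) (half true))))
    where
    half : ∀ b → length (map (b ∷_) (allBits k)) ≡ 2 ^ k
    half b = trans (List.length-map (b ∷_) (allBits k)) (length-allBits k)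

  sum-bound : ∀ {A : Set} (f : A → ℕ) T xs → (∀ x → f x ≤ T) → sum (map f xs) ≤ length xs * T
  sum-bound f T []       h = z≤n
  sum-bound f T (x ∷ xs) h = +-mono-≤ (h x) (sum-bound f T xs h)

  ∈-allBits : ∀ {n} (χ : Vec Bool n) → χ ∈ allBits n
  ∈-allBits []          = here refl
  ∈-allBits (false ∷ χ) = ∈-cartesianProductWith⁺ _∷_ {xs = false ∷ true ∷ []} (here refl) (∈-allBits χ)
  ∈-allBits (true  ∷ χ) = ∈-cartesianProductWith⁺ _∷_ {xs = false ∷ true ∷ []} (there (here refl)) (∈-allBits χ)

  size-encodeℕ : ∀ m → size (encodeℕ m) ≡ 1 + m * 2
  size-encodeℕ zero    = refl
  size-encodeℕ (suc m) = cong (2 +_) (size-encodeℕ m)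

  size-encodeBool : ∀ b → size (encodeBool b) ≤ 3
  size-encodeBool false = s≤s z≤n
  size-encodeBool true  = ≤-refl

  size-encodeList : ∀ {A : Set} (f : A → Tree) k xs → (∀ x → size (f x) ≤ k) → size (encodeList f xs) ≤ 1 + length xs * suc k
  size-encodeList f k []       h = ≤-refl
  size-encodeList f k (x ∷ xs) h = s≤s (≤-trans (+-mono-≤ (h x) (size-encodeList f k xs h)) (≤-reflexive (+-suc k _)))

  size-encodeBits : ∀ {n} (v : Vec Bool n) → size (encodeBits v) ≤ 1 + n * 4
  size-encodeBits {n} v = ≤-trans (size-encodeList encodeBool 3 (toList v) size-encodeBool)
    (≤-reflexive (cong (λ m → 1 + m * 4) (length-toList v)))

  size-vertex : ∀ {n} (v : Fin n) → size (vertex v) ≤ 1 + n * 2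
  size-vertex {n} v = ≤-trans (≤-reflexive (size-encodeℕ (suc (toℕ v)))) (s≤s (*-monoˡ-≤ 2 (Fin.toℕ<n v)))

  size-entry : ∀ {n} (e : Fin n × Bool) → size (encodeEntry e) ≤ 5 + n * 2
  size-entry {n} (v , b) = s≤s (≤-trans (+-mono-≤ (size-vertex v) (size-encodeBool b)) (≤-reflexive (+-comm (1 + n * 2) 3)))

  edges-size state-size context-size : ℕ → ℕ
  edges-size n   = 1 + suc n ^ 3 * (2 + n * 4)
  state-size n   = 2 + ((1 + n * (6 + n * 2)) + ((1 + suc n * 2) + (1 + suc n * 2)))
  context-size n = 6 + ((1 + n * 2) + ((1 + n * 2) + (edges-size n + state-size n)))

  -- The first factor accounts for one iteration, the second for the number of iterations up to the
  -- factor 6^(n/4), with `2 * suc n` coming from the depth of the search tree.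
  total : ℕ → ℕ
  total n = (5 + suc (body-cost n (context-size n))) * (1 + 8 * (2 * suc n))

  opaque
    poly-total : Poly total
    poly-total = poly-* (poly-+ (poly-const 5) (poly-+ (poly-const 1) poly-body)) (poly-+ (poly-const 1)
        (poly-* (poly-const 8) (poly-* (poly-const 2) poly-suc)))
      where
      linear : ∀ a b → Poly (λ n → a + n * b)
      linear a b = poly-+ (poly-const a) (poly-* poly-id (poly-const b))
      poly-suc : Poly suc
      poly-suc = poly-+ (poly-const 1) poly-id
      poly-edges : Poly edges-size
      poly-edges = poly-+ (poly-const 1) (poly-* (poly-power 3) (linear 2 4))
      poly-budget : Poly (λ n → 1 + suc n * 2)
      poly-budget = poly-+ (poly-const 1) (poly-* poly-suc (poly-const 2))
      poly-state : Poly state-size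
      poly-state = poly-+ (poly-const 2) (poly-+ (poly-+ (poly-const 1) (poly-* poly-id (linear 6 2))) (poly-+ poly-budget poly-budget))
      poly-context : Poly context-size
      poly-context = poly-+ (poly-const 6) (poly-+ (linear 1 2) (poly-+ (linear 1 2) (poly-+ poly-edges poly-state)))
      poly-body : Poly (λ n → body-cost n (context-size n))
      poly-body = poly-+ (poly-+ (poly-const 14) (poly-cost selectᵠ poly-context))
        (poly-* poly-id (poly-+ (poly-const 4) (poly-cost collectᵠ poly-context)))

  module Enumeration {n} (H : Hypergraph n) (uniform : Uniform 3 H) (no-small : NoSmallTransversal H) where

    open Minimal H uniform no-small
    open Local es
    open Explore es

    root-inv : Inv (root n)
    root-inv = record { distinct = [] ; ones≡ = refl ; zeros≡ = refl }

    opaque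
      R : Result (2 * suc n) (root n) nil nil
      R = explore n (root n) root-inv (≤-reflexive (sym (+-identityʳ n))) nil nil

    module R = Result R

    -- Lists without repetitions and with the same members are permutations of each other. Every
    -- proper coloring is found because it is good and balanced and trivially extends the empty log.
    outputs↭ : R.outputs ↭ properColorings H
    outputs↭ = ∼bag⇒↭ (unique∧set⇒bag R.unique (Unique.filter⁺ (proper? H) (allBits-unique n)) λ {χ} → mk⇔
      (λ h → ∈-filter⁺ (proper? H) (∈-allBits χ) (proper⇐ {χ} (proj₂ (All.lookup R.sound h))))
      (λ h → let p = proj₂ (∈-filter⁻ (proper? H) {xs = allBits n} h) in R.exhaustive χ (good {χ} p) (balanced {χ} p) (λ ())))

    colorings-bound : numProperColorings H ^ 4 ≤ 6 ^ n
    colorings-bound = subst (λ m → m ^ 4 ≤ 6 ^ n) (↭-length outputs↭) bound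
      where
      bound : length R.outputs ^ 4 ≤ 6 ^ n
      bound = by (decide es (root n) bad [])
        where
        by : Dec (Bad (root n)) → length R.outputs ^ 4 ≤ 6 ^ n
        by (yes b) = ≤-trans (≤-reflexive (cong (_^ 4) (proj₂ (R.dead b)))) z≤n
        by (no ¬b) = ≤-trans (within-root {1} {length R.outputs} {n} (proj₁ (R.few ¬b any _))) (≤-reflexive (*-identityˡ (6 ^ n)))

    internal-bound : R.internal ^ 4 ≤ (2 * suc n) ^ 4 * 6 ^ n
    internal-bound = by (decide es (root n) bad [])
      where
      by : Dec (Bad (root n)) → R.internal ^ 4 ≤ (2 * suc n) ^ 4 * 6 ^ n
      by (yes b) = ≤-trans (≤-reflexive (cong (_^ 4) (proj₁ (R.dead b)))) z≤n
      by (no ¬b) = within-root {2 * suc n} {R.internal} {n} (proj₂ (R.few ¬b any _))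

    size-state : ∀ σ → Inv σ → size (encodeState σ) ≤ state-size n
    size-state σ inv = s≤s (≤-trans (+-mono-≤ size-log (s≤s (+-mono-≤
        (size-budget (ones σ) (≤-trans (≤-reflexive (Inv.ones≡ inv)) (m∸n≤m (suc n) (2 * count true (log σ)))))
        (size-budget (zeros σ) (≤-trans (≤-reflexive (Inv.zeros≡ inv)) (m∸n≤m (suc n) (2 * count false (log σ))))))))
      (≤-reflexive (+-suc (1 + n * (6 + n * 2)) ((1 + suc n * 2) + (1 + suc n * 2)))))
      where
      size-log : size (encodeList encodeEntry (log σ)) ≤ 1 + n * (6 + n * 2)
      size-log = ≤-trans (size-encodeList encodeEntry (5 + n * 2) (log σ) size-entry)
        (s≤s (*-monoˡ-≤ (6 + n * 2) (distinct-bound (log σ) (Inv.distinct inv))))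
      size-budget : ∀ m → m ≤ suc n → size (encodeℕ m) ≤ 1 + suc n * 2
      size-budget m le = ≤-trans (≤-reflexive (size-encodeℕ m)) (s≤s (*-monoˡ-≤ 2 le))

    size-edges : size (encodeList encodeBits es) ≤ edges-size n
    size-edges = ≤-trans (size-encodeList encodeBits (1 + n * 4) es size-encodeBits)
      (s≤s (*-monoˡ-≤ (2 + n * 4) (uniform-bound n 3 es (Hypergraph.distinct H) uniform)))

    size-context : ∀ {k} {ρ : Vec (Fin n) k} σ → Inv σ → size (encodeEnv ρ) ≤ 2 + (1 + n * 2 + 1) → size (context es σ ρ) ≤ context-size n
    size-context σ inv le = ≤-trans (s≤s (+-mono-≤ le (s≤s (+-mono-≤ (≤-reflexive (size-encodeℕ n))
        (s≤s (+-mono-≤ size-edges (size-state σ inv)))))))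
      (≤-reflexive (arith (1 + n * 2) (edges-size n) (state-size n)))
      where
      arith : ∀ a e s → suc (2 + (a + 1) + suc (a + suc (e + s))) ≡ 6 + (a + (a + (e + s)))
      arith = solve-∀

    size-empty : ∀ σ → Inv σ → size (context es σ []) ≤ context-size n
    size-empty σ inv = size-context {ρ = []} σ inv (s≤s z≤n)

    size-vertex-context : ∀ σ → Inv σ → ∀ (v : Fin n) → size (context es σ (v ∷ [])) ≤ context-size n
    size-vertex-context σ inv v = size-context {ρ = v ∷ []} σ inv
      (≤-trans (s≤s (+-monoˡ-≤ 1 (size-vertex v))) (n≤1+n _))

    T : ℕ
    T = 5 + R.steps * suc (body-cost n (context-size n))

    opaque
     result : ∃[ k ] (k ≤ T × Steps k (Program.start program (encodeHypergraph H)) ([] , emit R.outputs nil ∷ []))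
     result = let k , le , s = code-run es (context-size n) size-vertex-context size-empty R.visits in k , le , s []

    emit-encode : ∀ cs → emit cs nil ≡ encodeList encodeBits cs
    emit-encode []       = refl
    emit-encode (c ∷ cs) = cong (encodeBits c ∙_) (emit-encode cs)

    enumerates : EnumeratesProperColorings program H
    enumerates r halted = R.outputs , outputs↭ , trans (cong (λ C → lookup (proj₂ C) zero) (steps-run (proj₂ (proj₂ result)) r halted))
                                                       (emit-encode R.outputs)

    T-bound : T ^ 4 ≤ total n ^ 4 * 6 ^ n
    T-bound = begin
      T ^ 4                                        ≤⟨ ^⁴-mono linear ⟩
      (b * (1 + 8 * R.internal)) ^ 4               ≡⟨ mul⁴ b (1 + 8 * R.internal) ⟩
      b ^ 4 * (1 + 8 * R.internal) ^ 4             ≤⟨ *-monoʳ-≤ (b ^ 4) nodes ⟩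
      b ^ 4 * (u ^ 4 * 6 ^ n)                      ≡⟨ sym (*-assoc (b ^ 4) (u ^ 4) (6 ^ n)) ⟩
      b ^ 4 * u ^ 4 * 6 ^ n                        ≡⟨ cong (_* 6 ^ n) (sym (mul⁴ b u)) ⟩
      (b * u) ^ 4 * 6 ^ n ∎
      where
      open ≤-Reasoning
      a b u : ℕ
      a = suc (body-cost n (context-size n))
      b = 5 + a
      u = 1 + 8 * (2 * suc n)
      linear : T ≤ b * (1 + 8 * R.internal)
      linear = begin
        5 + R.steps * a                             ≤⟨ +-monoʳ-≤ 5 (*-monoˡ-≤ a R.steps≤) ⟩
        5 + (1 + 8 * R.internal) * a                ≤⟨ +-monoˡ-≤ _ (m≤m*n 5 (1 + 8 * R.internal)) ⟩
        5 * (1 + 8 * R.internal) + (1 + 8 * R.internal) * a ≡⟨ cong (5 * (1 + 8 * R.internal) +_) (*-comm (1 + 8 * R.internal) a) ⟩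
        5 * (1 + 8 * R.internal) + a * (1 + 8 * R.internal) ≡⟨ sym (*-distribʳ-+ (1 + 8 * R.internal) 5 a) ⟩
        b * (1 + 8 * R.internal) ∎
      -- Adding the root to the count is another use of `add⁴`, now with R⁴ = 6^n: the summand 1 is
      -- at most R, and the other one is controlled by `internal-bound`.
      nodes : (1 + 8 * R.internal) ^ 4 ≤ u ^ 4 * 6 ^ n
      nodes = ≤-trans (≤-reflexive (sym (*-identityʳ _))) (add⁴ {1} {8 * R.internal} {1} {8 * (2 * suc n)} {1} {6 ^ n} ≤-refl
        (≤-trans (m^n>0 6 n) (≤-reflexive (sym (+-identityʳ _))))
        (≤-trans (≤-reflexive (trans (*-identityʳ _) (mul⁴ 8 R.internal)))
          (≤-trans (*-monoʳ-≤ (8 ^ 4) internal-bound) (≤-reflexive (trans (sym (*-assoc (8 ^ 4) ((2 * suc n) ^ 4) (6 ^ n)))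
            (cong (_* 6 ^ n) (sym (mul⁴ 8 (2 * suc n)))))))))

    expected-time : ∀ {c d} → (∀ n → total n ≤ c * suc n ^ d) →
      ExpectedTime⁴≤ program (encodeHypergraph H) ((c * suc n ^ d) ^ 4 * 6 ^ n)
    expected-time {c} {d} poly k = begin
      sum (map f (allBits k)) ^ 4               ≤⟨ ^⁴-mono (sum-bound f T (allBits k) (λ r →
                                                     ≤-trans (steps-time (proj₂ (proj₂ result)) r) (proj₁ (proj₂ result)))) ⟩
      (length (allBits k) * T) ^ 4              ≡⟨ cong (λ m → (m * T) ^ 4) (length-allBits k) ⟩
      (2 ^ k * T) ^ 4                           ≡⟨ mul⁴ (2 ^ k) T ⟩
      (2 ^ k) ^ 4 * T ^ 4                       ≤⟨ *-monoʳ-≤ ((2 ^ k) ^ 4) (≤-trans T-bound (*-monoˡ-≤ (6 ^ n) (^⁴-mono (poly n)))) ⟩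
      (2 ^ k) ^ 4 * ((c * suc n ^ d) ^ 4 * 6 ^ n) ∎
      where
      open ≤-Reasoning
      f : Vec Bool k → ℕ
      f r = time r (Program.start program (encodeHypergraph H))

-- Tightness on disjoint copies

module Tight where

  open Enumerate using (∈-allBits)
  import Data.Bool.Properties as Bool
  open import Data.Fin using (Fin; zero; suc; _↑ˡ_; _↑ʳ_)
  open import Data.Fin.Subset using (Subset; _∩_; ∣_∣; Nonempty; ⊥) renaming (_∈_ to _∈ˢ_)
  open import Data.Fin.Subset.Properties using (∣⊥∣≡0; ∉⊥; x∈p∩q⁺; x∈p∩q⁻; nonempty?)
  open import Data.List using (cartesianProductWith)
  import Data.List.Properties as List
  open import Data.List.Membership.Propositional.Properties using (∈-deduplicate⁺; ∈-deduplicate⁻; ∈-++⁺ˡ; ∈-++⁺ʳ; ∈-map⁺; ∈-filter⁺; ∈-filter⁻; ∈-cartesianProductWith⁺; ∈-cartesianProductWith⁻)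
  open import Data.List.Membership.Propositional.Properties.WithK using (unique∧set⇒bag)
  open import Data.List.Relation.Binary.BagAndSetEquality using (∼bag⇒↭)
  open import Data.List.Relation.Binary.Permutation.Propositional using (_↭_)
  open import Data.List.Relation.Binary.Permutation.Propositional.Properties using (↭-length)
  open import Data.List.Relation.Unary.All as All using (All; []; _∷_)
  import Data.List.Relation.Unary.All.Properties as All
  import Data.List.Relation.Unary.Unique.Propositional.Properties as Unique
  open import Data.Nat using (ℕ; zero; suc; _+_; _*_; _^_; _≤_; _≤?_; z≤n)
  open import Data.Nat.Properties using (≤-trans; ≤-reflexive; +-mono-≤; *-distribˡ-+; <⇒≱; +-identityʳ)
  open import Data.Vec using (_++_; splitAt)
  open import Data.Vec.Properties using (≡-dec; lookup-++ˡ; lookup-++ʳ; ++-injective; []=⇒lookup; lookup⇒[]=)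
  open import Function using (mk⇔; _∘_)
  open import Relation.Nullary using (_→-dec_)
  open import Relation.Nullary.Decidable using (toWitness)

  side : ∀ m {n} (j : Fin (m + n)) → (∃[ i ] j ≡ i ↑ˡ n) ⊎ (∃[ k ] j ≡ m ↑ʳ k)
  side zero    j       = inj₂ (j , refl)
  side (suc m) zero    = inj₁ (zero , refl)
  side (suc m) (suc j) with side m j
  ... | inj₁ (i , refl) = inj₁ (suc i , refl)
  ... | inj₂ (k , refl) = inj₂ (k , refl)

  module _ {m n : ℕ} where

    ∈-++ˡ : ∀ {p : Subset m} {q : Subset n} {i} → i ∈ˢ p → i ↑ˡ n ∈ˢ p ++ q
    ∈-++ˡ {p} {q} {i} h = lookup⇒[]= (i ↑ˡ n) (p ++ q) (trans (lookup-++ˡ p q i) ([]=⇒lookup h))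

    ∈-++ʳ : ∀ {p : Subset m} {q : Subset n} {k} → k ∈ˢ q → m ↑ʳ k ∈ˢ p ++ q
    ∈-++ʳ {p} {q} {k} h = lookup⇒[]= (m ↑ʳ k) (p ++ q) (trans (lookup-++ʳ p q k) ([]=⇒lookup h))

    ∈-++ˡ⁻ : ∀ {p : Subset m} {q : Subset n} {i} → i ↑ˡ n ∈ˢ p ++ q → i ∈ˢ p
    ∈-++ˡ⁻ {p} {q} {i} h = lookup⇒[]= i p (trans (sym (lookup-++ˡ p q i)) ([]=⇒lookup h))

    ∈-++ʳ⁻ : ∀ {p : Subset m} {q : Subset n} {k} → m ↑ʳ k ∈ˢ p ++ q → k ∈ˢ q
    ∈-++ʳ⁻ {p} {q} {k} h = lookup⇒[]= k q (trans (sym (lookup-++ʳ p q k)) ([]=⇒lookup h))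

    ∈-left : ∀ {e : Subset m} {j} → j ∈ˢ e ++ ⊥ {n} → ∃[ i ] (j ≡ i ↑ˡ n × i ∈ˢ e)
    ∈-left {e} {j} h with side m j
    ... | inj₁ (i , refl) = i , refl , ∈-++ˡ⁻ {e} {⊥} h
    ... | inj₂ (k , refl) = ⊥-elim (∉⊥ (∈-++ʳ⁻ {e} {⊥} h))

    ∈-right : ∀ {e : Subset n} {j} → j ∈ˢ ⊥ {m} ++ e → ∃[ k ] (j ≡ m ↑ʳ k × k ∈ˢ e)
    ∈-right {e} {j} h with side m j
    ... | inj₁ (i , refl) = ⊥-elim (∉⊥ (∈-++ˡ⁻ {⊥} {e} h))
    ... | inj₂ (k , refl) = k , refl , ∈-++ʳ⁻ {⊥} {e} h

    meets-left : ∀ (T : Subset m) (U : Subset n) e → Nonempty ((T ++ U) ∩ (e ++ ⊥)) → Nonempty (T ∩ e)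
    meets-left T U e (j , h) with x∈p∩q⁻ (T ++ U) (e ++ ⊥) h
    ... | ht , he with ∈-left {e} he
    ... | i , refl , hi = i , x∈p∩q⁺ (∈-++ˡ⁻ {T} {U} ht , hi)

    meets-right : ∀ (T : Subset m) (U : Subset n) e → Nonempty ((T ++ U) ∩ (⊥ ++ e)) → Nonempty (U ∩ e)
    meets-right T U e (j , h) with x∈p∩q⁻ (T ++ U) (⊥ ++ e) h
    ... | ht , he with ∈-right {e} he
    ... | k , refl , hk = k , x∈p∩q⁺ (∈-++ʳ⁻ {T} {U} ht , hk)

    module _ (χ : Coloring m) (ψ : Coloring n) where

      mono-left⁺ : ∀ {e} → Monochromatic χ e → Monochromatic (χ ++ ψ) (e ++ ⊥)
      mono-left⁺ {e} (c , h) = c , λ j j∈ → let i , eq , i∈ = ∈-left {e} j∈ in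
        trans (cong (lookup (χ ++ ψ)) eq) (trans (lookup-++ˡ χ ψ i) (h i i∈))

      mono-left⁻ : ∀ {e} → Monochromatic (χ ++ ψ) (e ++ ⊥) → Monochromatic χ e
      mono-left⁻ {e} (c , h) = c , λ i i∈ → trans (sym (lookup-++ˡ χ ψ i)) (h (i ↑ˡ n) (∈-++ˡ {e} {⊥} i∈))

      mono-right⁺ : ∀ {e} → Monochromatic ψ e → Monochromatic (χ ++ ψ) (⊥ ++ e)
      mono-right⁺ {e} (c , h) = c , λ j j∈ → let k , eq , k∈ = ∈-right {e} j∈ in
        trans (cong (lookup (χ ++ ψ)) eq) (trans (lookup-++ʳ χ ψ k) (h k k∈))

      mono-right⁻ : ∀ {e} → Monochromatic (χ ++ ψ) (⊥ ++ e) → Monochromatic ψ e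
      mono-right⁻ {e} (c , h) = c , λ k k∈ → trans (sym (lookup-++ʳ χ ψ k)) (h (m ↑ʳ k) (∈-++ʳ {⊥} {e} k∈))

  ∣++∣ : ∀ {m n} (p : Subset m) (q : Subset n) → ∣ p ++ q ∣ ≡ ∣ p ∣ + ∣ q ∣
  ∣++∣ []          q = refl
  ∣++∣ (true  ∷ p) q = cong suc (∣++∣ p q)
  ∣++∣ (false ∷ p) q = ∣++∣ p q

  length-cartesianProductWith : ∀ {A B C : Set} (f : A → B → C) xs ys → length (cartesianProductWith f xs ys) ≡ length xs * length ys
  length-cartesianProductWith f []       ys = refl
  length-cartesianProductWith f (x ∷ xs) ys = trans (List.length-++ (map (f x) ys))
    (cong₂ _+_ (List.length-map (f x) ys) (length-cartesianProductWith f xs ys))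

  module Sum {m n} (G : Hypergraph m) (H : Hypergraph n) where

    -- Deduplication preserves membership, so a property of all edges may be checked on the two
    -- families separately.
    all-⊕⁺ : ∀ {P : Subset (m + n) → Set} → All (P ∘ (_++ ⊥)) (edges G) → All (P ∘ (⊥ ++_)) (edges H) → All P (edges (G ⊕ H))
    all-⊕⁺ g h = All.tabulate λ k → All.lookup (All.++⁺ (All.map⁺ g) (All.map⁺ h)) (∈-deduplicate⁻ (≡-dec Bool._≟_) _ k)

    all-⊕⁻ : ∀ {P : Subset (m + n) → Set} → All P (edges (G ⊕ H)) → All (P ∘ (_++ ⊥)) (edges G) × All (P ∘ (⊥ ++_)) (edges H)
    all-⊕⁻ a = All.tabulate (λ k → All.lookup a (∈-deduplicate⁺ (≡-dec Bool._≟_) (∈-++⁺ˡ (∈-map⁺ (_++ ⊥) k))))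
             , All.tabulate (λ k → All.lookup a (∈-deduplicate⁺ (≡-dec Bool._≟_) (∈-++⁺ʳ (map (_++ ⊥) (edges G)) (∈-map⁺ (⊥ ++_) k))))

    uniform-⊕ : ∀ {k} → Uniform k G → Uniform k H → Uniform k (G ⊕ H)
    uniform-⊕ g h = all-⊕⁺
      (All.map (λ {e} eq → trans (∣++∣ e ⊥) (trans (cong₂ _+_ eq (∣⊥∣≡0 n)) (+-identityʳ _))) g)
      (All.map (λ {e} eq → trans (∣++∣ (⊥ {m}) e) (cong₂ _+_ (∣⊥∣≡0 m) eq)) h)

    transversal-⊕ : (∀ T → Transversal G T → m ≤ 2 * ∣ T ∣) → (∀ T → Transversal H T → n ≤ 2 * ∣ T ∣) →
      ∀ T → Transversal (G ⊕ H) T → m + n ≤ 2 * ∣ T ∣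
    transversal-⊕ g h TU t with splitAt m TU
    ... | T , U , refl = ≤-trans (+-mono-≤ (g T (All.map (λ {e} → meets-left T U e) (proj₁ (all-⊕⁻ t))))
                                          (h U (All.map (λ {e} → meets-right T U e) (proj₂ (all-⊕⁻ t)))))
        (≤-reflexive (trans (sym (*-distribˡ-+ 2 ∣ T ∣ ∣ U ∣)) (cong (2 *_) (sym (∣++∣ T U)))))

    -- No edge joins the two vertex sets, so the two halves of a coloring are constrained
    -- independently.
    proper-⊕ : properColorings (G ⊕ H) ↭ cartesianProductWith _++_ (properColorings G) (properColorings H)
    proper-⊕ = ∼bag⇒↭ (unique∧set⇒bag (Unique.filter⁺ (proper? (G ⊕ H)) (allBits-unique (m + n)))
      (Unique.cartesianProductWith⁺ _++_ (λ {x} {y} → ++-injective x y)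
        (Unique.filter⁺ (proper? G) (allBits-unique m)) (Unique.filter⁺ (proper? H) (allBits-unique n)))
      λ {χ} → mk⇔ (to χ) (from χ))
      where
      to : ∀ χ → χ ∈ properColorings (G ⊕ H) → χ ∈ cartesianProductWith _++_ (properColorings G) (properColorings H)
      to χ k with splitAt m χ
      ... | χ₁ , χ₂ , refl = let p = all-⊕⁻ (proj₂ (∈-filter⁻ (proper? (G ⊕ H)) {xs = allBits (m + n)} k)) in
        ∈-cartesianProductWith⁺ _++_
          (∈-filter⁺ (proper? G) (∈-allBits χ₁) (All.map (λ np mono → np (mono-left⁺ χ₁ χ₂ mono)) (proj₁ p)))
          (∈-filter⁺ (proper? H) (∈-allBits χ₂) (All.map (λ np mono → np (mono-right⁺ χ₁ χ₂ mono)) (proj₂ p)))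
      from : ∀ χ → χ ∈ cartesianProductWith _++_ (properColorings G) (properColorings H) → χ ∈ properColorings (G ⊕ H)
      from χ k with ∈-cartesianProductWith⁻ _++_ (properColorings G) (properColorings H) k
      ... | χ₁ , χ₂ , k₁ , k₂ , refl = ∈-filter⁺ (proper? (G ⊕ H)) (∈-allBits (χ₁ ++ χ₂)) (all-⊕⁺
          (All.map (λ {e} np mono → np (mono-left⁻ χ₁ χ₂ mono)) (proj₂ (∈-filter⁻ (proper? G) {xs = allBits m} k₁)))
          (All.map (λ {e} np mono → np (mono-right⁻ χ₁ χ₂ mono)) (proj₂ (∈-filter⁻ (proper? H) {xs = allBits n} k₂))))

    count-⊕ : numProperColorings (G ⊕ H) ≡ numProperColorings G * numProperColorings H
    count-⊕ = trans (↭-length proper-⊕) (length-cartesianProductWith _++_ (properColorings G) (properColorings H))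

  K : Hypergraph 4
  K = complete 3 4

  K-uniform : Uniform 3 K
  K-uniform = refl ∷ refl ∷ refl ∷ refl ∷ []

  -- Settled by evaluating the decision procedure on all 16 vertex sets.
  K-transversal : ∀ T → Transversal K T → 4 ≤ 2 * ∣ T ∣
  K-transversal T = All.lookup (toWitness {a? = All.all? (λ T → All.all? (λ e → nonempty? (T ∩ e)) (edges K) →-dec (4 ≤? 2 * ∣ T ∣)) (allBits 4)} _)
    (∈-allBits T)

  copies-uniform : ∀ m → Uniform 3 (copies m K)
  copies-uniform zero    = []
  copies-uniform (suc m) = Sum.uniform-⊕ K (copies m K) K-uniform (copies-uniform m)

  copies-transversal : ∀ m T → Transversal (copies m K) T → m * 4 ≤ 2 * ∣ T ∣
  copies-transversal zero    T t = z≤n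
  copies-transversal (suc m) = Sum.transversal-⊕ K (copies m K) K-transversal (copies-transversal m)

  copies-count : ∀ m → numProperColorings (copies m K) ≡ 6 ^ m
  copies-count zero    = refl
  -- The 6 is obtained by evaluation: the proper colorings of `K` are those with two vertices of
  -- each color.
  copies-count (suc m) = trans (Sum.count-⊕ K (copies m K)) (cong (6 *_) (copies-count m))

  tight : ∀ m → Uniform 3 (copies m (complete 3 4)) × NoSmallTransversal (copies m (complete 3 4))
              × numProperColorings (copies m (complete 3 4)) ≡ 6 ^ m
  tight m = copies-uniform m , (λ (T , t , lt) → <⇒≱ lt (copies-transversal m T t)) , copies-count m
open Code using (program)
open Enumerate using (poly-total; module Enumeration)
open Tight using (tight)

mainTheorem2 : (∀ n (H : Hypergraph n) → Uniform 3 H → NoSmallTransversal H →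
    numProperColorings H ^ 4 ≤ 6 ^ n)
    ×
    (∃[ A ] ∃[ c ] ∃[ d ]
    (∀ n (H : Hypergraph n) → Uniform 3 H → NoSmallTransversal H →
    EnumeratesProperColorings A H
    × ExpectedTime⁴≤ A (encodeHypergraph H) ((c * suc n ^ d) ^ 4 * 6 ^ n)))
    ×
    (∀ m → Uniform 3 (copies m (complete 3 4))
    × NoSmallTransversal (copies m (complete 3 4))
    × numProperColorings (copies m (complete 3 4)) ≡ 6 ^ m)
mainTheorem2 =
    (λ n H uniform no-small → Enumeration.colorings-bound H uniform no-small)
  , (program , proj₁ poly-total , proj₁ (proj₂ poly-total) , λ n H uniform no-small →
        Enumeration.enumerates H uniform no-small
      , Enumeration.expected-time H uniform no-small {proj₁ poly-total} {proj₁ (proj₂ poly-total)} (proj₂ (proj₂ poly-total)))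
  , tight
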